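{- Let $H\in\{P_6,N,W\}$ and let $G$ be a 2-connected claw-free graph on $n$ vertices. If $G$ satisfies $\varPhi(H,3)$, i.e. every vertex $v$ of $G$ that is an end-vertex of some induced subgraph of $G$ isomorphic to $H$ has $d_G(v)\geq (n+3)/3$, then $G$ is hamiltonian.
   Context: All graphs are finite and simple. A graph is claw-free if it has no induced subgraph isomorphic to $K_{1,3}$. An end-vertex of a graph $H$ is a vertex of degree $1$ in $H$. For a graph $G$ on $n$ vertices, a graph $H$ and a number $k$, $G$ satisfies $\varPhi(H,k)$ if every vertex $v$ of $G$ which is an end-vertex of an induced copy of $H$ in $G$ satisfies $d_G(v)\geq (n+k)/3$. $P_6$ is the path on $6$ vertices. $N$ (the net) is the graph obtained from a triangle by attaching one pendant edge at each of its three vertices. $W$ (the wounded) is the graph obtained from a triangle $xyz$ by adding a new vertex adjacent only to $y$, and a path $z u w$ with two new vertices $u,w$ (so $u$ is adjacent to $z$ and $w$, and $w$ only to $u$). -}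

module Defs where

open import Data.Nat using (ℕ; zero; suc; _+_; _*_; _≤_)
open import Data.Fin using (Fin)
import Data.Fin as Fin
open import Data.Fin.Properties using (_≟_)
open import Data.Bool using (Bool; true; false; if_then_else_; _∨_; _∧_)
open import Data.List using (List; []; _∷_; _++_; [_]; allFin; map)
open import Data.Nat.ListAction using (sum)
open import Data.Bool.ListAction using (any)
open import Data.List.Relation.Unary.Unique.Propositional using (Unique)
open import Data.List.Relation.Unary.Linked using (Linked)
open import Data.List.Membership.Propositional using (_∈_)
open import Data.Product using (Σ; _×_; _,_; ∃)
open import Relation.Binary.PropositionalEquality using (_≡_; _≢_)
open import Relation.Nullary.Decidable using (⌊_⌋)
open import Function.Definitions using (Injective)

record Graph (n : ℕ) : Set where
  field
    adj    : Fin n → Fin n → Bool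
    sym    : ∀ u v → adj u v ≡ adj v u
    irrefl : ∀ v → adj v v ≡ false
open Graph public

Adj : ∀ {n} → Graph n → Fin n → Fin n → Set
Adj G u v = adj G u v ≡ true

degreeOf : ∀ {k} → (Fin k → Fin k → Bool) → Fin k → ℕ
degreeOf {k} a v = sum (map (λ u → if a v u then 1 else 0) (allFin k))

deg : ∀ {n} → Graph n → Fin n → ℕ
deg G v = degreeOf (adj G) v

ClawFree : ∀ {n} → Graph n → Set
ClawFree {n} G = (a b c d : Fin n) → b ≢ c → b ≢ d → c ≢ d →
  Adj G a b → Adj G a c → Adj G a d →
  adj G b c ≡ false → adj G b d ≡ false → adj G c d ≡ false → ⊥'
  where open import Data.Empty renaming (⊥ to ⊥')

data ReachAvoiding {n} (G : Graph n) (x : Fin n) : Fin n → Fin n → Set where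
  here : ∀ {u} → ReachAvoiding G x u u
  step : ∀ {u v w} → Adj G u v → v ≢ x → ReachAvoiding G x v w → ReachAvoiding G x u w

data Reach {n} (G : Graph n) : Fin n → Fin n → Set where
  here : ∀ {u} → Reach G u u
  step : ∀ {u v w} → Adj G u v → Reach G v w → Reach G u w

Connected : ∀ {n} → Graph n → Set
Connected {n} G = (u v : Fin n) → Reach G u v

TwoConnected : ∀ {n} → Graph n → Set
TwoConnected {n} G = 3 ≤ n × Connected G ×
  ((x u v : Fin n) → u ≢ x → v ≢ x → ReachAvoiding G x u v)

Hamiltonian : ∀ {n} → Graph n → Set
Hamiltonian {n} G = Σ (Fin n) λ v₀ → Σ (List (Fin n)) λ rest →
  Unique (v₀ ∷ rest) × ((v : Fin n) → v ∈ (v₀ ∷ rest)) ×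
  Linked (Adj G) ((v₀ ∷ rest) ++ [ v₀ ])

fromEdges : ∀ {k} → List (Fin k × Fin k) → Fin k → Fin k → Bool
fromEdges es i j = any (λ { (a , b) → (⌊ a ≟ i ⌋ ∧ ⌊ b ≟ j ⌋) ∨ (⌊ a ≟ j ⌋ ∧ ⌊ b ≟ i ⌋) }) es

#0 #1 #2 #3 #4 #5 : Fin 6
#0 = Fin.zero
#1 = Fin.suc Fin.zero
#2 = Fin.suc (Fin.suc Fin.zero)
#3 = Fin.suc (Fin.suc (Fin.suc Fin.zero))
#4 = Fin.suc (Fin.suc (Fin.suc (Fin.suc Fin.zero)))
#5 = Fin.suc (Fin.suc (Fin.suc (Fin.suc (Fin.suc Fin.zero))))

P6-adj : Fin 6 → Fin 6 → Bool
P6-adj = fromEdges ((#0 , #1) ∷ (#1 , #2) ∷ (#2 , #3) ∷ (#3 , #4) ∷ (#4 , #5) ∷ [])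

Net-adj : Fin 6 → Fin 6 → Bool
Net-adj = fromEdges ((#0 , #1) ∷ (#1 , #2) ∷ (#0 , #2) ∷ (#0 , #3) ∷ (#1 , #4) ∷ (#2 , #5) ∷ [])

-- wounded: triangle x=0 y=1 z=2, vertex 3 adjacent to y, path z u w with u=4, w=5
W-adj : Fin 6 → Fin 6 → Bool
W-adj = fromEdges ((#0 , #1) ∷ (#1 , #2) ∷ (#0 , #2) ∷ (#1 , #3) ∷ (#2 , #4) ∷ (#4 , #5) ∷ [])

data Forbidden : Set where
  P6 N W : Forbidden

adjOf : Forbidden → Fin 6 → Fin 6 → Bool
adjOf P6 = P6-adj
adjOf N  = Net-adj
adjOf W  = W-adj

EndVertexOfInduced : ∀ {n} → Graph n → Forbidden → Fin n → Set
EndVertexOfInduced {n} G H v = Σ (Fin 6 → Fin n) λ f →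
  Injective _≡_ _≡_ f × ((i j : Fin 6) → adj G (f i) (f j) ≡ adjOf H i j) ×
  Σ (Fin 6) λ i → degreeOf (adjOf H) i ≡ 1 × f i ≡ v

-- Φ(H,k): every end-vertex v of an induced copy of H has d(v) ≥ (n+k)/3,
-- stated over ℕ as 3·d(v) ≥ n + k
Phi : ∀ {n} → Graph n → Forbidden → ℕ → Set
Phi {n} G H k = (v : Fin n) → EndVertexOfInduced G H v → n + k ≤ 3 * deg G v

{-# OPTIONS --safe #-}
module Submission where

-- Adding edges inside the neighbourhood of a vertex at which a diamond is centred keeps a claw-free graph claw-free and
-- does not create hamiltonicity, so G has a closure G* in which every edge lies in one maximal clique and every vertex in
-- at most two (G* is the line graph of a triangle-free graph H). An induced cycle of G* is a cycle of H; one that is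
-- adjacent to everything extends to a Hamilton cycle. If an induced cycle with the most neighbours misses a vertex, an ear
-- through that vertex either ends at one clique, where G* can be cut and treated by induction, or yields a theta: two
-- cliques joined by three legs, each long or a triangle with a free tip. All other configurations improve the cycle.
--
-- In G* two non-adjacent vertices have at most two common neighbours. Three pairwise non-adjacent vertices of degree at
-- least (n + 3)/3 therefore have exactly two common neighbours for each pair and dominate the graph, and then six cliques
-- form a K₃,₃ in H, whose hexagon gives a Hamilton cycle. So it is enough to find three such vertices as ends of copies of
-- P₆, N or W in G. Every clique of G* is connected in G, and an inner vertex of an induced path of G inside a clique has
-- all its neighbours in that clique; hence the legs and the two cliques of a theta can be traversed by induced paths of G.
-- If an end of a copy falls inside a clique of the theta, the copy is built on a shortest path of that clique, so that two
-- ends inside it have no common neighbour, which again contradicts the degree sum.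

open import Data.Nat using (ℕ; zero; suc; _+_; _*_; _≤_; _<_; z≤n; s≤s)
import Data.Nat.Properties as ℕ
open import Data.Nat.ListAction using (sum)
open import Data.Fin using (Fin; zero; suc; toℕ)
open import Data.Fin.Properties using (_≟_; any?; all?; toℕ-injective)
open import Data.Bool using (Bool; true; false; if_then_else_; _∧_; not)
import Data.Bool.Properties as Bool
open import Data.List using (List; []; _∷_; _++_; [_]; allFin; map; length; filter; _ʳ++_)
import Data.List.Properties as List
open import Data.List.Membership.Propositional using (_∈_; _∉_; find; lose)
open import Data.List.Membership.Propositional.Properties using (∈-++⁺ˡ; ∈-++⁺ʳ; ∈-++⁻; ∈-allFin; ∈-filter⁺; ∈-filter⁻)
import Data.List.Relation.Unary.Any as Any
open Any using (here; there)
import Data.List.Relation.Unary.All as All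
open All using (All; []; _∷_)
open import Data.List.Relation.Unary.AllPairs using ([]; _∷_)
open import Data.List.Relation.Unary.Unique.Propositional using (Unique)
import Data.List.Relation.Unary.Unique.Propositional.Properties as Unique
open import Data.List.Relation.Unary.Linked using (Linked; []; [-]; _∷_)
open import Data.List.Relation.Binary.Permutation.Propositional using (_↭_; ↭-refl; ↭-sym; ↭-trans; prep; swap)
open import Data.List.Relation.Binary.Permutation.Propositional.Properties using (∈-resp-↭; ++⁺; ++⁺ˡ; ++⁺ʳ; ++-comm; shift; shifts)
import Data.List.Relation.Binary.Permutation.Propositional.Properties as Perm
open import Data.Product using (Σ; ∃; _×_; _,_; proj₁; proj₂)
open import Data.Sum using (_⊎_; inj₁; inj₂)
open import Data.Unit using (⊤; tt)
open import Data.Empty using (⊥; ⊥-elim)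
open import Relation.Nullary using (¬_; Dec; yes; no; does)
open import Relation.Nullary.Decidable using (_×-dec_; _⊎-dec_; ¬?; ⌊_⌋; decidable-stable; toWitness; True)
open import Relation.Binary.PropositionalEquality using (_≡_; _≢_; refl; sym; trans; cong; cong₂; subst; subst₂)
open import Relation.Binary.Definitions using (tri<; tri≈; tri>)
open import Function using (_∘_; id; case_of_)
open import Defs hiding (sym)

-- Counting

-- The degree condition and the copies of H belong to G, while thetas are found in G*, whose
-- additional edges destroy induced subgraphs of G and raise degrees. Hence most modules carry two
-- graphs, `G₀` for the given one and `G` for its closure: the edges of a copy are edges of `G₀`,
-- the separation of different legs is proved in `G`, where it is stronger, and degrees are taken in
-- `G₀` while common neighbours are bounded in `G`.
--
-- The constant 3 is where the counting becomes tight. For three pairwise non-adjacent vertices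
-- without a neighbour common to all three, the degree sum is at most n - 3 plus the numbers of
-- common neighbours of the three pairs, hence at most n - 3 + 6. Degrees of at least (n + 3)/3
-- reach this bound. They give equality everywhere rather than a contradiction, which is why the
-- closing lemmas end in a Hamilton cycle and not in `⊥`.

bit : Bool → ℕ
bit b = if b then 1 else 0

module _ {A : Set} where

  total : (A → ℕ) → List A → ℕ
  total f l = sum (map f l)

  total-mono : ∀ {f g : A → ℕ} → (∀ x → f x ≤ g x) → ∀ l → total f l ≤ total g l
  total-mono h []      = z≤n
  total-mono h (x ∷ l) = ℕ.+-mono-≤ (h x) (total-mono h l)

  total-strict : ∀ {f g : A → ℕ} → (∀ x → f x ≤ g x) → ∀ {x l} → x ∈ l → f x < g x → total f l < total g l
  total-strict h {l = _ ∷ l} (here refl) lt = ℕ.+-mono-<-≤ lt (total-mono h l)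
  total-strict h {l = y ∷ l} (there i)   lt = ℕ.+-mono-≤-< (h y) (total-strict h i lt)

  total-+ : ∀ (f g : A → ℕ) l → total (λ x → f x + g x) l ≡ total f l + total g l
  total-+ f g []      = refl
  total-+ f g (x ∷ l) rewrite total-+ f g l = interchange (f x) (g x) (total f l) (total g l)
    where
    open import Data.Nat.Solver using (module +-*-Solver)
    open +-*-Solver
    interchange : ∀ a b c d → (a + b) + (c + d) ≡ (a + c) + (b + d)
    interchange = solve 4 (λ a b c d → (a :+ b) :+ (c :+ d) := (a :+ c) :+ (b :+ d)) refl

  total-1 : ∀ (l : List A) → total (λ _ → 1) l ≡ length l
  total-1 []      = refl
  total-1 (_ ∷ l) = cong suc (total-1 l)

  private
    tally : (A → Bool) → List A → ℕ
    tally p = total (bit ∘ p)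

  tally-none : ∀ (p : A → Bool) l → (∀ {x} → x ∈ l → p x ≡ true → ⊥) → tally p l ≡ 0
  tally-none p []      h = refl
  tally-none p (x ∷ l) h with p x in eq
  ... | true  = ⊥-elim (h (here refl) eq)
  ... | false = tally-none p l (h ∘ there)

  tally-≤1 : ∀ (p : A → Bool) {l} → Unique l →
    (∀ {x y} → x ≢ y → p x ≡ true → p y ≡ true → ⊥) → tally p l ≤ 1
  tally-≤1 p [] h = z≤n
  tally-≤1 p {x ∷ l} (x∉ ∷ u) h with p x in eq
  ... | false = tally-≤1 p u h
  ... | true  rewrite tally-none p l (λ i py → h (All.lookup x∉ i) eq py) = ℕ.≤-refl

  tally-≤2 : ∀ (p : A → Bool) {l} → Unique l →
    (∀ {x y z} → x ≢ y → x ≢ z → y ≢ z → p x ≡ true → p y ≡ true → p z ≡ true → ⊥) → tally p l ≤ 2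
  tally-≤2 p [] h = z≤n
  tally-≤2 p {x ∷ l} (x∉ ∷ u) h with p x in eq
  ... | false = tally-≤2 p u h
  ... | true  = s≤s (go u x∉)
    where
    go : ∀ {l} → Unique l → All (x ≢_) l → tally p l ≤ 1
    go [] _ = z≤n
    go {y ∷ l} (y∉ ∷ u) (x≢y ∷ x∉) with p y in eq′
    ... | false = go u x∉
    ... | true  rewrite tally-none p l (λ i pz → h x≢y (All.lookup x∉ i) (All.lookup y∉ i) eq eq′ pz) = ℕ.≤-refl

count : ∀ {n} → (Fin n → Bool) → ℕ
count p = total (bit ∘ p) (allFin _)

bit-mono : ∀ {a b} → (a ≡ true → b ≡ true) → bit a ≤ bit b
bit-mono {false} h = z≤n
bit-mono {true} h rewrite h refl = ℕ.≤-refl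

count-< : ∀ {n} {p q : Fin n → Bool} → (∀ x → p x ≡ true → q x ≡ true) →
  ∀ x → q x ≡ true → p x ≢ true → count p < count q
count-< {p = p} {q} sub x qx ¬px = total-strict (λ y → bit-mono (sub y)) (∈-allFin x) lt
  where
  lt : bit (p x) < bit (q x)
  lt rewrite qx with p x
  ... | true  = ⊥-elim (¬px refl)
  ... | false = s≤s z≤n

∧-true : ∀ {a b} → a ∧ b ≡ true → a ≡ true × b ≡ true
∧-true {true} {true} _ = refl , refl

⌊⌋⁺ : ∀ {P : Set} (d : Dec P) → P → ⌊ d ⌋ ≡ true
⌊⌋⁺ (yes _) p = refl
⌊⌋⁺ (no ¬p) p = ⊥-elim (¬p p)

⌊⌋⁻ : ∀ {P : Set} (d : Dec P) → ⌊ d ⌋ ≡ true → P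
⌊⌋⁻ (yes p) _ = p

-- Closed adjacency, walks and induced paths

module Adjacency {n : ℕ} (G : Graph n) where

  V : Set
  V = Fin n

  infix 4 _~_ _≃_

  _~_ : V → V → Set
  u ~ v = Adj G u v

  -- Closed adjacency and its negation `Far` are the working relations: claws, diamonds and
  -- domination are stated without distinctness hypotheses, so coinciding vertices rarely need a
  -- case of their own.
  _≃_ : V → V → Set
  u ≃ v = u ≡ v ⊎ u ~ v

  Far : V → V → Set
  Far u v = ¬ (u ≃ v)

  _~?_ : ∀ u v → Dec (u ~ v)
  u ~? v = adj G u v Bool.≟ true

  _≃?_ : ∀ u v → Dec (u ≃ v)
  u ≃? v = (u ≟ v) ⊎-dec (u ~? v)

  ~-sym : ∀ {u v} → u ~ v → v ~ u
  ~-sym {u} {v} e = trans (Graph.sym G v u) e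

  ~-irrefl : ∀ {u} → ¬ (u ~ u)
  ~-irrefl {u} e with () ← trans (sym e) (irrefl G u)

  ~⇒≢ : ∀ {u v} → u ~ v → u ≢ v
  ~⇒≢ e refl = ~-irrefl e

  ≃-refl : ∀ {u} → u ≃ u
  ≃-refl = inj₁ refl

  ≃-sym : ∀ {u v} → u ≃ v → v ≃ u
  ≃-sym (inj₁ e) = inj₁ (sym e)
  ≃-sym (inj₂ e) = inj₂ (~-sym e)

  far-sym : ∀ {u v} → Far u v → Far v u
  far-sym f = f ∘ ≃-sym

  ≃⇒~ : ∀ {u v} → u ≢ v → u ≃ v → u ~ v
  ≃⇒~ ne (inj₁ e) = ⊥-elim (ne e)
  ≃⇒~ ne (inj₂ e) = e

  far⇒≢ : ∀ {u v} → Far u v → u ≢ v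
  far⇒≢ f refl = f ≃-refl

  data Walk (P : V → Set) : V → V → Set where
    stop : ∀ {u} → P u → Walk P u u
    go   : ∀ {u v w} → P u → u ~ v → Walk P v w → Walk P u w

  module _ {P : V → Set} where

    steps : ∀ {u v} → Walk P u v → ℕ
    steps (stop _)   = 1
    steps (go _ _ w) = suc (steps w)

    walk-start : ∀ {u v} → Walk P u v → P u
    walk-start (stop p)   = p
    walk-start (go p _ _) = p

    walk-end : ∀ {u v} → Walk P u v → P v
    walk-end (stop p)   = p
    walk-end (go _ _ w) = walk-end w

    walk-trans : ∀ {u v w} → Walk P u v → Walk P v w → Walk P u w
    walk-trans (stop _)    w′ = w′
    walk-trans (go p e w) w′ = go p e (walk-trans w w′)

    walk-snoc : ∀ {u v w} → Walk P u v → v ~ w → P w → Walk P u w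
    walk-snoc w e p = walk-trans w (go (walk-end w) e (stop p))

    walk-sym : ∀ {u v} → Walk P u v → Walk P v u
    walk-sym (stop p)   = stop p
    walk-sym (go p e w) = walk-snoc (walk-sym w) (~-sym e) p

  walk-map : ∀ {P Q : V → Set} → (∀ {x} → P x → Q x) → ∀ {u v} → Walk P u v → Walk Q u v
  walk-map h (stop p)   = stop (h p)
  walk-map h (go p e w) = go (h p) e (walk-map h w)

  data Path : V → V → List V → Set where
    one  : ∀ {u} → Path u u (u ∷ [])
    cons : ∀ {u c v l} → u ~ c → Path c v l → Path u v (u ∷ l)

  path-++ : ∀ {u v w z l m} → Path u v l → v ~ w → Path w z m → Path u z (l ++ m)
  path-++ one        e q = cons e q
  path-++ (cons f p) e q = cons f (path-++ p e q)

  path-reverse : ∀ {u v l} → Path u v l → ∃ λ m → Path v u m × m ↭ l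
  path-reverse one = _ , one , ↭-refl
  path-reverse {u} (cons {l = l} e p) with path-reverse p
  ... | m , q , π = m ++ [ u ] , path-++ q (~-sym e) one , ↭-trans (++-comm m [ u ]) (prep u π)

  path-first : ∀ {u v l} → Path u v l → u ∈ l
  path-first one        = here refl
  path-first (cons _ _) = here refl

  path-last : ∀ {u v l} → Path u v l → v ∈ l
  path-last one        = here refl
  path-last (cons _ p) = there (path-last p)

  data IPath : V → V → List V → Set where
    one  : ∀ {u} → IPath u u (u ∷ [])
    cons : ∀ {u c v l} → u ~ c → (∀ {x} → x ∈ l → Far u x) → IPath c v (c ∷ l) → IPath u v (u ∷ c ∷ l)

  ipath-path : ∀ {u v l} → IPath u v l → Path u v l
  ipath-path one          = one
  ipath-path (cons e _ p) = cons e (ipath-path p)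

  ipath-first : ∀ {u v l} → IPath u v l → u ∈ l
  ipath-first = path-first ∘ ipath-path

  ipath-last : ∀ {u v l} → IPath u v l → v ∈ l
  ipath-last = path-last ∘ ipath-path

  ipath-head∉ : ∀ {u c v l} → IPath u v (u ∷ c ∷ l) → ∀ {x} → x ∈ c ∷ l → u ≢ x
  ipath-head∉ (cons e f p) (here refl) = ~⇒≢ e
  ipath-head∉ (cons e f p) (there i)   = far⇒≢ (f i)

  ipath-unique : ∀ {u v l} → IPath u v l → Unique l
  ipath-unique one            = [] ∷ []
  ipath-unique p@(cons _ _ q) = All.tabulate (ipath-head∉ p) ∷ ipath-unique q

  ipath-snoc : ∀ {u v w l} → IPath u v l → v ~ w → (∀ {x} → x ∈ l → x ≃ w → x ≡ v) → IPath u w (l ++ [ w ])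
  ipath-snoc one e h = cons e (λ ()) one
  ipath-snoc {u} {v} {w} p@(cons {l = l} e f q) e′ h = cons e f′ (ipath-snoc q e′ (h ∘ there))
    where
    f′ : ∀ {x} → x ∈ l ++ [ w ] → Far u x
    f′ i c with ∈-++⁻ l i
    ... | inj₁ j = f j c
    ... | inj₂ (here refl) = ipath-head∉ p (ipath-last q) (h (here refl) c)

  ipath-reverse : ∀ {u v l} → IPath u v l →
    ∃ λ m → IPath v u m × (∀ {x} → x ∈ m → x ∈ l) × (∀ {x} → x ∈ l → x ∈ m)
  ipath-reverse one = _ , one , id , id
  ipath-reverse {u} (cons {c = c} {l = l} e f p) with ipath-reverse p
  ... | m , q , i , j = m ++ [ u ] , ipath-snoc q (~-sym e) only , i′ , j′
    where
    only : ∀ {x} → x ∈ m → x ≃ u → x ≡ c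
    only k cl with i k
    ... | here eq  = eq
    ... | there k′ = ⊥-elim (f k′ (≃-sym cl))
    i′ : ∀ {x} → x ∈ m ++ [ u ] → x ∈ u ∷ c ∷ l
    i′ k with ∈-++⁻ m k
    ... | inj₁ k′         = there (i k′)
    ... | inj₂ (here eq) = here eq
    j′ : ∀ {x} → x ∈ u ∷ c ∷ l → x ∈ m ++ [ u ]
    j′ (here eq) = ∈-++⁺ʳ m (here eq)
    j′ (there k) = ∈-++⁺ˡ (j k)

  ipath-join : ∀ {u v w l m} → IPath u v l → IPath v w (v ∷ m) →
    (∀ {x y} → x ∈ l → y ∈ m → x ≃ y → x ≡ v) → IPath u w (l ++ m)
  ipath-join one q h = q
  ipath-join {u} {v} {m = m} p@(cons {l = l} e f p′) q h = cons e f′ (ipath-join p′ q (h ∘ there))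
    where
    f′ : ∀ {x} → x ∈ l ++ m → Far u x
    f′ i c with ∈-++⁻ l i
    ... | inj₁ j = f j c
    ... | inj₂ j = ipath-head∉ p (ipath-last p′) (h (here refl) j c)

  data Edge (u v : V) : List V → Set where
    here  : ∀ {l} → Edge u v (u ∷ v ∷ l)
    there : ∀ {w l} → Edge u v l → Edge u v (w ∷ l)

  ipath-position : ∀ {u v l z} → IPath u v l → z ∈ l →
    z ≡ u ⊎ z ≡ v ⊎ ∃ λ x → ∃ λ y → x ∈ l × y ∈ l × Edge x z l × Edge z y l × x ~ z × z ~ y × Far x y
  ipath-position p (here refl) with p
  ... | one        = inj₁ refl
  ... | cons _ _ _ = inj₁ refl
  ipath-position (cons e f p) (there i) with ipath-position p i
  ipath-position (cons e f p) (there i) | inj₂ (inj₁ eq) = inj₂ (inj₁ eq)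
  ipath-position (cons e f p) (there i) | inj₂ (inj₂ (x , y , x∈ , y∈ , ex , ey , r)) =
    inj₂ (inj₂ (x , y , there x∈ , there y∈ , there ex , there ey , r))
  ipath-position (cons e f one) (there i) | inj₁ refl = inj₂ (inj₁ refl)
  ipath-position (cons e f (cons e′ _ p)) (there i) | inj₁ refl =
    inj₂ (inj₂ (_ , _ , here refl , there (there (here refl)) , here , there here , e , e′ , f (here refl)))

  -- `x` is the last vertex close to `u`. Unless `u` is `x` itself, it can be put in front of what
  -- remains without creating a chord.
  cut : ∀ u {v w l} → IPath v w l → (∃ λ x → x ∈ l × u ≃ x) →
    ∃ λ x → ∃ λ m → IPath x w (x ∷ m) × u ≃ x × (∀ {y} → y ∈ m → Far u y) ×
      (∀ {y} → y ∈ x ∷ m → y ∈ l) × length (x ∷ m) ≤ length l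
  cut u one (x , here refl , c) = x , [] , one , c , (λ ()) , id , ℕ.≤-refl
  cut u (cons {c = c} {l = l} e f p) ex with Any.any? (u ≃?_) (c ∷ l)
  cut u (cons e f p) ex | yes a with find a
  ... | x , i , cl with cut u p (x , i , cl)
  ... | y , m , q , r , s , t , le = y , m , q , r , s , there ∘ t , ℕ.m≤n⇒m≤1+n le
  cut u (cons e f p) (x , here refl , c) | no ¬a =
    x , _ , cons e f p , c , (λ i r → ¬a (lose i r)) , id , ℕ.≤-refl
  cut u (cons e f p) (x , there i , c) | no ¬a = ⊥-elim (¬a (lose i c))

  -- Chords at each new first vertex are removed by `cut`. The bound on the length later lets a
  -- short walk replace an induced path by a shorter one.
  walk⇒ipath : ∀ {P u v} (w : Walk P u v) →
    ∃ λ l → IPath u v l × (∀ {x} → x ∈ l → P x) × length l ≤ steps w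
  walk⇒ipath (stop p) = _ , one , (λ { (here refl) → p }) , ℕ.≤-refl
  walk⇒ipath {P} (go {u} {v} p e w) with walk⇒ipath w
  ... | l , q , all , le with cut u q (v , ipath-first q , inj₂ e)
  ... | x , m , r , inj₁ refl , far , sub , le′ = _ , r , all ∘ sub , ℕ.m≤n⇒m≤1+n (ℕ.≤-trans le′ le)
  ... | x , m , r , inj₂ e′ , far , sub , le′ = u ∷ x ∷ m , cons e′ far r , all′ , s≤s (ℕ.≤-trans le′ le)
    where
    all′ : ∀ {y} → y ∈ u ∷ x ∷ m → P y
    all′ (here refl) = p
    all′ (there i)   = all (sub i)

  ipath⇒walk : ∀ {P u v l} → IPath u v l → (∀ {x} → x ∈ l → P x) → Σ (Walk P u v) λ w → steps w ≡ length l
  ipath⇒walk one all = stop (all (here refl)) , refl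
  ipath⇒walk (cons e f p) all with ipath⇒walk p (all ∘ there)
  ... | w , eq = go (all (here refl)) e w , cong suc eq

  module Claw (cf : ClawFree G) where

    claw : ∀ {a b c d} → a ≃ b → a ≃ c → a ≃ d → b ≃ c ⊎ b ≃ d ⊎ c ≃ d
    claw (inj₁ refl) ac ad = inj₁ ac
    claw ab@(inj₂ _) (inj₁ refl) ad = inj₁ (≃-sym ab)
    claw ab@(inj₂ _) (inj₂ _) (inj₁ refl) = inj₂ (inj₁ (≃-sym ab))
    claw {a} {b} {c} {d} (inj₂ ab) (inj₂ ac) (inj₂ ad) with b ≃? c | b ≃? d | c ≃? d
    ... | yes p | _ | _ = inj₁ p
    ... | no _ | yes p | _ = inj₂ (inj₁ p)
    ... | no _ | no _ | yes p = inj₂ (inj₂ p)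
    ... | no bc | no bd | no cd =
      ⊥-elim (cf a b c d (far⇒≢ bc) (far⇒≢ bd) (far⇒≢ cd) ab ac ad (≁ bc) (≁ bd) (≁ cd))
      where
      ≁ : ∀ {u v} → Far u v → adj G u v ≡ false
      ≁ f = Bool.¬-not (f ∘ inj₂)

    claw₃ : ∀ {a b c d} → a ≃ b → a ≃ c → a ≃ d → Far b c → Far b d → c ≃ d
    claw₃ ab ac ad bc bd with claw ab ac ad
    ... | inj₁ r = ⊥-elim (bc r)
    ... | inj₂ (inj₁ r) = ⊥-elim (bd r)
    ... | inj₂ (inj₂ r) = r

    claw₂ : ∀ {a b c d} → a ≃ b → a ≃ c → a ≃ d → Far b c → b ≃ d ⊎ c ≃ d
    claw₂ ab ac ad bc with claw ab ac ad
    ... | inj₁ r = ⊥-elim (bc r)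
    ... | inj₂ r = r

-- The closed form of excluding induced K₄ minus an edge
DiamondFree : ∀ {n} → Graph n → Set
DiamondFree G = ∀ {a b x y} → x ~ y → a ≃ x → a ≃ y → b ≃ x → b ≃ y → a ≃ b
  where open Adjacency G

HamiltonianCycleOn : ∀ {n} → Graph n → (Fin n → Set) → Set
HamiltonianCycleOn G S = ∃ λ u → ∃ λ v → ∃ λ l →
  Path u v l × v ~ u × Unique l × (∀ {z} → z ∈ l → S z) × (∀ {z} → S z → z ∈ l)
  where open Adjacency G

-- Local completion preserves non-hamiltonicity

unique-↭ : ∀ {A : Set} {xs ys : List A} → xs ↭ ys → Unique xs → Unique ys
unique-↭ _↭_.refl u = u
unique-↭ (prep x p) (a ∷ u) = Perm.All-resp-↭ p a ∷ unique-↭ p u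
unique-↭ (swap x y p) ((x≢y ∷ ax) ∷ ay ∷ u) =
  ((x≢y ∘ sym) ∷ Perm.All-resp-↭ p ay) ∷ Perm.All-resp-↭ p ax ∷ unique-↭ p u
unique-↭ (_↭_.trans p q) u = unique-↭ q (unique-↭ p u)

unique-disjoint : ∀ {A : Set} (xs : List A) {ys} → Unique (xs ++ ys) → ∀ {x y} → x ∈ xs → y ∈ ys → x ≢ y
unique-disjoint (x ∷ xs) (a ∷ u) (here refl) j = All.lookup a (∈-++⁺ʳ xs j)
unique-disjoint (x ∷ xs) (a ∷ u) (there i)   j = unique-disjoint xs u i j

unique-left : ∀ {A : Set} (xs : List A) {ys} → Unique (xs ++ ys) → Unique xs
unique-left []       u       = []
unique-left (x ∷ xs) (a ∷ u) = All.tabulate (λ i → All.lookup a (∈-++⁺ˡ i)) ∷ unique-left xs u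

unique-right : ∀ {A : Set} (xs : List A) {ys} → Unique (xs ++ ys) → Unique ys
unique-right []       u       = u
unique-right (x ∷ xs) (_ ∷ u) = unique-right xs u

bool-ext : ∀ {a b : Bool} → (a ≡ true → b ≡ true) → (b ≡ true → a ≡ true) → a ≡ b
bool-ext {false} {false} f g = refl
bool-ext {false} {true}  f g = g refl
bool-ext {true}  {false} f g = sym (f refl)
bool-ext {true}  {true}  f g = refl

module _ {n : ℕ} (G : Graph n) where
  open Adjacency G

  path-split : ∀ {u v l y} → Path u v l → y ∈ l → y ≡ u ⊎ y ≡ v ⊎
    ∃ λ s → ∃ λ t → ∃ λ m₁ → ∃ λ m₂ → Path u s m₁ × s ~ y × y ~ t × Path t v m₂ × l ≡ m₁ ++ y ∷ m₂
  path-split one (here refl) = inj₁ refl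
  path-split (cons _ _) (here refl) = inj₁ refl
  path-split (cons e p) (there i) with path-split p i
  path-split (cons e one) (there i) | inj₁ refl = inj₂ (inj₁ refl)
  path-split (cons e (cons f p)) (there i) | inj₁ refl =
    inj₂ (inj₂ (_ , _ , _ , _ , one , e , f , p , refl))
  path-split (cons e p) (there i) | inj₂ (inj₁ eq) = inj₂ (inj₁ eq)
  path-split (cons e p) (there i) | inj₂ (inj₂ (s , t , m₁ , m₂ , p₁ , f , g , p₂ , eq)) =
    inj₂ (inj₂ (s , t , _ , m₂ , cons e p₁ , f , g , p₂ , cong (_ ∷_) eq))

  cycle-open : ∀ {u v l x} → Path u v l → v ~ u → x ∈ l →
    ∃ λ s → ∃ λ t → ∃ λ m → Path s t m × x ~ s × x ~ t × (x ∷ m) ↭ l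
  cycle-open p e i with path-split p i
  cycle-open one e i | inj₁ refl = ⊥-elim (~-irrefl e)
  cycle-open (cons f p) e i | inj₁ refl = _ , _ , _ , p , f , ~-sym e , ↭-refl
  cycle-open p e i | inj₂ (inj₁ refl) with path-reverse p
  ... | _ , one , π = ⊥-elim (~-irrefl e)
  ... | _ , cons f q , π = _ , _ , _ , q , f , e , π
  cycle-open {x = x} p e i | inj₂ (inj₂ (s , t , m₁ , m₂ , p₁ , f , g , p₂ , eq)) =
    t , s , m₂ ++ m₁ , path-++ p₂ e p₁ , g , ~-sym f , subst (_ ↭_) (sym eq) (++-comm (x ∷ m₂) m₁)

  module Rejoin (cf : ClawFree G) (x : V) where
    open Claw cf

    Closing : List V → Set
    Closing l = ∃ λ u → ∃ λ v → ∃ λ m → Path u v m × x ~ u × x ~ v × m ↭ l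

    -- A Hamilton cycle of the completion, without `x` and the added edges, falls into paths with
    -- both ends in N(x). As N(x) contains no three pairwise far vertices, joining paths at close
    -- ends stops only at one path (`Closing`) or at two paths of which no end of one is close to an
    -- end of the other.
    record Stuck (l : List V) : Set where
      constructor stuck
      field
        {p p′ q q′} : V
        {m₁ m₂}     : List V
        path₁ : Path p p′ m₁
        path₂ : Path q q′ m₂
        xp    : x ~ p
        xp′   : x ~ p′
        xq    : x ~ q
        xq′   : x ~ q′
        pq    : Far p q
        pq′   : Far p q′
        p′q   : Far p′ q
        p′q′  : Far p′ q′
        perm  : m₁ ++ m₂ ↭ l

    Outcome : List V → Set
    Outcome l = Closing l ⊎ Stuck l

    join : ∀ {u v p p′ m l} → Path u v m → x ~ u → x ~ v → Path p p′ l → x ~ p → x ~ p′ →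
      v ~ p → Closing (m ++ l)
    join a xu xv b xp xp′ e = _ , _ , _ , path-++ a e b , xu , xp′ , ↭-refl

    closing-↭ : ∀ {l l′} → l ↭ l′ → Closing l → Closing l′
    closing-↭ π (u , v , m , p , xu , xv , ρ) = u , v , m , p , xu , xv , ↭-trans ρ π

    outcome-↭ : ∀ {l l′} → l ↭ l′ → Outcome l → Outcome l′
    outcome-↭ π (inj₁ c) = inj₁ (closing-↭ π c)
    outcome-↭ π (inj₂ (stuck a b c d e f g h i j ρ)) = inj₂ (stuck a b c d e f g h i j (↭-trans ρ π))

    pair : ∀ {u v p p′ m l} → Path u v m → x ~ u → x ~ v → Path p p′ l → x ~ p → x ~ p′ →
      Unique (m ++ l) → Outcome (m ++ l)
    pair {u} {v} {p} {p′} {m} {l} a xu xv b xp xp′ un with v ~? p | v ~? p′ | u ~? p | u ~? p′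
    ... | yes e | _ | _ | _ = inj₁ (join a xu xv b xp xp′ e)
    ... | no _ | yes e | _ | _ with path-reverse b
    ...   | l′ , b′ , π = inj₁ (closing-↭ (++⁺ˡ m π) (join a xu xv b′ xp′ xp e))
    pair {u} {v} {p} {p′} {m} {l} a xu xv b xp xp′ un | no _ | no _ | yes e | _ with path-reverse a
    ...   | m′ , a′ , π = inj₁ (closing-↭ (++⁺ʳ l π) (join a′ xv xu b xp xp′ e))
    pair {u} {v} {p} {p′} {m} {l} a xu xv b xp xp′ un | no _ | no _ | no _ | yes e with path-reverse a | path-reverse b
    ...   | m′ , a′ , π | l′ , b′ , ρ = inj₁ (closing-↭ (++⁺ π ρ) (join a′ xv xu b′ xp′ xp e))
    pair {u} {v} {p} {p′} {m} {l} a xu xv b xp xp′ un | no vp | no vp′ | no up | no up′ =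
      inj₂ (stuck a b xu xv xp xp′ (far u∈ p∈ up) (far u∈ p′∈ up′) (far v∈ p∈ vp) (far v∈ p′∈ vp′) ↭-refl)
      where
      u∈ = path-first a
      v∈ = path-last a
      p∈ = path-first b
      p′∈ = path-last b
      far : ∀ {s t} → s ∈ m → t ∈ l → ¬ s ~ t → Far s t
      far i j ne (inj₁ eq) = unique-disjoint m un i j eq
      far i j ne (inj₂ e)  = ne e

    -- The ends `p` and `q` of the stuck paths are far, so the claw at `x` makes the end `v` of the
    -- new path close to one of them, and two paths remain.
    insert : ∀ {u v m l} → Path u v m → x ~ u → x ~ v → Outcome l → Unique (m ++ l) → Outcome (m ++ l)
    insert {m = m} a xu xv (inj₁ (p , p′ , l′ , b , xp , xp′ , π)) un =
      outcome-↭ (++⁺ˡ m π) (pair a xu xv b xp xp′ (unique-↭ (++⁺ˡ m (↭-sym π)) un))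
    insert {m = m} {l} a xu xv (inj₂ (stuck {m₁ = m₁} {m₂} a₁ a₂ xp xp′ xq xq′ pq _ _ _ π)) un
      with claw₂ (inj₂ xp) (inj₂ xq) (inj₂ xv) pq
    ... | inj₁ r = outcome-↭ ρ (pair (path-++ a (~-sym (≃⇒~ (dis (∈-++⁺ˡ (path-first a₁))) r)) a₁) xu xp′ a₂ xq xq′ (unique-↭ (↭-sym ρ) un))
      where
      ρ : (m ++ m₁) ++ m₂ ↭ m ++ l
      ρ = ↭-trans (Perm.++-assoc m m₁ m₂) (++⁺ˡ m π)
      dis : ∀ {t} → t ∈ m₁ ++ m₂ → t ≢ _
      dis i eq = unique-disjoint m un (path-last a) (∈-resp-↭ π i) (sym eq)
    ... | inj₂ r = outcome-↭ ρ (pair (path-++ a (~-sym (≃⇒~ (dis (∈-++⁺ʳ m₁ (path-first a₂))) r)) a₂) xu xq′ a₁ xp xp′ (unique-↭ (↭-sym ρ) un))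
      where
      ρ : (m ++ m₂) ++ m₁ ↭ m ++ l
      ρ = ↭-trans (Perm.++-assoc m m₂ m₁) (++⁺ˡ m (↭-trans (++-comm m₂ m₁) π))
      dis : ∀ {t} → t ∈ m₁ ++ m₂ → t ≢ _
      dis i eq = unique-disjoint m un (path-last a) (∈-resp-↭ π i) (sym eq)

    module _ {m p p′} (a : Path p p′ m) (un : Unique m) (x∉ : x ∉ m) (pp′ : p ≃ p′) (xp : x ~ p) (xp′ : x ~ p′) where

      -- y either has a path-neighbour in N(x), where the closed path can be cut open, or can be bypassed
      reopen : ∀ {y} → y ∈ m → x ~ y →
        (∃ λ e → ∃ λ m′ → Path y e m′ × x ~ e × m′ ↭ m) ⊎
        (∃ λ m′ → Path p p′ m′ × (y ∷ m′) ↭ m × y ≢ p × y ≢ p′)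
      reopen {y} i xy with y ≟ p | y ≟ p′ | path-split a i
      ... | yes refl | _ | _ = inj₁ (_ , _ , a , xp′ , ↭-refl)
      ... | no _ | yes refl | _ with path-reverse a
      ...   | m′ , a′ , π = inj₁ (_ , _ , a′ , xp , π)
      reopen {y} i xy | no ne | no _ | inj₁ eq = ⊥-elim (ne eq)
      reopen {y} i xy | no _ | no ne | inj₂ (inj₁ eq) = ⊥-elim (ne eq)
      reopen {y} i xy | no ne | no ne′ | inj₂ (inj₂ (s , t , m₁ , m₂ , b₁ , e , f , b₂ , refl)) with x ~? s | x ~? t
      ... | yes xs | _ = inj₁ (s , y ∷ m₂ ++ m₁ , cons f (path-++ b₂ (~-sym (≃⇒~ (dis (path-first b₁) (path-last b₂)) pp′)) b₁) , xs , ++-comm (y ∷ m₂) m₁)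
        where
        dis : ∀ {c d} → c ∈ m₁ → d ∈ m₂ → c ≢ d
        dis i j = unique-disjoint m₁ un i (there j)
      ... | no _ | yes xt with path-reverse b₁ | path-reverse b₂
      ...   | m₁′ , b₁′ , π | m₂′ , b₂′ , ρ =
        inj₁ (t , y ∷ m₁′ ++ m₂′ , cons (~-sym e) (path-++ b₁′ (≃⇒~ (dis (path-first b₁) (path-last b₂)) pp′) b₂′) , xt ,
              ↭-trans (prep y (++⁺ π ρ)) (↭-sym (shift y m₁ m₂)))
        where
        dis : ∀ {c d} → c ∈ m₁ → d ∈ m₂ → c ≢ d
        dis i j = unique-disjoint m₁ un i (there j)
      reopen {y} i xy | no ne | no ne′ | inj₂ (inj₂ (s , t , m₁ , m₂ , b₁ , e , f , b₂ , refl)) | no xs | no xt =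
        inj₂ (m₁ ++ m₂ , path-++ b₁ st b₂ , ↭-sym (shift y m₁ m₂) , ne , ne′)
        where
        farx : ∀ {c} → c ∈ m₁ ++ y ∷ m₂ → ¬ x ~ c → Far x c
        farx j ne (inj₁ refl) = x∉ j
        farx j ne (inj₂ e)    = ne e
        st : s ~ t
        st = ≃⇒~ (unique-disjoint m₁ un (path-last b₁) (there (path-first b₂)))
               (claw₃ (inj₂ (~-sym xy)) (inj₂ (~-sym e)) (inj₂ f)
                 (farx (∈-++⁺ˡ (path-last b₁)) xs) (farx (∈-++⁺ʳ m₁ (there (path-first b₂))) xt))

    -- Stuck paths have close ends, so each of them closes up. The neighbours `y` and `z` of `x`
    -- serve as hooks for the first and the second path; wherever they lie on the paths, `y ≃ z`
    -- suffices to join the two.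
    record Split (y z : V) (l : List V) : Set where
      constructor split
      field
        {p p′ q q′} : V
        {m₁ m₂}     : List V
        path₁ : Path p p′ m₁
        path₂ : Path q q′ m₂
        xp    : x ~ p
        xp′   : x ~ p′
        xq    : x ~ q
        xq′   : x ~ q′
        pp′   : p ≃ p′
        qq′   : q ≃ q′
        yp    : y ≃ p
        yp′   : y ≃ p′
        zq    : z ≃ q
        zq′   : z ≃ q′
        perm  : m₁ ++ m₂ ↭ l

    module _ {l} (un : Unique l) (x∉ : x ∉ l) (all : ∀ {y} → x ~ y → y ∈ l) where

      private
        uniq : ∀ {m} → m ↭ l → Unique m
        uniq π = unique-↭ (↭-sym π) un
        x∉′ : ∀ {m} → m ↭ l → x ∉ m
        x∉′ π i = x∉ (∈-resp-↭ π i)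

      merge-same : ∀ {y} → x ~ y → Split y y l → Closing l
      merge-same {y} xy (split {m₁ = m₁} {m₂} a b xp xp′ xq xq′ pp′ qq′ yp yp′ yq yq′ π)
        with ∈-++⁻ m₁ (∈-resp-↭ (↭-sym π) (all xy))
      ... | inj₁ i with reopen a (unique-left m₁ (uniq π)) (x∉′ π ∘ ∈-++⁺ˡ) pp′ xp xp′ i xy
      ...   | inj₁ (e , m′ , c , xe , ρ) with path-reverse c
      ...     | m″ , c′ , ρ′ =
        closing-↭ (↭-trans (++⁺ʳ m₂ (↭-trans ρ′ ρ)) π)
          (join c′ xe xy b xq xq′ (≃⇒~ (unique-disjoint m₁ (uniq π) i (path-first b)) yq))
      merge-same {y} xy (split {m₁ = m₁} {m₂} a b xp xp′ xq xq′ pp′ qq′ yp yp′ yq yq′ π)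
        | inj₁ i | inj₂ (m′ , c , ρ , y≢p , y≢p′) =
        closing-↭ (↭-trans (shift y m′ m₂) (↭-trans (++⁺ʳ m₂ ρ) π))
          (_ , _ , m′ ++ y ∷ m₂ , path-++ c (~-sym (≃⇒~ y≢p′ yp′)) (cons (≃⇒~ (unique-disjoint m₁ (uniq π) i (path-first b)) yq) b) ,
            xp , xq′ , ↭-refl)
      merge-same {y} xy (split {m₁ = m₁} {m₂} a b xp xp′ xq xq′ pp′ qq′ yp yp′ yq yq′ π)
        | inj₂ i with reopen b (unique-right m₁ (uniq π)) (x∉′ π ∘ ∈-++⁺ʳ m₁) qq′ xq xq′ i xy
      ... | inj₁ (e , m′ , c , xe , ρ) =
        closing-↭ (↭-trans (++⁺ˡ m₁ ρ) π)
          (join a xp xp′ c xy xe (~-sym (≃⇒~ (unique-disjoint m₁ (uniq π) (path-last a) i ∘ sym) yp′)))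
      ... | inj₂ (m′ , c , ρ , y≢q , y≢q′) =
        closing-↭ (↭-trans (++⁺ˡ m₁ ρ) π)
          (_ , _ , m₁ ++ y ∷ m′ , path-++ a (~-sym (≃⇒~ (unique-disjoint m₁ (uniq π) (path-last a) i ∘ sym) yp′)) (cons (≃⇒~ y≢q yq) c) ,
            xp , xq′ , ↭-refl)

      attach : ∀ {y m} {p p′} → Path p p′ m → Unique m → x ∉ m → p ≃ p′ → x ~ p → x ~ p′ → y ≃ p → y ∈ m → x ~ y →
        ∃ λ e → ∃ λ m′ → Path y e m′ × x ~ e × m′ ↭ m
      attach a un x∉ pp′ xp xp′ yp i xy with reopen a un x∉ pp′ xp xp′ i xy
      ... | inj₁ r = r
      ... | inj₂ (m′ , c , ρ , y≢p , _) = _ , _ , cons (≃⇒~ y≢p yp) c , xp′ , ρ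

      merge-placed : ∀ {y z} → x ~ y → x ~ z → y ~ z → (s : Split y z l) →
        y ∈ Split.m₁ s → z ∈ Split.m₂ s → Closing l
      merge-placed xy xz yz (split {m₁ = m₁} {m₂} a b xp xp′ xq xq′ pp′ qq′ yp yp′ zq zq′ π) i j
        with attach a (unique-left m₁ (uniq π)) (x∉′ π ∘ ∈-++⁺ˡ) pp′ xp xp′ yp i xy
           | attach b (unique-right m₁ (uniq π)) (x∉′ π ∘ ∈-++⁺ʳ m₁) qq′ xq xq′ zq j xz
      ... | e , m₁′ , c , xe , ρ | f , m₂′ , d , xf , σ with path-reverse c
      ... | m₁″ , c′ , ρ′ = closing-↭ (↭-trans (++⁺ (↭-trans ρ′ ρ) σ) π) (join c′ xe xy d xz xf yz)

      -- If `z` lies on the first path as well, that path is either reopened so as to end at `z`,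
      -- next to the second path, or made to bypass `z`, which then moves to the front of the second
      -- path.
      merge-first : ∀ {y z} → x ~ y → x ~ z → y ~ z → (s : Split y z l) → y ∈ Split.m₁ s → Closing l
      merge-first {y} {z} xy xz yz s@(split {m₁ = m₁} {m₂} a b xp xp′ xq xq′ pp′ qq′ yp yp′ zq zq′ π) i
        with ∈-++⁻ m₁ (∈-resp-↭ (↭-sym π) (all xz))
      ... | inj₂ j = merge-placed xy xz yz s i j
      ... | inj₁ j with reopen a (unique-left m₁ (uniq π)) (x∉′ π ∘ ∈-++⁺ˡ) pp′ xp xp′ j xz
      ...   | inj₁ (e , m′ , c , xe , ρ) with path-reverse c
      ...     | m″ , c′ , ρ′ =
        closing-↭ (↭-trans (++⁺ʳ m₂ (↭-trans ρ′ ρ)) π)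
          (join c′ xe xz b xq xq′ (≃⇒~ (unique-disjoint m₁ (uniq π) j (path-first b)) zq))
      merge-first {y} {z} xy xz yz s@(split {m₁ = m₁} {m₂} a b xp xp′ xq xq′ pp′ qq′ yp yp′ zq zq′ π) i
        | inj₁ j | inj₂ (m′ , c , ρ , _ , _) =
        merge-placed xy xz yz
          (split c (cons (≃⇒~ (unique-disjoint m₁ (uniq π) j (path-first b)) zq) b) xp xp′ xz xq′ pp′ zq′ yp yp′ ≃-refl zq′
            (↭-trans (shift z m′ m₂) (↭-trans (++⁺ʳ m₂ ρ) π)))
          (y∈ (∈-resp-↭ (↭-sym ρ) i)) (here refl)
        where
        y∈ : y ∈ z ∷ m′ → y ∈ m′
        y∈ (here eq) = ⊥-elim (~⇒≢ yz eq)
        y∈ (there k) = k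

      merge : ∀ {y z} → x ~ y → x ~ z → y ≃ z → Split y z l → Closing l
      merge xy xz (inj₁ refl) s = merge-same xy s
      merge {y} {z} xy xz (inj₂ yz) s@(split {m₁ = m₁} {m₂} a b xp xp′ xq xq′ pp′ qq′ yp yp′ zq zq′ π)
        with ∈-++⁻ m₁ (∈-resp-↭ (↭-sym π) (all xy))
      ... | inj₁ i = merge-first xy xz yz s i
      ... | inj₂ i with reopen b (unique-right m₁ (uniq π)) (x∉′ π ∘ ∈-++⁺ʳ m₁) qq′ xq xq′ i xy
      ...   | inj₁ (e , m′ , c , xe , ρ) =
        closing-↭ (↭-trans (++⁺ˡ m₁ ρ) π)
          (join a xp xp′ c xy xe (~-sym (≃⇒~ (unique-disjoint m₁ (uniq π) (path-last a) i ∘ sym) yp′)))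
      ...   | inj₂ (m′ , c , ρ , _ , _) =
        merge-first xy xz yz
          (split (cons (≃⇒~ (unique-disjoint m₁ (uniq π) (path-first a) i ∘ sym) yp) a) c xy xp′ xq xq′ yp′ qq′ ≃-refl yp′ zq zq′
            (↭-trans (↭-trans (↭-sym (shift y m₁ m′)) (++⁺ˡ m₁ ρ)) π))
          (here refl)

      -- the two stuck paths are closed, and every neighbour of x is close to both ends of one of them
      unstick : ∀ {a b c} → x ~ a → x ~ b → x ~ c → Far a b → a ~ c → b ~ c → Stuck l → Closing l
      unstick {a} {b} {c} xa xb xc ab ac bc (stuck {p} {p′} {q} {q′} u v xp xp′ xq xq′ pq pq′ p′q p′q′ π) =
        chain (touches xp) (touches xq)
        where
        pp′ : p ≃ p′
        pp′ = claw₃ (inj₂ xq) (inj₂ xp) (inj₂ xp′) (far-sym pq) (far-sym p′q)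
        qq′ : q ≃ q′
        qq′ = claw₃ (inj₂ xp) (inj₂ xq) (inj₂ xq′) pq pq′
        Left Right : V → Set
        Left t = t ≃ p × t ≃ p′
        Right t = t ≃ q × t ≃ q′
        side : ∀ {t} → x ~ t → Left t ⊎ Right t
        side {t} xt with t ≃? p | t ≃? p′
        ... | yes r | yes s = inj₁ (r , s)
        ... | no f | _ = inj₂ (claw₃ (inj₂ xp) (inj₂ xt) (inj₂ xq) (far-sym f) pq , claw₃ (inj₂ xp) (inj₂ xt) (inj₂ xq′) (far-sym f) pq′)
        ... | yes _ | no f = inj₂ (claw₃ (inj₂ xp′) (inj₂ xt) (inj₂ xq) (far-sym f) p′q , claw₃ (inj₂ xp′) (inj₂ xt) (inj₂ xq′) (far-sym f) p′q′)
        bridge : ∀ {y z} → x ~ y → x ~ z → Left y → Right z → y ≃ z → Closing l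
        bridge xy xz (yp , yp′) (zq , zq′) yz =
          merge xy xz yz (split u v xp xp′ xq xq′ pp′ qq′ yp yp′ zq zq′ π)
        touches : ∀ {t} → x ~ t → ∃ λ s → x ~ s × t ≃ s × s ≃ c
        touches xt with claw₂ (inj₂ xa) (inj₂ xb) (inj₂ xt) ab
        ... | inj₁ r = a , xa , ≃-sym r , inj₂ ac
        ... | inj₂ r = b , xb , ≃-sym r , inj₂ bc
        Lp : Left p
        Lp = ≃-refl , pp′
        Rq : Right q
        Rq = ≃-refl , qq′
        -- By the diamond, `p`, `s`, `c`, `t`, `q` is a sequence of consecutively close vertices in
        -- N(x) leading from the left side to the right side. The paths are merged where it changes
        -- sides.
        chain : (∃ λ s → x ~ s × p ≃ s × s ≃ c) → (∃ λ s → x ~ s × q ≃ s × s ≃ c) → Closing l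
        chain (s , xs , ps , sc) (t , xt , qt , tc) with side xs | side xc | side xt
        ... | inj₂ R | _ | _ = bridge xp xs Lp R ps
        ... | inj₁ L | inj₂ R | _ = bridge xs xc L R sc
        ... | inj₁ _ | inj₁ L | inj₂ R = bridge xc xt L R (≃-sym tc)
        ... | inj₁ _ | inj₁ _ | inj₁ L = bridge xt xq L Rq (≃-sym qt)

module _ {n : ℕ} (G : Graph n) (x : Fin n) where
  open Adjacency G

  CompletedEdge : V → V → Set
  CompletedEdge u v = u ~ v ⊎ (x ~ u × x ~ v × u ≢ v)

  completedEdge? : ∀ u v → Dec (CompletedEdge u v)
  completedEdge? u v = (u ~? v) ⊎-dec ((x ~? u) ×-dec ((x ~? v) ×-dec ¬? (u ≟ v)))

  completedEdge-sym : ∀ {u v} → CompletedEdge u v → CompletedEdge v u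
  completedEdge-sym (inj₁ e) = inj₁ (~-sym e)
  completedEdge-sym (inj₂ (a , b , c)) = inj₂ (b , a , c ∘ sym)

  completion : Graph n
  completion .adj u v = ⌊ completedEdge? u v ⌋
  completion .Graph.sym u v = bool-ext (flip u v) (flip v u)
    where
    flip : ∀ u v → ⌊ completedEdge? u v ⌋ ≡ true → ⌊ completedEdge? v u ⌋ ≡ true
    flip u v t = ⌊⌋⁺ (completedEdge? v u) (completedEdge-sym (⌊⌋⁻ (completedEdge? u v) t))
  completion .irrefl v with completedEdge? v v
  ... | no _ = refl
  ... | yes (inj₁ e) = ⊥-elim (~-irrefl e)
  ... | yes (inj₂ (_ , _ , ne)) = ⊥-elim (ne refl)

  private module C = Adjacency completion

  completed⁺ : ∀ {u v} → CompletedEdge u v → u C.~ v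
  completed⁺ = ⌊⌋⁺ (completedEdge? _ _)

  completed⁻ : ∀ {u v} → u C.~ v → CompletedEdge u v
  completed⁻ = ⌊⌋⁻ (completedEdge? _ _)

  completed-≃ : ∀ {u v} → x ≃ u → x ≃ v → u C.≃ v
  completed-≃ {u} {v} (inj₁ refl) (inj₁ refl) = inj₁ refl
  completed-≃ {u} {v} (inj₁ refl) (inj₂ e) = inj₂ (completed⁺ (inj₁ e))
  completed-≃ {u} {v} (inj₂ e) (inj₁ refl) = inj₂ (completed⁺ (inj₁ (~-sym e)))
  completed-≃ {u} {v} (inj₂ e) (inj₂ f) = case u ≟ v of λ where
    (yes eq) → inj₁ eq
    (no ne)  → inj₂ (completed⁺ (inj₂ (e , f , ne)))

  completion-clawFree : ClawFree G → ClawFree completion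
  completion-clawFree cf a b c d b≢c b≢d c≢d ab ac ad bc bd cd =
    cases (completed⁻ ab) (completed⁻ ac) (completed⁻ ad)
    where
    open Claw cf
    far : ∀ {u v} → u ≢ v → adj completion u v ≡ false → ¬ (u C.≃ v)
    far ne f (inj₁ eq) = ne eq
    far ne f (inj₂ e) with () ← trans (sym e) f
    bc′ = far b≢c bc
    bd′ = far b≢d bd
    cd′ = far c≢d cd
    weaken : ∀ {u v} → u ≃ v → u C.≃ v
    weaken (inj₁ eq) = inj₁ eq
    weaken (inj₂ e) = inj₂ (completed⁺ (inj₁ e))
    -- with a, b in N(x), the leaves c, d lie outside N[x] and form a claw at a with x
    new : ∀ {b c d} → ¬ (b C.≃ c) → ¬ (b C.≃ d) → ¬ (c C.≃ d) → x ~ a → x ~ b → a ~ c → a ~ d → ⊥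
    new bc bd cd xa xb ac ad with claw (inj₂ (~-sym xa)) (inj₂ ac) (inj₂ ad)
    ... | inj₁ r = bc (completed-≃ (inj₂ xb) r)
    ... | inj₂ (inj₁ r) = bd (completed-≃ (inj₂ xb) r)
    ... | inj₂ (inj₂ r) = cd (weaken r)
    cases : CompletedEdge a b → CompletedEdge a c → CompletedEdge a d → ⊥
    cases (inj₁ e) (inj₁ f) (inj₁ g) with claw (inj₂ e) (inj₂ f) (inj₂ g)
    ... | inj₁ r = bc′ (weaken r)
    ... | inj₂ (inj₁ r) = bd′ (weaken r)
    ... | inj₂ (inj₂ r) = cd′ (weaken r)
    cases (inj₂ (_ , xb , _)) (inj₂ (_ , xc , _)) _ = bc′ (completed-≃ (inj₂ xb) (inj₂ xc))
    cases (inj₂ (_ , xb , _)) (inj₁ _) (inj₂ (_ , xd , _)) = bd′ (completed-≃ (inj₂ xb) (inj₂ xd))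
    cases (inj₁ _) (inj₂ (_ , xc , _)) (inj₂ (_ , xd , _)) = cd′ (completed-≃ (inj₂ xc) (inj₂ xd))
    cases (inj₂ (xa , xb , _)) (inj₁ f) (inj₁ g) = new bc′ bd′ cd′ xa xb f g
    cases (inj₁ e) (inj₂ (xa , xc , _)) (inj₁ g) = new (bc′ ∘ C.≃-sym) cd′ bd′ xa xc e g
    cases (inj₁ e) (inj₁ f) (inj₂ (xa , xd , _)) = new (bd′ ∘ C.≃-sym) (cd′ ∘ C.≃-sym) bc′ xa xd e f

  module _ (cf : ClawFree G) where
    open Rejoin G cf x

    private
      Rest : List V → Set
      Rest l = l ≡ [] ⊎ Outcome l

      add : ∀ {u v m l} → Path u v m → x ~ u → x ~ v → Rest l → Unique (m ++ l) → Outcome (m ++ l)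
      add {m = m} a xu xv (inj₁ refl) un rewrite List.++-identityʳ m = inj₁ (_ , _ , m , a , xu , xv , ↭-refl)
      add a xu xv (inj₂ o) un = insert a xu xv o un

      -- Added edges are cut. Both ends of such an edge are neighbours of `x`, so the pieces are of
      -- the kind that `insert` accepts. The first piece is kept apart because its start `u` need
      -- not be a neighbour of `x`.
      pieces : ∀ {u v l} → C.Path u v l → x ~ v → Unique l →
        ∃ λ q → ∃ λ m → ∃ λ r → Path u q m × x ~ q × Rest r × m ++ r ↭ l
      pieces C.one xv un = _ , _ , [] , one , xv , inj₁ refl , ↭-refl
      pieces {u} (C.cons e p) xv (u∉ ∷ un) with pieces p xv un | completed⁻ e
      ... | q , m , r , a , xq , o , π | inj₁ e′ = q , u ∷ m , r , cons e′ a , xq , o , prep u π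
      ... | q , m , r , a , xq , o , π | inj₂ (xu , xc , _) =
        u , [ u ] , m ++ r , one , xu , inj₂ (add a xc xq o (unique-↭ (↭-sym π) un)) , prep u π

    -- A single diamond at `x` stands in for connectedness of N(x): by the claw every neighbour of
    -- `x` is close to `a` or `b`, and `c` links these two.
    completion-hamiltonian : ∀ {a b c} → x ~ a → x ~ b → x ~ c → Far a b → a ~ c → b ~ c →
      HamiltonianCycleOn completion (λ _ → ⊤) → HamiltonianCycleOn G (λ _ → ⊤)
    completion-hamiltonian {a} {b} {c} xa xb xc ab ac bc (u , v , l , p , vu , un , _ , all)
      with cycle-open completion p vu (all {x} tt)
    ... | s , t , m , q , xs , xt , π with pieces q (near xt) (tail (unique-↭ (↭-sym π) un))
      where
      tail : ∀ {y : V} {ys} → Unique (y ∷ ys) → Unique ys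
      tail (_ ∷ u) = u
      near : ∀ {y} → x C.~ y → x ~ y
      near e with completed⁻ e
      ... | inj₁ f = f
      ... | inj₂ (f , _) = ⊥-elim (~-irrefl f)
    ... | q′ , m′ , r , d , xq′ , o , ρ = finish (closing (add d (near xs) xq′ o (unique-↭ (↭-sym ρ) um)))
      where
      near : ∀ {y} → x C.~ y → x ~ y
      near e with completed⁻ e
      ... | inj₁ f = f
      ... | inj₂ (f , _) = ⊥-elim (~-irrefl f)
      uxm : Unique (x ∷ m)
      uxm = unique-↭ (↭-sym π) un
      um : Unique m
      um with _ ∷ u ← uxm = u
      x∉ : x ∉ m
      x∉ i with a ∷ _ ← uxm = All.lookup a i refl
      cover : ∀ {y} → x ~ y → y ∈ m
      cover {y} xy with ∈-resp-↭ (↭-sym π) (all {y} tt)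
      ... | here refl = ⊥-elim (~-irrefl xy)
      ... | there i = i
      closing : Outcome (m′ ++ r) → Closing m
      closing o with outcome-↭ ρ o
      ... | inj₁ k = k
      ... | inj₂ k = unstick um x∉ cover xa xb xc ab ac bc k
      finish : Closing m → HamiltonianCycleOn G (λ _ → ⊤)
      finish (y , z , k , w , xy , xz , σ) =
        x , z , x ∷ k , cons xy w , ~-sym xz , unique-↭ (prep x (↭-sym σ)) uxm , (λ _ → tt) ,
        (λ {y} _ → ∈-resp-↭ (↭-trans (↭-sym π) (prep x (↭-sym σ))) (all {y} tt))

-- The closure obtained by repeated local completion

infix 4 _⊑_
_⊑_ : ∀ {n} → Graph n → Graph n → Set
G ⊑ G′ = ∀ {u v} → Adj G u v → Adj G′ u v

-- The trace of the cliques of `G` in `G₀`: an edge `ab` is replaced by a walk through vertices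
-- close to both ends. Local completion preserves this, since two neighbours of `x` are joined
-- through `x`, within the closed neighbourhood that becomes complete.
Spanned : ∀ {n} → Graph n → Graph n → Set
Spanned G₀ G = ∀ {a b} → a ~ b → Adjacency.Walk G₀ (λ z → z ≃ a × z ≃ b) a b
  where open Adjacency G

HamiltonianCycle : ∀ {n} → Graph n → Set
HamiltonianCycle G = HamiltonianCycleOn G (λ _ → ⊤)

record Closure {n} (G₀ : Graph n) : Set where
  field
    closure     : Graph n
    clawFree    : ClawFree closure
    diamondFree : DiamondFree closure
    extends     : G₀ ⊑ closure
    spanned     : Spanned G₀ closure
    hamiltonian : HamiltonianCycle closure → HamiltonianCycle G₀

module _ {n : ℕ} (G₀ : Graph n) where

  private
    nonEdges : Graph n → ℕ
    nonEdges G = total (λ u → count (λ v → not (adj G u v))) (allFin n)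

  module _ (G : Graph n) where
    open Adjacency G

    Diamond : V → V → V → V → Set
    Diamond x a b c = x ~ a × x ~ b × x ~ c × Far a b × a ~ c × b ~ c

    diamond? : Dec (∃ λ x → ∃ λ a → ∃ λ b → ∃ λ c → Diamond x a b c)
    diamond? = any? λ x → any? λ a → any? λ b → any? λ c →
      (x ~? a) ×-dec ((x ~? b) ×-dec ((x ~? c) ×-dec (¬? (a ≃? b) ×-dec ((a ~? c) ×-dec (b ~? c)))))

    no-diamond : ¬ (∃ λ x → ∃ λ a → ∃ λ b → ∃ λ c → Diamond x a b c) → DiamondFree G
    no-diamond none {a} {b} {x} {y} xy ax ay bx by with a ≃? b
    ... | yes r = r
    ... | no f = ⊥-elim (none (x , a , b , y , ~-sym ax′ , ~-sym bx′ , xy , f , ay′ , by′))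
      where
      strict : ∀ {s t w} → Far s t → s ≃ w → t ≃ w → s ~ w
      strict f (inj₁ refl) tw = ⊥-elim (f (≃-sym tw))
      strict f (inj₂ e) _ = e
      ax′ = strict f ax bx
      ay′ = strict f ay by
      bx′ = strict (far-sym f) bx ax
      by′ = strict (far-sym f) by ay

    fewer : ∀ {x a b c} → Diamond x a b c → nonEdges (completion G x) < nonEdges G
    fewer {x} {a} {b} (xa , xb , _ , f , _) =
      total-strict (λ u → total-mono (λ v → bit-mono (mono u v)) (allFin n)) (∈-allFin a)
        (count-< (mono a) b (cong not (Bool.¬-not (f ∘ inj₂)))
          (λ t → case trans (sym (cong not (completed⁺ G x (inj₂ (xa , xb , far⇒≢ f))))) t of λ ()))
      where
      mono : ∀ u v → not (adj (completion G x) u v) ≡ true → not (adj G u v) ≡ true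
      mono u v t with adj G u v in eq
      ... | false = refl
      ... | true = ⊥-elim (case trans (sym (cong not (completed⁺ G x {u} {v} (inj₁ eq)))) t′ of λ ())
        where
        t′ : not (adj (completion G x) u v) ≡ true
        t′ rewrite eq = t

    completion-spanned : ∀ x → Spanned G₀ G → Spanned G₀ (completion G x)
    completion-spanned x sp {u} {v} e with completed⁻ G x {u} {v} e
    ... | inj₁ f = Z.walk-map (λ (r , s) → weaken r , weaken s) (sp f)
      where
      module Z = Adjacency G₀
      module C = Adjacency (completion G x)
      weaken : ∀ {s t} → s ≃ t → s C.≃ t
      weaken (inj₁ eq) = inj₁ eq
      weaken (inj₂ e) = inj₂ (completed⁺ G x (inj₁ e))
    ... | inj₂ (xu , xv , _) =
      Z.walk-trans (Z.walk-sym (Z.walk-map (λ (r , _) → within (≃-sym r)) (sp xu)))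
                   (Z.walk-map (λ (r , _) → within (≃-sym r)) (sp xv))
      where
      module Z = Adjacency G₀
      module C = Adjacency (completion G x)
      within : ∀ {z} → x ≃ z → z C.≃ u × z C.≃ v
      within r = completed-≃ G x r (inj₂ xu) , completed-≃ G x r (inj₂ xv)

  private
    close : ∀ k (G : Graph n) → nonEdges G < k → ClawFree G → G₀ ⊑ G → Spanned G₀ G →
      (HamiltonianCycle G → HamiltonianCycle G₀) → Closure G₀
    close (suc k) G (s≤s le) cf sub sp ham with diamond? G
    ... | no none = record { closure = G ; clawFree = cf ; diamondFree = no-diamond G none
                           ; extends = sub ; spanned = sp ; hamiltonian = ham }
    ... | yes (x , a , b , c , d@(xa , xb , xc , ab , ac , bc)) =
      close k (completion G x) (ℕ.<-≤-trans (fewer G d) le) (completion-clawFree G x cf)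
        (λ e → completed⁺ G x (inj₁ (sub e))) (completion-spanned G x sp)
        (λ h → ham (completion-hamiltonian G x cf xa xb xc ab ac bc h))

  closure-of : ClawFree G₀ → Closure G₀
  closure-of cf = close (suc (nonEdges G₀)) G₀ ℕ.≤-refl cf id
    (λ e → Adjacency.go (inj₁ refl , inj₂ e) e (Adjacency.stop (inj₂ (Adjacency.~-sym G₀ e) , inj₁ refl))) id

-- Cycles of cliques

filter-split : ∀ {A : Set} {P : A → Set} (P? : ∀ x → Dec (P x)) l →
  filter P? l ++ filter (¬? ∘ P?) l ↭ l
filter-split P? [] = ↭-refl
filter-split P? (x ∷ l) with P? x
... | yes _ = prep x (filter-split P? l)
... | no _ = ↭-trans (shift x (filter P? l) _) (prep x (filter-split P? l))

module Cliques {n : ℕ} (G : Graph n) (df : DiamondFree G) where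
  open Adjacency G

  -- for an edge ab, Clique a b is the maximal clique through it
  Clique : V → V → V → Set
  Clique a b z = z ≃ a × z ≃ b

  clique? : ∀ a b z → Dec (Clique a b z)
  clique? a b z = (z ≃? a) ×-dec (z ≃? b)

  clique-≃ : ∀ {a b} → a ~ b → ∀ {y z} → Clique a b y → Clique a b z → y ≃ z
  clique-≃ ab (ya , yb) (za , zb) = df ab ya yb za zb

  clique-absorb : ∀ {a b} → a ~ b → ∀ {s t y} → Clique a b s → Clique a b t → s ≢ t → y ≃ s → y ≃ t → Clique a b y
  clique-absorb ab cs ct s≢t ys yt = df st ys yt (≃-sym (proj₁ cs)) (≃-sym (proj₁ ct)) , df st ys yt (≃-sym (proj₂ cs)) (≃-sym (proj₂ ct))
    where st = ≃⇒~ s≢t (clique-≃ ab cs ct)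

  extend : ∀ {s u c l} → Path s u l → u ~ c → ∀ ins → (∀ {z} → z ∈ ins → Clique u c z) → Unique (l ++ ins) →
    ∃ λ w → ∃ λ r → Path s w r × w ≃ c × r ↭ l ++ ins
  extend {l = l} p uc ins inK un = walk p (λ i → proj₁ (inK i)) (inj₂ uc) (λ i → proj₂ (inK i)) (λ i j → clique-≃ uc (inK i) (inK j)) un
    where
    walk : ∀ {s u c l ins} → Path s u l → (∀ {z} → z ∈ ins → z ≃ u) → u ≃ c → (∀ {z} → z ∈ ins → z ≃ c) →
      (∀ {y z} → y ∈ ins → z ∈ ins → y ≃ z) → Unique (l ++ ins) → ∃ λ w → ∃ λ r → Path s w r × w ≃ c × r ↭ l ++ ins
    walk {l = l} {[]} p _ uc _ _ un = _ , l , p , uc , subst (l ↭_) (sym (List.++-identityʳ l)) ↭-refl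
    walk {l = l} {i ∷ ins} p nu uc nc nn un with walk {ins = ins} (path-++ p (~-sym (≃⇒~ (ne ∘ sym) (nu (here refl)))) one)
           (λ k → nn (there k) (here refl)) (nc (here refl)) (nc ∘ there) (λ j k → nn (there j) (there k))
           (subst Unique (sym (List.++-assoc l [ i ] ins)) un)
      where ne = unique-disjoint l un (path-last p) (here refl)
    ... | w , r , q , wc , π = w , r , q , wc , subst (r ↭_) (List.++-assoc l [ i ] ins) π

  path-ends-≢ : ∀ {s t k} → Path s t k → Unique k → ∀ {y} → y ∈ k → y ≢ s → t ≢ s
  path-ends-≢ one _ (here eq) ne _ = ne eq
  path-ends-≢ (cons _ p) (s∉ ∷ _) _ _ refl = All.lookup s∉ (path-last p) refl

  InEdge : List V → V → Set
  InEdge l z = ∃ λ x → ∃ λ y → Edge x y l × Clique x y z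

  Filled : V → V → List V → List V → Set
  Filled u v l pool = ∃ λ m → ∃ λ left → Path u v m × m ++ left ↭ l ++ pool × (∀ {z} → z ∈ left → z ∈ pool × ¬ InEdge l z)

  -- Every path edge absorbs the pool vertices of its clique, earlier edges first. What fits no path
  -- edge stays in `left` and must be placed at the two edges that connect the legs of a cycle.
  fill : ∀ {u v l} → Path u v l → ∀ pool → Unique (l ++ pool) → Filled u v l pool
  fill one pool un = _ , pool , one , ↭-refl , λ i → i , λ { (_ , _ , there () , _) }
  fill {u} {v} (cons {c = c} {l = l} e p) pool (u∉ ∷ un) with fill p (filter (¬? ∘ clique? u c) pool)
         (unique-right ins (unique-↭ (↭-trans (++⁺ˡ l (↭-sym (filter-split (clique? u c) pool))) (shifts l ins)) un))
    where ins = filter (clique? u c) pool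
  ... | m , left , q , π , lost = attach (extend one e ins (λ i → proj₂ (∈-filter⁻ (clique? u c) {xs = pool} i)) (unique-left (u ∷ ins) un′))
    where
    ins rest : List V
    ins = filter (clique? u c) pool
    rest = filter (¬? ∘ clique? u c) pool
    ρ : (u ∷ ins) ++ (m ++ left) ↭ u ∷ l ++ pool
    ρ = prep u (↭-trans (++⁺ˡ ins π) (↭-trans (shifts ins l) (++⁺ˡ l (filter-split (clique? u c) pool))))
    un′ : Unique ((u ∷ ins) ++ (m ++ left))
    un′ = unique-↭ (↭-sym ρ) (u∉ ∷ un)
    attach : (∃ λ w → ∃ λ r → Path u w r × w ≃ c × r ↭ u ∷ ins) → Filled u v (u ∷ l) pool
    attach (w , r , a , wc , σ) = r ++ m , left , path-++ a (≃⇒~ w≢c wc) q ,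
      ↭-trans (Perm.++-assoc r m left) (↭-trans (++⁺ʳ (m ++ left) σ) ρ) , lost′
      where
      w≢c : w ≢ c
      w≢c = unique-disjoint (u ∷ ins) un′ (∈-resp-↭ σ (path-last a)) (∈-++⁺ˡ (path-first q))
      lost′ : ∀ {z} → z ∈ left → z ∈ pool × ¬ InEdge (u ∷ l) z
      lost′ i with ∈-filter⁻ (¬? ∘ clique? u c) {xs = pool} (proj₁ (lost i))
      ... | j , ¬k = j , no-edge p
        where
        no-edge : ∀ {v} → Path c v l → ¬ InEdge (u ∷ l) _
        no-edge one (x , y , here , k) = ¬k k
        no-edge (cons _ _) (x , y , here , k) = ¬k k
        no-edge _ (x , y , there ed , k) = proj₂ (lost i) (x , y , ed , k)

  Covered : (a b a′ b′ : V) → List V → List V → V → Set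
  Covered a b a′ b′ p q z = InEdge p z ⊎ InEdge q z ⊎ Clique a a′ z ⊎ Clique b b′ z

  -- A clique can be toured between the two ends of any of its edges, so a cycle absorbs all
  -- vertices in the cliques of its edges. The cycle need not be induced and may degenerate to one
  -- edge used both as `aa` and as `bb`; that case settles complete graphs.
  spliced-cycle : ∀ (S : V → Bool) {a b a′ b′ p q} → Path a b p → Path a′ b′ q → a ~ a′ → b ~ b′ → Unique (p ++ q) →
    (∀ {z} → z ∈ p ++ q → S z ≡ true) → (∀ {z} → S z ≡ true → Covered a b a′ b′ p q z) →
    HamiltonianCycleOn G (λ z → S z ≡ true)
  spliced-cycle S {a} {b} {a′} {b′} {p} {q} P Q aa bb un inS cov = result
    where
    outside? : ∀ z → Dec (S z ≡ true × ¬ Any.Any (z ≡_) (p ++ q))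
    outside? z = (S z Bool.≟ true) ×-dec ¬? (Any.any? (z ≟_) (p ++ q))
    pool : List V
    pool = filter outside? (allFin n)
    unAll : Unique ((p ++ q) ++ pool)
    unAll = Unique.++⁺ un (Unique.filter⁺ outside? (Unique.allFin⁺ n))
      (λ (i , j) → proj₂ (proj₂ (∈-filter⁻ outside? {xs = allFin n} j)) i)
    unAll′ : Unique (p ++ (q ++ pool))
    unAll′ = subst Unique (List.++-assoc p q pool) unAll
    Result : Set
    Result = HamiltonianCycleOn G (λ z → S z ≡ true)
    finish : ∀ {w r} → Path b′ w r → w ≃ b′ → b ∈ r → r ↭ p ++ (q ++ pool) → Result
    finish {w} {r} E wb′ b∈ τ = b′ , w , r , E , ≃⇒~ (path-ends-≢ E unR b∈ (~⇒≢ bb)) wb′ , unR , inR , allR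
      where
      unR : Unique r
      unR = unique-↭ (↭-sym τ) unAll′
      inR : ∀ {z} → z ∈ r → S z ≡ true
      inR {z} i with ∈-++⁻ (p ++ q) (subst (z ∈_) (sym (List.++-assoc p q pool)) (∈-resp-↭ τ i))
      ... | inj₁ j = inS j
      ... | inj₂ j = proj₁ (proj₂ (∈-filter⁻ outside? {xs = allFin n} j))
      allR : ∀ {z} → S z ≡ true → z ∈ r
      allR {z} sz with Any.any? (z ≟_) (p ++ q)
      ... | yes i = ∈-resp-↭ (↭-sym τ) (subst (z ∈_) (List.++-assoc p q pool) (∈-++⁺ˡ i))
      ... | no ¬i = ∈-resp-↭ (↭-sym τ) (∈-++⁺ʳ p (∈-++⁺ʳ q (∈-filter⁺ outside? (∈-allFin z) (sz , ¬i))))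
    -- the cycle is b′ ⇝ a′ , clique of aa′ , a ⇝ b , clique of bb′
    close : ∀ {m₁ m₂ insA restA} → Path a b m₁ → Path b′ a′ m₂ → (∀ {z} → z ∈ insA → Clique a a′ z) → (∀ {z} → z ∈ restA → Clique b b′ z) →
      ((m₂ ++ insA) ++ m₁) ++ restA ↭ p ++ (q ++ pool) → Result
    close {m₁} {m₂} {insA} {restA} P₁ P₂ allA allB τ = first (extend P₂ (~-sym aa) insA (λ i → proj₂ (allA i) , proj₁ (allA i)) (unique-left (m₂ ++ insA) unA))
      where
      unT : Unique (((m₂ ++ insA) ++ m₁) ++ restA)
      unT = unique-↭ (↭-sym τ) unAll′
      unA : Unique ((m₂ ++ insA) ++ m₁)
      unA = unique-left ((m₂ ++ insA) ++ m₁) unT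
      first : (∃ λ w → ∃ λ r → Path b′ w r × w ≃ a × r ↭ m₂ ++ insA) → Result
      first (w , r , E , wa , σ) = second (extend (path-++ E wa′ P₁) bb restA allB (unique-↭ (↭-sym (++⁺ʳ restA (++⁺ʳ m₁ σ))) unT))
        where
        wa′ : w ~ a
        wa′ = ≃⇒~ (unique-disjoint (m₂ ++ insA) unA (∈-resp-↭ σ (path-last E)) (path-first P₁)) wa
        second : (∃ λ w → ∃ λ r′ → Path b′ w r′ × w ≃ b′ × r′ ↭ (r ++ m₁) ++ restA) → Result
        second (w , r′ , E , wb , σ′) = finish E wb (∈-resp-↭ (↭-sym σ′) (∈-++⁺ˡ (∈-++⁺ʳ r (path-last P₁))))
          (↭-trans σ′ (↭-trans (++⁺ʳ restA (++⁺ʳ m₁ σ)) τ))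
    step₂ : ∀ {m₁ left₁} → Path a b m₁ → (∀ {z} → z ∈ left₁ → z ∈ pool × ¬ InEdge p z) → m₁ ++ (q ++ left₁) ↭ p ++ (q ++ pool) →
      Filled a′ b′ q left₁ → Result
    step₂ {m₁} P₁ lost₁ ρ₁ (m₂ , left₂ , P₂ , π₂ , lost₂) with path-reverse P₂
    ... | m₂′ , P₂′ , θ = close {insA = filter (clique? a a′) left₂} P₁ P₂′ (λ i → proj₂ (∈-filter⁻ (clique? a a′) {xs = left₂} i)) allB
      (↭-trans (Perm.++-assoc (m₂′ ++ _) m₁ restA)
      (↭-trans (shifts (m₂′ ++ _) m₁)
      (↭-trans (++⁺ˡ m₁ (↭-trans (Perm.++-assoc m₂′ _ restA) (++⁺ θ (filter-split (clique? a a′) left₂))))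
      (↭-trans (++⁺ˡ m₁ π₂) ρ₁))))
      where
      restA : List V
      restA = filter (¬? ∘ clique? a a′) left₂
      allB : ∀ {z} → z ∈ restA → Clique b b′ z
      allB i with ∈-filter⁻ (¬? ∘ clique? a a′) {xs = left₂} i
      ... | j , ¬kA with lost₂ j
      ... | k , ¬q with lost₁ k
      ... | l , ¬p with cov (proj₁ (proj₂ (∈-filter⁻ outside? {xs = allFin n} l)))
      ... | inj₁ c = ⊥-elim (¬p c)
      ... | inj₂ (inj₁ c) = ⊥-elim (¬q c)
      ... | inj₂ (inj₂ (inj₁ c)) = ⊥-elim (¬kA c)
      ... | inj₂ (inj₂ (inj₂ c)) = c
    step₁ : Filled a b p pool → Result
    step₁ (m₁ , left₁ , P₁ , π₁ , lost₁) = step₂ P₁ lost₁ ρ (fill Q left₁ (unique-right m₁ (unique-↭ (↭-sym ρ) unAll′)))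
      where
      ρ : m₁ ++ (q ++ left₁) ↭ p ++ (q ++ pool)
      ρ = ↭-trans (shifts m₁ q) (↭-trans (++⁺ˡ q π₁) (shifts q p))
    result : Result
    result = step₁ (fill P pool (unique-right q (unique-↭ (shifts p q) unAll′)))

-- Thetas

module _ {n : ℕ} (G : Graph n) where
  open Adjacency G

  -- The legs of Brousek's graphs, the minimal 2-connected non-hamiltonian claw-free graphs: a path
  -- with at least three vertices, or a triangle. An edge without a tip is excluded, since the cycle
  -- through the other two legs would absorb it.
  data Shape (a b : V) (vs : List V) : Set where
    long : ∀ {l} → IPath a b l → Far a b → (∀ {z} → z ∈ l → z ∈ vs) → Shape a b vs
    tee  : ∀ {c} → a ~ b → c ~ a → c ~ b → a ∈ vs → b ∈ vs → c ∈ vs → Shape a b vs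

pick₃ : ∀ {A : Set} → A → A → A → Fin 3 → A
pick₃ x y z zero = x
pick₃ x y z (suc zero) = y
pick₃ x y z (suc (suc zero)) = z

each₃ : ∀ {Q : Fin 3 → Set} → Q zero → Q (suc zero) → Q (suc (suc zero)) → ∀ i → Q i
each₃ x y z zero = x
each₃ x y z (suc zero) = y
each₃ x y z (suc (suc zero)) = z

off-diagonal₃ : ∀ {Q : Fin 3 → Fin 3 → Set} → Q zero (suc zero) → Q zero (suc (suc zero)) → Q (suc zero) zero → Q (suc zero) (suc (suc zero)) →
  Q (suc (suc zero)) zero → Q (suc (suc zero)) (suc zero) → ∀ i j → i ≢ j → Q i j
off-diagonal₃ a b c d e f zero zero ne = ⊥-elim (ne refl)
off-diagonal₃ a b c d e f zero (suc zero) _ = a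
off-diagonal₃ a b c d e f zero (suc (suc zero)) _ = b
off-diagonal₃ a b c d e f (suc zero) zero _ = c
off-diagonal₃ a b c d e f (suc zero) (suc zero) ne = ⊥-elim (ne refl)
off-diagonal₃ a b c d e f (suc zero) (suc (suc zero)) _ = d
off-diagonal₃ a b c d e f (suc (suc zero)) zero _ = e
off-diagonal₃ a b c d e f (suc (suc zero)) (suc zero) _ = f
off-diagonal₃ a b c d e f (suc (suc zero)) (suc (suc zero)) ne = ⊥-elim (ne refl)

-- three legs between two triangles; the legs live in G₀, the separation of distinct legs is required in G
record Theta {n} (G₀ G : Graph n) : Set where
  open Adjacency G
  field
    a b   : Fin 3 → V
    vs    : Fin 3 → List V
    shape : ∀ i → Shape G₀ (a i) (b i) (vs i)
    aa    : ∀ {i j} → i ≢ j → a i ~ a j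
    bb    : ∀ {i j} → i ≢ j → b i ~ b j
    cross : ∀ {i j} → i ≢ j → ∀ {x y} → x ∈ vs i → y ∈ vs j → x ≃ y → (x ≡ a i × y ≡ a j) ⊎ (x ≡ b i × y ≡ b j)

-- Induced cycles in a closed graph and what they dominate

module ClosedGraph {n : ℕ} (G : Graph n) (cf : ClawFree G) (df : DiamondFree G) where
  open Adjacency G
  open Claw cf
  open Cliques G df

  -- an induced cycle, presented as two legs between the edges aa′ and bb′
  record Ring (a b : V) (p : List V) (a′ b′ : V) (q : List V) : Set where
    constructor ring
    field
      left    : IPath a b p
      right   : IPath a′ b′ q
      aa      : a ~ a′
      bb      : b ~ b′
      cross   : ∀ {x y} → x ∈ p → y ∈ q → x ≃ y → (x ≡ a × y ≡ a′) ⊎ (x ≡ b × y ≡ b′)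
      -- Together with `fat′` this excludes triangles: when one leg is a single vertex, the other
      -- has far ends.
      fat     : a ≡ b → Far a′ b′
      fat′    : a′ ≡ b′ → Far a b

  Dom : List V → V → Set
  Dom l z = ∃ λ o → o ∈ l × o ≃ z

  dom? : ∀ l z → Dec (Dom l z)
  dom? l z with Any.any? (_≃? z) l
  ... | yes i = yes (find i)
  ... | no ¬i = no λ (o , i , c) → ¬i (lose i c)

  _⊆ₗ_ : List V → List V → Set
  l ⊆ₗ m = ∀ {z} → z ∈ l → z ∈ m

  dom-⊆ : ∀ {l m z} → l ⊆ₗ m → Dom l z → Dom m z
  dom-⊆ s (o , i , c) = o , s i , c

  ++-swap-⊆ : ∀ l {m} → (l ++ m) ⊆ₗ (m ++ l)
  ++-swap-⊆ l {m} i with ∈-++⁻ l i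
  ... | inj₁ j = ∈-++⁺ʳ m j
  ... | inj₂ j = ∈-++⁺ˡ j

  ++-mono-⊆ : ∀ {l l′ m m′} → l ⊆ₗ l′ → m ⊆ₗ m′ → (l ++ m) ⊆ₗ (l′ ++ m′)
  ++-mono-⊆ {l} {l′} f g i with ∈-++⁻ l i
  ... | inj₁ j = ∈-++⁺ˡ (f j)
  ... | inj₂ j = ∈-++⁺ʳ l′ (g j)

  ring-swap : ∀ {a b p a′ b′ q} → Ring a b p a′ b′ q → Ring a′ b′ q a b p
  ring-swap (ring l r aa bb c f f′) = ring r l (~-sym aa) (~-sym bb) c′ f′ f
    where
    c′ : ∀ {x y} → _ → _ → x ≃ y → _
    c′ i j r with c j i (≃-sym r)
    ... | inj₁ (e , e′) = inj₁ (e′ , e)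
    ... | inj₂ (e , e′) = inj₂ (e′ , e)

  ring-flip : ∀ {a b p a′ b′ q} → Ring a b p a′ b′ q →
    ∃ λ p′ → ∃ λ q′ → Ring b a p′ b′ a′ q′ × (p ++ q) ⊆ₗ (p′ ++ q′) × (p′ ++ q′) ⊆ₗ (p ++ q)
  ring-flip (ring l r aa bb c f f′) with ipath-reverse l | ipath-reverse r
  ... | p′ , l′ , s , t | q′ , r′ , s′ , t′ =
    p′ , q′ , ring l′ r′ bb aa c′ (λ e → f (sym e) ∘ ≃-sym) (λ e → f′ (sym e) ∘ ≃-sym) ,
    ++-mono-⊆ t t′ , ++-mono-⊆ s s′
    where
    c′ : ∀ {x y} → _ → _ → x ≃ y → _
    c′ i j r with c (s i) (s′ j) r
    ... | inj₁ e = inj₂ e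
    ... | inj₂ e = inj₁ e

  second-far : ∀ {a b a′ b′ c t q} → Ring a b (a ∷ c ∷ t) a′ b′ q → Far c a′
  second-far (ring l@(cons e _ _) r aa bb cr f f′) cl with cr (there (here refl)) (ipath-first r) cl
  ... | inj₁ (refl , _) = ~-irrefl e
  ... | inj₂ (refl , eq) = f′ eq (inj₂ e)

  ring-shift : ∀ {a b a′ b′ c t q} → Ring a b (a ∷ c ∷ t) a′ b′ q → Ring c b (c ∷ t) a b′ (a ∷ q)
  ring-shift {a} {b} {a′} {b′} {c} {t} {q} R@(ring l@(cons e f p) r aa bb cr fa fa′) =
    ring p (prepend r cr′) (~-sym e) bb cross′ fat₁ fat₂
    where
    a≢b : a ≢ b
    a≢b = ipath-head∉ l (ipath-last p)
    cr′ : ∀ {y} → y ∈ q → a ≃ y → y ≡ a′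
    cr′ j cl with cr (here refl) j cl
    ... | inj₁ (_ , eq) = eq
    ... | inj₂ (eq , _) = ⊥-elim (a≢b eq)
    prepend : ∀ {q} → IPath a′ b′ q → (∀ {y} → y ∈ q → a ≃ y → y ≡ a′) → IPath a b′ (a ∷ q)
    prepend one h = cons aa (λ ()) one
    prepend r@(cons _ _ _) h = cons aa (λ i cl → ipath-head∉ r i (sym (h (there i) cl))) r
    cross′ : ∀ {x y} → x ∈ c ∷ t → y ∈ a ∷ q → x ≃ y → (x ≡ c × y ≡ a) ⊎ (x ≡ b × y ≡ b′)
    cross′ (here refl) (here refl) cl = inj₁ (refl , refl)
    cross′ (there i) (here refl) cl = ⊥-elim (f i (≃-sym cl))
    cross′ i (there j) cl with cr (there i) j cl
    ... | inj₁ (eq , _) = ⊥-elim (ipath-head∉ l i (sym eq))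
    ... | inj₂ es = inj₂ es
    fat₁ : c ≡ b → Far a b′
    fat₁ refl cl = fa′ (sym (cr′ (ipath-last r) cl)) (inj₂ e)
    fat₂ : a ≡ b′ → Far c b
    fat₂ refl = ⊥-elim (~-irrefl (subst (_~ a′) (cr′ (ipath-last r) ≃-refl) aa))

  -- The two cycle neighbours of `o` are far apart, so by the claw at `o` the vertex `y` is close to
  -- one of them: it sits at an edge of the cycle. `ring-shift` turns the cycle until this edge is
  -- the top `cc′`. The bottom `bb′` never moves, whence the second outcome.
  scan : ∀ {y a b p a′ b′ q o} → Ring a b p a′ b′ q → o ∈ p → o ≃ y →
    (∃ λ c → ∃ λ c′ → ∃ λ p₁ → ∃ λ q₁ → Ring c b p₁ c′ b′ q₁ × y ≃ c × y ≃ c′ ×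
      (p ++ q) ⊆ₗ (p₁ ++ q₁) × (p₁ ++ q₁) ⊆ₗ (p ++ q)) ⊎ (y ≃ b × y ≃ b′)
  scan R@(ring one r aa bb cr f f′) (here refl) cl with claw₂ (inj₂ aa) (inj₂ bb) cl (f refl)
  ... | inj₁ c = inj₁ (_ , _ , _ , _ , R , ≃-sym cl , ≃-sym c , id , id)
  ... | inj₂ c = inj₂ (≃-sym cl , ≃-sym c)
  scan R@(ring (cons e _ _) r aa bb cr f f′) (here refl) cl with claw₂ (inj₂ e) (inj₂ aa) cl (second-far R)
  ... | inj₂ c = inj₁ (_ , _ , _ , _ , R , ≃-sym cl , ≃-sym c , id , id)
  ... | inj₁ c = inj₁ (_ , _ , _ , _ , ring-shift R , ≃-sym c , ≃-sym cl , moved , moved′)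
    where
    moved : ∀ {a c t q} → (a ∷ c ∷ t ++ q) ⊆ₗ (c ∷ t ++ a ∷ q)
    moved {a} {c} {t} {q} i = ∈-resp-↭ (↭-sym (shift a (c ∷ t) q)) i
    moved′ : ∀ {a c t q} → (c ∷ t ++ a ∷ q) ⊆ₗ (a ∷ c ∷ t ++ q)
    moved′ {a} {c} {t} {q} i = ∈-resp-↭ (shift a (c ∷ t) q) i
  scan {p = a ∷ c ∷ t} {q = q} R@(ring (cons _ _ _) _ _ _ _ _ _) (there i) cl with scan (ring-shift R) i cl
  ... | inj₂ r = inj₂ r
  ... | inj₁ (d , d′ , p₁ , q₁ , R₁ , yd , yd′ , s , s′) =
    inj₁ (d , d′ , p₁ , q₁ , R₁ , yd , yd′ , (λ k → s (∈-resp-↭ (↭-sym (shift a (c ∷ t) q)) k)) ,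
      λ k → ∈-resp-↭ (shift a (c ∷ t) q) (s′ k))

  -- Cycle vertices close to `y` are pairwise close when `y` has a neighbour that the cycle does not
  -- dominate. Then a vertex of `p` close to `y` is close to `a′`. Apart from `a` only `b` could be,
  -- with `a′` equal to `b′`, and there `fat′` keeps `a` and `b` far.
  top-only : ∀ {y a b p a′ b′ q} → Ring a b p a′ b′ q → (∀ {o o′} → o ∈ p ++ q → o′ ∈ p ++ q → o ≃ y → o′ ≃ y → o ≃ o′) →
    y ≃ a → y ≃ a′ → ∀ {o} → o ∈ p → o ≃ y → o ≡ a
  top-only {p = p} (ring l r aa bb cr f f′) pw ya ya′ i cl
    with cr i (ipath-first r) (pw (∈-++⁺ˡ i) (∈-++⁺ʳ p (ipath-first r)) cl (≃-sym ya′))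
  ... | inj₁ (eq , _) = eq
  ... | inj₂ (refl , eq) = ⊥-elim (f′ eq (pw (∈-++⁺ˡ (ipath-first l)) (∈-++⁺ˡ i) (≃-sym ya) cl))

  ipath-pred : ∀ {u v l} → IPath u v l → u ≡ v ⊎ ∃ λ s → s ∈ l × Edge s v l × s ~ v
  ipath-pred one = inj₁ refl
  ipath-pred (cons e f p) with ipath-pred p
  ... | inj₂ (s , i , ed , e′) = inj₂ (s , there i , there ed , e′)
  ipath-pred (cons e f one) | inj₁ _ = inj₂ (_ , here refl , here , e)
  ipath-pred (cons e f p@(cons _ _ q)) | inj₁ refl = ⊥-elim (ipath-head∉ p (ipath-last q) refl)

  ring-covered : ∀ {a b p a′ b′ q o z} → Ring a b p a′ b′ q → o ∈ p → o ≃ z → Covered a b a′ b′ p q z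
  ring-covered R@(ring l r aa bb cr f f′) i cl with ipath-position l i
  ring-covered R@(ring one r aa bb cr f f′) i cl | inj₁ refl with claw₂ (inj₂ aa) (inj₂ bb) cl (f refl)
  ... | inj₁ c = inj₂ (inj₂ (inj₁ (≃-sym cl , ≃-sym c)))
  ... | inj₂ c = inj₂ (inj₂ (inj₂ (≃-sym cl , ≃-sym c)))
  ring-covered R@(ring (cons e _ _) r aa bb cr f f′) i cl | inj₁ refl with claw₂ (inj₂ e) (inj₂ aa) cl (second-far R)
  ... | inj₁ c = inj₁ (_ , _ , here , ≃-sym cl , ≃-sym c)
  ... | inj₂ c = inj₂ (inj₂ (inj₁ (≃-sym cl , ≃-sym c)))
  ring-covered R@(ring l r aa bb cr f f′) i cl | inj₂ (inj₂ (x , y , _ , _ , ex , ey , xz , zy , far))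
    with claw₂ (inj₂ (~-sym xz)) (inj₂ zy) cl far
  ... | inj₁ c = inj₁ (_ , _ , ex , ≃-sym c , ≃-sym cl)
  ... | inj₂ c = inj₁ (_ , _ , ey , ≃-sym cl , ≃-sym c)
  ring-covered R@(ring l r aa bb cr f f′) i cl | inj₂ (inj₁ refl) with ipath-pred l
  ring-covered R@(ring l r aa bb cr f f′) i cl | inj₂ (inj₁ refl) | inj₁ refl with claw₂ (inj₂ aa) (inj₂ bb) cl (f refl)
  ... | inj₁ c = inj₂ (inj₂ (inj₁ (≃-sym cl , ≃-sym c)))
  ... | inj₂ c = inj₂ (inj₂ (inj₂ (≃-sym cl , ≃-sym c)))
  ring-covered R@(ring l r aa bb cr f f′) i cl | inj₂ (inj₁ refl) | inj₂ (s , s∈ , ed , e)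
    with claw₂ (inj₂ (~-sym e)) (inj₂ bb) cl far
    where
    far : Far s _
    far c with cr s∈ (ipath-last r) c
    ... | inj₁ (refl , eq) = f′ (sym eq) (inj₂ e)
    ... | inj₂ (refl , _) = ~-irrefl e
  ... | inj₁ c = inj₁ (_ , _ , ed , ≃-sym c , ≃-sym cl)
  ... | inj₂ c = inj₂ (inj₂ (inj₂ (≃-sym cl , ≃-sym c)))

  -- Domination is enough: the two cycle neighbours of a cycle vertex are far apart, so by the claw
  -- whatever is close to this vertex lies in the clique of one of its two cycle edges.
  ring-cycle : ∀ (S : V → Bool) {a b p a′ b′ q} → Ring a b p a′ b′ q → (∀ {z} → z ∈ p ++ q → S z ≡ true) →
    (∀ {z} → S z ≡ true → Dom (p ++ q) z) → HamiltonianCycleOn G (λ z → S z ≡ true)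
  ring-cycle S {a} {b} {p} {a′} {b′} {q} R@(ring l r aa bb cr f f′) inS dom =
    spliced-cycle S (ipath-path l) (ipath-path r) aa bb
      (Unique.++⁺ (ipath-unique l) (ipath-unique r) (λ (i , j) → disjoint i j refl)) inS covered
    where
    disjoint : ∀ {x y} → x ∈ p → y ∈ q → x ≢ y
    disjoint i j refl with cr i j ≃-refl
    ... | inj₁ (refl , refl) = ~-irrefl aa
    ... | inj₂ (refl , refl) = ~-irrefl bb
    covered : ∀ {z} → S z ≡ true → Covered a b a′ b′ p q z
    covered sz with dom sz
    ... | o , i , cl with ∈-++⁻ p i
    ... | inj₁ j = ring-covered R j cl
    ... | inj₂ j with ring-covered (ring-swap R) j cl
    ...   | inj₁ c = inj₂ (inj₁ c)
    ...   | inj₂ (inj₁ c) = inj₁ c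
    ...   | inj₂ (inj₂ (inj₁ (c , d))) = inj₂ (inj₂ (inj₁ (d , c)))
    ...   | inj₂ (inj₂ (inj₂ (c , d))) = inj₂ (inj₂ (inj₂ (d , c)))

  record RingIn (S : V → Bool) : Set where
    constructor ringIn
    field
      {a b a′ b′} : V
      {p q}       : List V
      theRing     : Ring a b p a′ b′ q
      inside      : ∀ {z} → z ∈ p ++ q → S z ≡ true
    verts : List V
    verts = p ++ q

  module _ (S : V → Bool) where

    data Kind (a b : V) (p others : List V) : Set where
      long : Far a b → Kind a b p others
      tip  : ∀ c → S c ≡ true → p ≡ a ∷ b ∷ [] → a ~ b → c ~ a → c ~ b → (∀ {o} → o ∈ others → Far o c) → Kind a b p others

    tips : ∀ {a b p o} → Kind a b p o → List V
    tips (long _) = []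
    tips (tip c _ _ _ _ _ _) = [ c ]

    kind : ∀ {a b p a′ b′ q} → Ring a b p a′ b′ q → ∀ r →
      Kind a b p (q ++ r) ⊎ (∀ {z} → S z ≡ true → Dom p z → Dom (q ++ r) z)
    kind {q = q} (ring one ri aa bb cr f f′) r = inj₂ dom
      where
      dom : ∀ {z} → _ → Dom (_ ∷ []) z → Dom (q ++ r) z
      dom _ (o , here refl , c) with claw₂ (inj₂ aa) (inj₂ bb) c (f refl)
      ... | inj₁ d = _ , ∈-++⁺ˡ (ipath-first ri) , d
      ... | inj₂ d = _ , ∈-++⁺ˡ (ipath-last ri) , d
    kind (ring (cons e f (cons e′ f′ p)) _ _ _ _ _ _) r = inj₁ (long (f (ipath-last p)))
    kind {a} {b} {a′ = a′} {b′} {q} (ring (cons e _ one) ri aa bb cr f f′) r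
      with any? (λ c → (S c Bool.≟ true) ×-dec ((c ~? a) ×-dec ((c ~? b) ×-dec ¬? (dom? (q ++ r) c))))
    ... | yes (c , sc , ca , cb , nd) = inj₁ (tip c sc refl e ca cb (λ i cl → nd (_ , i , cl)))
    ... | no none = inj₂ dom
      where
      ba′ : Far b a′
      ba′ c with cr (there (here refl)) (ipath-first ri) c
      ... | inj₁ (refl , _) = ~-irrefl e
      ... | inj₂ (_ , eq) = f′ eq (inj₂ e)
      ab′ : Far a b′
      ab′ c with cr (here refl) (ipath-last ri) c
      ... | inj₁ (_ , eq) = f′ (sym eq) (inj₂ e)
      ... | inj₂ (refl , _) = ~-irrefl e
      both : ∀ {z} → S z ≡ true → a ≃ z → b ≃ z → Dom (q ++ r) z
      both sz (inj₁ refl) _ = a′ , ∈-++⁺ˡ (ipath-first ri) , inj₂ (~-sym aa)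
      both sz (inj₂ _) (inj₁ refl) = b′ , ∈-++⁺ˡ (ipath-last ri) , inj₂ (~-sym bb)
      both {z} sz (inj₂ az) (inj₂ bz) with dom? (q ++ r) z
      ... | yes d = d
      ... | no nd = ⊥-elim (none (z , sz , ~-sym az , ~-sym bz , nd))
      dom : ∀ {z} → S z ≡ true → Dom (a ∷ b ∷ []) z → Dom (q ++ r) z
      dom sz (o , here refl , c) with claw₂ (inj₂ e) (inj₂ aa) c ba′
      ... | inj₁ d = both sz c d
      ... | inj₂ d = a′ , ∈-++⁺ˡ (ipath-first ri) , d
      dom sz (o , there (here refl) , c) with claw₂ (inj₂ (~-sym e)) (inj₂ bb) c ab′
      ... | inj₁ d = both sz d c
      ... | inj₂ d = b′ , ∈-++⁺ˡ (ipath-last ri) , d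

    module Legs {a₁ b₁ p₁ a₂ b₂ p₂ a₃ b₃ p₃}
      (R₁₂ : Ring a₁ b₁ p₁ a₂ b₂ p₂) (R₁₃ : Ring a₁ b₁ p₁ a₃ b₃ p₃) (R₂₃ : Ring a₂ b₂ p₂ a₃ b₃ p₃)
      where

      -- Two adjacent tips allow the detour `a₁`, `c₁`, `c₂`, `b₂` in place of two legs. The omitted
      -- vertices `b₁` and `a₂` are both adjacent to the far vertices `a₁` and `b₂`, so by the claw
      -- nothing that they dominate is lost.
      tip-ring : ∀ {c₁ c₂} → p₁ ≡ a₁ ∷ b₁ ∷ [] → a₁ ~ b₁ → c₁ ~ a₁ → (∀ {o} → o ∈ p₂ ++ p₃ → Far o c₁) →
        p₂ ≡ a₂ ∷ b₂ ∷ [] → a₂ ~ b₂ → c₂ ~ b₂ → (∀ {o} → o ∈ p₁ ++ p₃ → Far o c₂) → c₁ ~ c₂ →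
        Ring a₁ b₂ (a₁ ∷ c₁ ∷ c₂ ∷ b₂ ∷ []) a₃ b₃ p₃ ×
        (∀ {z} → Dom (p₁ ++ p₂ ++ p₃) z → Dom ((a₁ ∷ c₁ ∷ c₂ ∷ b₂ ∷ []) ++ p₃) z)
      tip-ring {c₁} {c₂} refl ab₁ ca₁ far₁ refl ab₂ cb₂ far₂ cc =
        ring (cons (~-sym ca₁) farA (cons cc (λ { (here refl) → far₁ (there (here refl)) ∘ ≃-sym }) (cons cb₂ (λ ()) one)))
          (Ring.right R₁₃) (Ring.aa R₁₃) (Ring.bb R₂₃) cr
          (λ { refl → ⊥-elim (a₁b₂ ≃-refl) })
          (λ _ → a₁b₂) , dom
        where
        a₁b₂ : Far a₁ b₂
        a₁b₂ c with Ring.cross R₁₂ (here refl) (there (here refl)) c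
        ... | inj₁ (_ , refl) = ~-irrefl ab₂
        ... | inj₂ (refl , _) = ~-irrefl ab₁
        farA : ∀ {x} → x ∈ c₂ ∷ b₂ ∷ [] → Far a₁ x
        farA (here refl) = far₂ (here refl)
        farA (there (here refl)) = a₁b₂
        cr : ∀ {x y} → x ∈ a₁ ∷ c₁ ∷ c₂ ∷ b₂ ∷ [] → y ∈ p₃ → x ≃ y → (x ≡ a₁ × y ≡ a₃) ⊎ (x ≡ b₂ × y ≡ b₃)
        cr (here refl) j c with Ring.cross R₁₃ (here refl) j c
        ... | inj₁ e = inj₁ e
        ... | inj₂ (refl , _) = ⊥-elim (~-irrefl ab₁)
        cr (there (here refl)) j c = ⊥-elim (far₁ (there (there j)) (≃-sym c))
        cr (there (there (here refl))) j c = ⊥-elim (far₂ (there (there j)) (≃-sym c))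
        cr (there (there (there (here refl)))) j c with Ring.cross R₂₃ (there (here refl)) j c
        ... | inj₁ (refl , _) = ⊥-elim (~-irrefl ab₂)
        ... | inj₂ e = inj₂ e
        A∈ = here refl
        B∈ = there (there (there (here refl)))
        dom : ∀ {z} → Dom (p₁ ++ p₂ ++ p₃) z → Dom ((a₁ ∷ c₁ ∷ c₂ ∷ b₂ ∷ []) ++ p₃) z
        dom (o , here refl , c) = o , A∈ , c
        dom (o , there (here refl) , c) with claw₂ (inj₂ (~-sym ab₁)) (inj₂ (Ring.bb R₁₂)) c a₁b₂
        ... | inj₁ d = _ , A∈ , d
        ... | inj₂ d = _ , B∈ , d
        dom (o , there (there (here refl)) , c) with claw₂ (inj₂ (~-sym (Ring.aa R₁₂))) (inj₂ ab₂) c a₁b₂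
        ... | inj₁ d = _ , A∈ , d
        ... | inj₂ d = _ , B∈ , d
        dom (o , there (there (there (here refl))) , c) = o , B∈ , c
        dom (o , there (there (there (there i))) , c) = o , there (there (there (there i))) , c

    shape-of : ∀ {a b p o} → IPath a b p → (k : Kind a b p o) → Shape G a b (tips k ++ p)
    shape-of l (long f) = long l f id
    shape-of l (tip c _ refl ab ca cb _) = tee ab ca cb (there (here refl)) (there (there (here refl))) (here refl)

    kind-cross : ∀ {a b p a′ b′ q r s} → Ring a b p a′ b′ q → (k : Kind a b p r) (k′ : Kind a′ b′ q s) → q ⊆ₗ r → p ⊆ₗ s →
      (∀ {x y} → x ∈ tips k → y ∈ tips k′ → Far x y) →
      ∀ {x y} → x ∈ tips k ++ p → y ∈ tips k′ ++ q → x ≃ y → (x ≡ a × y ≡ a′) ⊎ (x ≡ b × y ≡ b′)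
    kind-cross R k k′ qr ps tt′ i j c with ∈-++⁻ (tips k) i | ∈-++⁻ (tips k′) j
    ... | inj₁ i′ | inj₁ j′ = ⊥-elim (tt′ i′ j′ c)
    ... | inj₂ i′ | inj₂ j′ = Ring.cross R i′ j′ c
    kind-cross R (tip _ _ _ _ _ _ far) k′ qr ps tt′ i j c | inj₁ (here refl) | inj₂ j′ = ⊥-elim (far (qr j′) (≃-sym c))
    kind-cross R k (tip _ _ _ _ _ _ far) qr ps tt′ i j c | inj₂ i′ | inj₁ (here refl) = ⊥-elim (far (ps i′) c)

    tips-clash : ∀ {a b p o a′ b′ q o′} (k : Kind a b p o) (k′ : Kind a′ b′ q o′) → p ⊆ₗ o′ → a ∈ p →
      (∀ {x y} → x ∈ tips k → y ∈ tips k′ → Far x y) ⊎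
      (∃ λ c → ∃ λ c′ → S c ≡ true × S c′ ≡ true × c ~ c′ × (p ≡ a ∷ b ∷ [] × a ~ b × c ~ a × c ~ b × (∀ {x} → x ∈ o → Far x c)) ×
        (q ≡ a′ ∷ b′ ∷ [] × a′ ~ b′ × c′ ~ a′ × c′ ~ b′ × (∀ {x} → x ∈ o′ → Far x c′)))
    tips-clash (long _) _ s a∈ = inj₁ λ ()
    tips-clash (tip _ _ _ _ _ _ _) (long _) s a∈ = inj₁ λ _ ()
    tips-clash (tip c e₀ e₁ e₂ e₃ e₄ e₅) (tip c′ f₀ f₁ f₂ f₃ f₄ f₅) s a∈ with c ≃? c′
    ... | no f = inj₁ λ { (here refl) (here refl) → f }
    ... | yes (inj₁ refl) = ⊥-elim (f₅ (s a∈) (inj₂ (~-sym e₃)))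
    ... | yes (inj₂ e) = inj₂ (c , c′ , e₀ , f₀ , e , (e₁ , e₂ , e₃ , e₄ , e₅) , (f₁ , f₂ , f₃ , f₄ , f₅))

    module _ {a₁ b₁ p₁ a₂ b₂ p₂ a₃ b₃ p₃}
      (R₁₂ : Ring a₁ b₁ p₁ a₂ b₂ p₂) (R₁₃ : Ring a₁ b₁ p₁ a₃ b₃ p₃) (R₂₃ : Ring a₂ b₂ p₂ a₃ b₃ p₃)
      where

      good-theta : (k₁ : Kind a₁ b₁ p₁ (p₂ ++ p₃)) (k₂ : Kind a₂ b₂ p₂ (p₁ ++ p₃)) (k₃ : Kind a₃ b₃ p₃ (p₁ ++ p₂)) →
        (∀ {x y} → x ∈ tips k₁ → y ∈ tips k₂ → Far x y) →
        (∀ {x y} → x ∈ tips k₁ → y ∈ tips k₃ → Far x y) →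
        (∀ {x y} → x ∈ tips k₂ → y ∈ tips k₃ → Far x y) → Theta G G
      good-theta k₁ k₂ k₃ t₁₂ t₁₃ t₂₃ = record
        { a = pick₃ a₁ a₂ a₃ ; b = pick₃ b₁ b₂ b₃ ; vs = pick₃ (tips k₁ ++ p₁) (tips k₂ ++ p₂) (tips k₃ ++ p₃)
        ; shape = each₃ (shape-of (Ring.left R₁₂) k₁) (shape-of (Ring.right R₁₂) k₂) (shape-of (Ring.right R₁₃) k₃)
        ; aa = λ {i} {j} → ends i j (Ring.aa R₁₂) (Ring.aa R₁₃) (Ring.aa R₂₃)
        ; bb = λ {i} {j} → ends i j (Ring.bb R₁₂) (Ring.bb R₁₃) (Ring.bb R₂₃)
        ; cross = λ {i} {j} → cr i j }
        where
        ends : ∀ i j {x y z} → x ~ y → x ~ z → y ~ z → i ≢ j → pick₃ x y z i ~ pick₃ x y z j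
        ends i j {x} {y} {z} e f g = off-diagonal₃ {λ i j → pick₃ x y z i ~ pick₃ x y z j} e f (~-sym e) g (~-sym f) (~-sym g) i j
        cr₁₂ = kind-cross R₁₂ k₁ k₂ ∈-++⁺ˡ ∈-++⁺ˡ t₁₂
        cr₁₃ = kind-cross R₁₃ k₁ k₃ (∈-++⁺ʳ p₂) ∈-++⁺ˡ t₁₃
        cr₂₃ = kind-cross R₂₃ k₂ k₃ (∈-++⁺ʳ p₁) (∈-++⁺ʳ p₁) t₂₃
        turn : ∀ {x y s t s′ t′ : V} → (x ≡ s × y ≡ t) ⊎ (x ≡ s′ × y ≡ t′) → (y ≡ t × x ≡ s) ⊎ (y ≡ t′ × x ≡ s′)
        turn (inj₁ (e , f)) = inj₁ (f , e)
        turn (inj₂ (e , f)) = inj₂ (f , e)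
        Crossing : Fin 3 → Fin 3 → Set
        Crossing i j = ∀ {x y} → x ∈ pick₃ (tips k₁ ++ p₁) (tips k₂ ++ p₂) (tips k₃ ++ p₃) i →
          y ∈ pick₃ (tips k₁ ++ p₁) (tips k₂ ++ p₂) (tips k₃ ++ p₃) j → x ≃ y →
          (x ≡ pick₃ a₁ a₂ a₃ i × y ≡ pick₃ a₁ a₂ a₃ j) ⊎ (x ≡ pick₃ b₁ b₂ b₃ i × y ≡ pick₃ b₁ b₂ b₃ j)
        cr : ∀ i j → i ≢ j → Crossing i j
        cr = off-diagonal₃ {Crossing} cr₁₂ cr₁₃ (λ i j c → turn (cr₁₂ j i (≃-sym c))) cr₂₃
          (λ i j c → turn (cr₁₃ j i (≃-sym c))) (λ i j c → turn (cr₂₃ j i (≃-sym c)))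

      Better : Set
      Better = Σ (RingIn S) λ R → ∀ {z} → S z ≡ true → Dom (p₁ ++ p₂ ++ p₃) z → Dom (RingIn.verts R) z

      module _ (in₁ : ∀ {z} → z ∈ p₁ → S z ≡ true) (in₂ : ∀ {z} → z ∈ p₂ → S z ≡ true) (in₃ : ∀ {z} → z ∈ p₃ → S z ≡ true) where

        private
          in-++ : ∀ l {m} → (∀ {z} → z ∈ l → S z ≡ true) → (∀ {z} → z ∈ m → S z ≡ true) → ∀ {z} → z ∈ l ++ m → S z ≡ true
          in-++ l f g i with ∈-++⁻ l i
          ... | inj₁ j = f j
          ... | inj₂ j = g j

          dom-cases : ∀ {z} → Dom (p₁ ++ p₂ ++ p₃) z → Dom p₁ z ⊎ Dom p₂ z ⊎ Dom p₃ z
          dom-cases (o , i , c) with ∈-++⁻ p₁ i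
          ... | inj₁ j = inj₁ (o , j , c)
          ... | inj₂ j with ∈-++⁻ p₂ j
          ...   | inj₁ k = inj₂ (inj₁ (o , k , c))
          ...   | inj₂ k = inj₂ (inj₂ (o , k , c))

        clash : ∀ {c c′ a b p a′ b′ q a″ b″ r}
          (R : Ring a b p a′ b′ q) (R′ : Ring a b p a″ b″ r) (R″ : Ring a′ b′ q a″ b″ r) → S c ≡ true → S c′ ≡ true →
          (∀ {z} → z ∈ p → S z ≡ true) → (∀ {z} → z ∈ q → S z ≡ true) → (∀ {z} → z ∈ r → S z ≡ true) → c ~ c′ →
          (p ≡ a ∷ b ∷ [] × a ~ b × c ~ a × c ~ b × (∀ {x} → x ∈ q ++ r → Far x c)) →
          (q ≡ a′ ∷ b′ ∷ [] × a′ ~ b′ × c′ ~ a′ × c′ ~ b′ × (∀ {x} → x ∈ p ++ r → Far x c′)) →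
          Σ (RingIn S) λ M → ∀ {z} → Dom (p ++ q ++ r) z → Dom (RingIn.verts M) z
        clash {r = r} R R′ R″ Sc Sc′ ip iq ir cc (e , ab , ca , cb , far) (e′ , ab′ , ca′ , cb′ , far′)
          with Legs.tip-ring R R′ R″ e ab ca far e′ ab′ cb′ far′ cc
        ... | M , dom = ringIn M inM , dom
          where
          inM : ∀ {z} → z ∈ _ → S z ≡ true
          inM (here refl) = ip (ipath-first (Ring.left R))
          inM (there (here refl)) = Sc
          inM (there (there (here refl))) = Sc′
          inM (there (there (there (here refl)))) = iq (ipath-last (Ring.right R))
          inM (there (there (there (there i)))) = ir i

        private
          middle : ∀ l {m r} → (l ++ m ++ r) ⊆ₗ (l ++ r ++ m)
          middle l {m} i with ∈-++⁻ l i
          ... | inj₁ j = ∈-++⁺ˡ j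
          ... | inj₂ j = ∈-++⁺ʳ l (++-swap-⊆ m j)

          rotate : ∀ l {m r} → (l ++ m ++ r) ⊆ₗ (m ++ r ++ l)
          rotate l {m} {r} i = subst (_ ∈_) (List.++-assoc m r l) (++-swap-⊆ l i)

        -- Each way to fail as a theta gives a cycle that dominates as much as the three legs
        -- together: a dispensable leg is dropped, adjacent tips are used for a detour.
        theta-or-better : Theta G G ⊎ Better
        theta-or-better with kind R₁₂ p₃ | kind (ring-swap R₁₂) p₃ | kind (ring-swap R₁₃) p₂
        ... | inj₂ d | _ | _ = inj₂ (ringIn R₂₃ (in-++ p₂ in₂ in₃) , dom)
          where
          dom : ∀ {z} → S z ≡ true → Dom (p₁ ++ p₂ ++ p₃) z → Dom (p₂ ++ p₃) z
          dom sz e with dom-cases e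
          ... | inj₁ f = d sz f
          ... | inj₂ (inj₁ f) = dom-⊆ ∈-++⁺ˡ f
          ... | inj₂ (inj₂ f) = dom-⊆ (∈-++⁺ʳ p₂) f
        ... | inj₁ _ | inj₂ d | _ = inj₂ (ringIn R₁₃ (in-++ p₁ in₁ in₃) , dom)
          where
          dom : ∀ {z} → S z ≡ true → Dom (p₁ ++ p₂ ++ p₃) z → Dom (p₁ ++ p₃) z
          dom sz e with dom-cases e
          ... | inj₁ f = dom-⊆ ∈-++⁺ˡ f
          ... | inj₂ (inj₁ f) = d sz f
          ... | inj₂ (inj₂ f) = dom-⊆ (∈-++⁺ʳ p₁) f
        ... | inj₁ _ | inj₁ _ | inj₂ d = inj₂ (ringIn R₁₂ (in-++ p₁ in₁ in₂) , dom)
          where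
          dom : ∀ {z} → S z ≡ true → Dom (p₁ ++ p₂ ++ p₃) z → Dom (p₁ ++ p₂) z
          dom sz e with dom-cases e
          ... | inj₁ f = dom-⊆ ∈-++⁺ˡ f
          ... | inj₂ (inj₁ f) = dom-⊆ (∈-++⁺ʳ p₁) f
          ... | inj₂ (inj₂ f) = d sz f
        ... | inj₁ k₁ | inj₁ k₂ | inj₁ k₃
          with tips-clash k₁ k₂ ∈-++⁺ˡ (ipath-first (Ring.left R₁₂))
             | tips-clash k₁ k₃ ∈-++⁺ˡ (ipath-first (Ring.left R₁₂))
             | tips-clash k₂ k₃ (∈-++⁺ʳ p₁) (ipath-first (Ring.left R₂₃))
        ...   | inj₁ t₁₂ | inj₁ t₁₃ | inj₁ t₂₃ = inj₁ (good-theta k₁ k₂ k₃ t₁₂ t₁₃ t₂₃)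
        ...   | inj₂ (c , c′ , Sc , Sc′ , cc , T , T′) | _ | _ with clash R₁₂ R₁₃ R₂₃ Sc Sc′ in₁ in₂ in₃ cc T T′
        ...     | M , dom = inj₂ (M , λ _ → dom)
        theta-or-better | inj₁ k₁ | inj₁ k₂ | inj₁ k₃ | inj₁ _
          | inj₂ (c , c′ , Sc , Sc′ , cc , (e₁ , e₂ , e₃ , e₄ , far) , (f₁ , f₂ , f₃ , f₄ , far′)) | _
          with clash R₁₃ R₁₂ (ring-swap R₂₃) Sc Sc′ in₁ in₃ in₂ cc (e₁ , e₂ , e₃ , e₄ , far ∘ ++-swap-⊆ p₃) (f₁ , f₂ , f₃ , f₄ , far′)
        ... | M , dom = inj₂ (M , λ _ d → dom (dom-⊆ (middle p₁ {p₂} {p₃}) d))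
        theta-or-better | inj₁ k₁ | inj₁ k₂ | inj₁ k₃ | inj₁ _ | inj₁ _
          | inj₂ (c , c′ , Sc , Sc′ , cc , (e₁ , e₂ , e₃ , e₄ , far) , (f₁ , f₂ , f₃ , f₄ , far′))
          with clash R₂₃ (ring-swap R₁₂) (ring-swap R₁₃) Sc Sc′ in₂ in₃ in₁ cc
            (e₁ , e₂ , e₃ , e₄ , far ∘ ++-swap-⊆ p₃) (f₁ , f₂ , f₃ , f₄ , far′ ∘ ++-swap-⊆ p₂)
        ... | M , dom = inj₂ (M , λ _ d → dom (dom-⊆ (rotate p₁ {p₂} {p₃}) d))

-- Two-connected closed graphs are hamiltonian or contain a theta

module Search {n : ℕ} (G : Graph n) where
  open Adjacency G

  abstract
    subset : ∀ {P : V → Set} → (∀ z → Dec (P z)) → V → Bool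
    subset P? z = ⌊ P? z ⌋

    subset⁺ : ∀ {P : V → Set} (P? : ∀ z → Dec (P z)) {z} → P z → subset P? z ≡ true
    subset⁺ P? {z} = ⌊⌋⁺ (P? z)

    subset⁻ : ∀ {P : V → Set} (P? : ∀ z → Dec (P z)) {z} → subset P? z ≡ true → P z
    subset⁻ P? {z} = ⌊⌋⁻ (P? z)

    collapse : ∀ {P : V → Set} → (∀ z → Dec (P z)) → V → V → V
    collapse P? c z = if ⌊ P? z ⌋ then c else z

    collapse-cases : ∀ {P : V → Set} (P? : ∀ z → Dec (P z)) c z →
      (P z × collapse P? c z ≡ c) ⊎ (¬ P z × collapse P? c z ≡ z)
    collapse-cases P? c z with P? z
    ... | yes p = inj₁ (p , refl)
    ... | no ¬p = inj₂ (¬p , refl)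

  record Component (D : V → Bool) (w : V) : Set where
    field
      mem    : V → Bool
      start  : mem w ≡ true
      sound  : ∀ {z} → mem z ≡ true → D z ≡ true
      closed : ∀ {r z} → mem r ≡ true → D z ≡ true → r ~ z → mem z ≡ true
      walk   : ∀ {z} → mem z ≡ true → Walk (λ v → mem v ≡ true) w z

  abstract
    component : ∀ D w → D w ≡ true → Component D w
    component D w Dw = grow (suc (count (fresh (λ z → ⌊ z ≟ w ⌋)))) (λ z → ⌊ z ≟ w ⌋) ℕ.≤-refl
        (⌊⌋⁺ (w ≟ w) refl) (λ {z} t → subst (λ z → D z ≡ true) (sym (⌊⌋⁻ (z ≟ w) t)) Dw)
        (λ {z} t → subst (Walk _ w) (sym (⌊⌋⁻ (z ≟ w) t)) (stop (⌊⌋⁺ (w ≟ w) refl)))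
      where
      fresh : (V → Bool) → V → Bool
      fresh R z = D z ∧ not (R z)
      grow : ∀ k (R : V → Bool) → count (fresh R) < k → R w ≡ true → (∀ {z} → R z ≡ true → D z ≡ true) →
        (∀ {z} → R z ≡ true → Walk (λ v → R v ≡ true) w z) → Component D w
      grow (suc k) R (s≤s le) Rw sound walks
        with any? (λ r → any? (λ z → (R r Bool.≟ true) ×-dec ((D z Bool.≟ true) ×-dec (¬? (R z Bool.≟ true) ×-dec (r ~? z)))))
      ... | no none = record { mem = R ; start = Rw ; sound = sound ; closed = cl ; walk = walks }
        where
        cl : ∀ {r z} → R r ≡ true → D z ≡ true → r ~ z → R z ≡ true
        cl {r} {z} Rr Dz e with R z Bool.≟ true
        ... | yes t = t
        ... | no f = ⊥-elim (none (r , z , Rr , Dz , f , e))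
      ... | yes (r , z , Rr , Dz , nRz , e) = grow k R′ (ℕ.<-≤-trans (count-< sub z fz nfz) le) (old Rw) sound′ walks′
        where
        R′? : ∀ v → Dec (R v ≡ true ⊎ v ≡ z)
        R′? v = (R v Bool.≟ true) ⊎-dec (v ≟ z)
        R′ : V → Bool
        R′ v = ⌊ R′? v ⌋
        old : ∀ {v} → R v ≡ true → R′ v ≡ true
        old {v} t = ⌊⌋⁺ (R′? v) (inj₁ t)
        new : R′ z ≡ true
        new = ⌊⌋⁺ (R′? z) (inj₂ refl)
        sub : ∀ v → fresh R′ v ≡ true → fresh R v ≡ true
        sub v t with ∧-true t
        ... | Dv , nR = cong₂ _∧_ Dv (cong not (Bool.¬-not λ Rv → case trans (sym (cong not (old Rv))) nR of λ ()))
        fz : fresh R z ≡ true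
        fz rewrite Dz | Bool.¬-not nRz = refl
        nfz : fresh R′ z ≢ true
        nfz rewrite Dz | new = λ ()
        sound′ : ∀ {v} → R′ v ≡ true → D v ≡ true
        sound′ {v} t with ⌊⌋⁻ (R′? v) t
        ... | inj₁ s = sound s
        ... | inj₂ refl = Dz
        walks′ : ∀ {v} → R′ v ≡ true → Walk (λ v → R′ v ≡ true) w v
        walks′ {v} t with ⌊⌋⁻ (R′? v) t
        ... | inj₁ s = walk-map old (walks s)
        ... | inj₂ refl = walk-snoc (walk-map old (walks Rr)) e new

  -- Serves to pass 2-connectedness to a part: all else is collapsed onto a vertex of the part, and
  -- walks are pushed forward. A collapse preserves closeness, not adjacency.
  retract : ∀ {P Q : V → Set} (f : V → V) → (∀ {z t} → P z → P t → z ~ t → f z ≃ f t) → (∀ {z} → P z → Q (f z)) →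
    ∀ {u v} → Walk P u v → Walk Q (f u) (f v)
  retract f adjf into (stop p) = stop (into p)
  retract {P} {Q} f adjf into {v = t} (go p e w) with adjf p (walk-start w) e
  ... | inj₁ eq = subst (λ s → Walk Q s (f t)) (sym eq) (retract f adjf into w)
  ... | inj₂ e′ = go (into p) e′ (retract f adjf into w)

  record TwoConnectedOn (S : V → Bool) : Set where
    field
      connected : ∀ {u v} → S u ≡ true → S v ≡ true → Walk (λ z → S z ≡ true) u v
      robust    : ∀ {x u v} → S x ≡ true → S u ≡ true → S v ≡ true → u ≢ x → v ≢ x → Walk (λ z → S z ≡ true × z ≢ x) u v

  first-entry : ∀ {P D : V → Set} (D? : ∀ z → Dec (D z)) → ∀ {u v} → Walk P u v → ¬ D u → D v →
    ∃ λ w → ∃ λ y → P w × P y × ¬ D w × D y × w ~ y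
  first-entry D? (stop p) ¬d d = ⊥-elim (¬d d)
  first-entry D? (go {v = v} p e w) ¬d d with D? v
  ... | yes dv = _ , _ , p , walk-start w , ¬d , dv , e
  ... | no ¬dv = first-entry D? w ¬dv d

-- Ears of an induced cycle, and cuts at a clique

module Extraction {n : ℕ} (G : Graph n) (cf : ClawFree G) (df : DiamondFree G) where
  open Adjacency G
  open Claw cf
  open Cliques G df
  open ClosedGraph G cf df
  open Search G

  ear-ring : ∀ {a b p a′ b′ q t y r} → Ring a b p a′ b′ q → IPath t y r → t ≢ y →
    t ≃ a → t ≃ a′ → y ≃ b → a ≢ t → b ≢ y →
    (∀ {o} → o ∈ p → o ≃ t → o ≡ a) → (∀ {o} → o ∈ p → o ≃ y → o ≡ b) → (∀ {o} → o ∈ q → o ≃ y → o ≡ b′) →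
    (∀ {z} → z ∈ r → z ≡ t ⊎ z ≡ y ⊎ (∀ {o} → o ∈ p → Far o z)) → Ring a b p t y r
  ear-ring {a} {b} {p} {a′} {b′} {t = t} {y} {r} (ring l ri aa bb cr f f′) ip t≢y ta ta′ yb a≢t b≢y onlyt onlyy onlyy′ elems =
    ring l ip (≃⇒~ a≢t (≃-sym ta)) (≃⇒~ b≢y (≃-sym yb)) cross′ fat₁ (λ e → ⊥-elim (t≢y e))
    where
    cross′ : ∀ {x z} → x ∈ p → z ∈ r → x ≃ z → (x ≡ a × z ≡ t) ⊎ (x ≡ b × z ≡ y)
    cross′ i j c with elems j
    ... | inj₁ refl = inj₁ (onlyt i c , refl)
    ... | inj₂ (inj₁ refl) = inj₂ (onlyy i c , refl)
    ... | inj₂ (inj₂ far) = ⊥-elim (far i c)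
    -- If `t` and `y` were close, diamond-freeness at the edge `at` would make `a′` close to `y`,
    -- hence equal to `b′`, against `fat`.
    fat₁ : a ≡ b → Far t y
    fat₁ refl c = f refl (inj₁ (onlyy′ (ipath-first ri) a′y))
      where
      a′y : a′ ≃ y
      a′y = df (≃⇒~ a≢t (≃-sym ta)) (inj₂ (~-sym aa)) (≃-sym ta′) yb (≃-sym c)

  firstHit : ∀ {v c w t} → IPath c w (c ∷ t) → Far v c → v ≃ w →
    ∃ λ y → ∃ λ m → IPath c y (c ∷ m) × m ⊆ₗ t × v ≃ y × (∀ {z} → z ∈ c ∷ m → z ≃ v → z ≡ y)
  firstHit one f c = ⊥-elim (f c)
  firstHit {v} {c} (cons {c = d} {l = t} e g p) f cl with v ≃? d
  ... | yes vd = d , d ∷ [] , cons e (λ ()) one , (λ { (here refl) → here refl }) , vd , only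
    where
    only : ∀ {z} → z ∈ c ∷ d ∷ [] → z ≃ v → z ≡ d
    only (here refl) zv = ⊥-elim (f (≃-sym zv))
    only (there (here eq)) zv = eq
  ... | no fd with firstHit p fd cl
  ...   | y , m , q , sub , vy , only = y , d ∷ m , cons e (g ∘ sub) q , sub′ , vy , only′
    where
    sub′ : (d ∷ m) ⊆ₗ (d ∷ t)
    sub′ (here eq) = here eq
    sub′ (there i) = there (sub i)
    only′ : ∀ {z} → z ∈ c ∷ d ∷ m → z ≃ v → z ≡ y
    only′ (here refl) zv = ⊥-elim (f (≃-sym zv))
    only′ (there i) zv = only i zv

  -- As long as the second vertex is close to `v`, the first is dropped; the new first vertex stays
  -- far from `w`, or a diamond would make `u` and `w` close. After that, the first later vertex
  -- close to `v` closes an induced cycle.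
  chordless : ∀ {v u w l} → IPath u w l → (∀ {z} → z ∈ l → z ≢ v) → v ≃ u → v ≃ w → Far u w →
    ∃ λ x → ∃ λ y → ∃ λ q → Ring v v [ v ] x y q × q ⊆ₗ l
  chordless one ne vu vw far = ⊥-elim (far ≃-refl)
  chordless {v} {u} {w} (cons {c = c} {l = t} e f p) ne vu vw far with v ≃? c
  ... | yes vc with chordless p (ne ∘ there) vc vw (λ cw → far (df (≃⇒~ (ne (there (here refl)) ∘ sym) vc) (≃-sym vu) (inj₂ e) (≃-sym vw) (≃-sym cw)))
  ...   | x , y , q , R , sub = x , y , q , R , there ∘ sub
  chordless {v} {u} {w} (cons {c = c} {l = t} e f p) ne vu vw far | no fc with firstHit p fc vw
  ... | y , m , q , sub , vy , only = u , y , u ∷ c ∷ m ,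
    ring one (cons e (f ∘ sub) q) (≃⇒~ (ne (here refl) ∘ sym) vu) (≃⇒~ v≢y vy) cr (λ _ → uy) (λ eq → ⊥-elim (uy (inj₁ eq))) , sub′
    where
    sub′ : (u ∷ c ∷ m) ⊆ₗ (u ∷ c ∷ t)
    sub′ (here eq) = here eq
    sub′ (there (here eq)) = there (here eq)
    sub′ (there (there i)) = there (there (sub i))
    y∈ : y ∈ m
    y∈ with ipath-last q
    ... | here refl = ⊥-elim (fc vy)
    ... | there i = i
    uy : Far u y
    uy = f (sub y∈)
    v≢y : v ≢ y
    v≢y eq = ne (there (there (sub y∈))) (sym eq)
    cr : ∀ {x z} → x ∈ [ v ] → z ∈ u ∷ c ∷ m → x ≃ z → (x ≡ v × z ≡ u) ⊎ (x ≡ v × z ≡ y)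
    cr (here refl) (here refl) _ = inj₁ (refl , refl)
    cr (here refl) (there j) r = inj₂ (refl , only j (≃-sym r))

  HamOn : (V → Bool) → Set
  HamOn S = HamiltonianCycleOn G (λ z → S z ≡ true)

  -- The second vertex `v` of an induced path has two far neighbours on it, and 2-connectedness
  -- joins these by a path that avoids `v`.
  initial-ring : ∀ {S} → TwoConnectedOn S → ∀ {a b} → S a ≡ true → S b ≡ true → Far a b → RingIn S
  initial-ring {S} tc {a} {b} Sa Sb far with walk⇒ipath (TwoConnectedOn.connected tc Sa Sb)
  ... | _ , one , _ , _ = ⊥-elim (far ≃-refl)
  ... | _ , cons e _ one , _ , _ = ⊥-elim (far (inj₂ e))
  ... | _ , cons {c = v} e f (cons {c = c} e′ f′ p) , inS , _
    with walk⇒ipath (TwoConnectedOn.robust tc (inS (there (here refl))) Sa (inS (there (there (here refl)))) (~⇒≢ e) (~⇒≢ e′ ∘ sym))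
  ...   | l , q , in′ , _ with chordless q (proj₂ ∘ in′) (inj₂ (~-sym e)) (inj₂ e′) (f (here refl))
  ...     | x , y , m , R , sub = ringIn R inR
    where
    inR : ∀ {z} → z ∈ v ∷ m → S z ≡ true
    inR (here refl) = inS (there (here refl))
    inR (there i) = proj₁ (in′ (sub i))

  TwoPoints : (V → Bool) → Set
  TwoPoints S = ∃ λ u → ∃ λ v → S u ≡ true × S v ≡ true × u ≢ v

  -- when a part M of S hangs at the single clique of the edge bb′, cut the graph there and glue the two cycles
  module Gluing (S : V → Bool) (tc : TwoConnectedOn S)
    (IH : ∀ S′ → count S′ < count S → TwoConnectedOn S′ → TwoPoints S′ → Theta G G ⊎ HamOn S′)
    {b b′ y w : V} (bb′ : b ~ b′) (Sb : S b ≡ true) (Sb′ : S b′ ≡ true)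
    (M Att : V → Set) (M? : ∀ z → Dec (M z)) (att⇒M : ∀ {z} → Att z → M z) (M-S : ∀ {z} → M z → S z ≡ true)
    (¬Mb : ¬ M b) (¬Mb′ : ¬ M b′)
    (leave : ∀ {z t} → M z → ¬ M t → S t ≡ true → z ~ t → Att z × t ≃ b)
    (att~b : ∀ {z} → Att z → z ~ b) (att-att : ∀ {z t} → Att z → Att t → z ≃ t) (att-y : Att y)
    (Mw : M w) (w≢y : w ≢ y) (b-att : ∀ {c} → M c → b ~ c → Att c) (to : ∀ {u} → M u → Walk M u w)
    where

    Sy : S y ≡ true
    Sy = M-S (att⇒M att-y)

    y≢b : y ≢ b
    y≢b = ~⇒≢ (att~b att-y)

    near-y : ∀ {z t} → Att z → z ≃ t → t ≃ b → t ≃ y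
    near-y at zt tb = df (att~b at) (≃-sym zt) tb (att-att att-y at) (inj₂ (att~b att-y))

    GW? : ∀ z → Dec (M z ⊎ z ≡ b)
    GW? z = M? z ⊎-dec (z ≟ b)

    GW : V → Bool
    GW = subset GW?

    GW⁺ : ∀ {z} → M z ⊎ z ≡ b → GW z ≡ true
    GW⁺ = subset⁺ GW?

    GW⁻ : ∀ {z} → GW z ≡ true → M z ⊎ z ≡ b
    GW⁻ = subset⁻ GW?

    GW-S : ∀ {z} → GW z ≡ true → S z ≡ true
    GW-S t with GW⁻ t
    ... | inj₁ m = M-S m
    ... | inj₂ refl = Sb

    toGW : V → V
    toGW = collapse (¬? ∘ GW?) b

    toGW-cases : ∀ z → (¬ M z × toGW z ≡ b) ⊎ ((M z ⊎ z ≡ b) × toGW z ≡ z)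
    toGW-cases z with collapse-cases (¬? ∘ GW?) b z
    ... | inj₁ (¬g , e) = inj₁ (¬g ∘ inj₁ , e)
    ... | inj₂ (¬¬g , e) = inj₂ (decidable-stable (GW? z) ¬¬g , e)

    toGW-fix : ∀ {z} → GW z ≡ true → toGW z ≡ z
    toGW-fix {z} t with collapse-cases (¬? ∘ GW?) b z
    ... | inj₁ (¬g , _) = ⊥-elim (¬g (GW⁻ t))
    ... | inj₂ (_ , e) = e

    toGW-adj : ∀ {z t} → S z ≡ true → S t ≡ true → z ~ t → toGW z ≃ toGW t
    toGW-adj {z} {t} Sz St e = along (toGW-cases z) (toGW-cases t)
      where
      side : ∀ {z t} → M z ⊎ z ≡ b → S t ≡ true → z ~ t → ¬ M t → z ≃ b
      side (inj₁ m) St e ¬m = inj₂ (att~b (proj₁ (leave m ¬m St e)))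
      side (inj₂ refl) _ _ _ = ≃-refl
      along : ∀ {z′ t′} → (¬ M z × z′ ≡ b) ⊎ ((M z ⊎ z ≡ b) × z′ ≡ z) → (¬ M t × t′ ≡ b) ⊎ ((M t ⊎ t ≡ b) × t′ ≡ t) → z′ ≃ t′
      along (inj₁ (_ , refl)) (inj₁ (_ , refl)) = ≃-refl
      along (inj₂ (_ , refl)) (inj₂ (_ , refl)) = inj₂ e
      along (inj₂ (g , refl)) (inj₁ (¬m , refl)) = side g St e ¬m
      along (inj₁ (¬m , refl)) (inj₂ (g , refl)) = ≃-sym (side g Sz (~-sym e) ¬m)

    toGW-in : ∀ {z} → GW (toGW z) ≡ true
    toGW-in {z} with toGW-cases z
    ... | inj₁ (_ , e) = subst (λ s → GW s ≡ true) (sym e) (GW⁺ (inj₂ refl))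
    ... | inj₂ (g , e) = subst (λ s → GW s ≡ true) (sym e) (GW⁺ g)

    GW-fixed : ∀ {Q : V → Set} {u v} → GW u ≡ true → GW v ≡ true → Walk Q (toGW u) (toGW v) → Walk Q u v
    GW-fixed {Q} Gu Gv w = subst (λ s → Walk Q s _) (toGW-fix Gu) (subst (Walk Q _) (toGW-fix Gv) w)

    to-w : ∀ {u} → M u → Walk (λ z → GW z ≡ true × z ≢ b) u w
    to-w m = walk-map (λ m → GW⁺ (inj₁ m) , λ { refl → ¬Mb m }) (to m)

    -- All of the rest is collapsed onto `b`. When `b` itself is deleted this target is gone, but
    -- `M` is connected on its own through `w`.
    GW-connected : TwoConnectedOn GW
    GW-connected = record { connected = conn ; robust = rob }
      where
      conn : ∀ {u v} → GW u ≡ true → GW v ≡ true → Walk (λ z → GW z ≡ true) u v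
      conn Gu Gv = GW-fixed Gu Gv (retract toGW toGW-adj (λ {z} _ → toGW-in {z}) (TwoConnectedOn.connected tc (GW-S Gu) (GW-S Gv)))
      rob : ∀ {x u v} → GW x ≡ true → GW u ≡ true → GW v ≡ true → u ≢ x → v ≢ x → Walk (λ z → GW z ≡ true × z ≢ x) u v
      rob {x} Gx Gu Gv u≢x v≢x with x ≟ b
      ... | yes refl = walk-trans (to-w (drop (GW⁻ Gu) u≢x)) (walk-sym (to-w (drop (GW⁻ Gv) v≢x)))
        where
        drop : ∀ {z} → M z ⊎ z ≡ b → z ≢ b → M z
        drop (inj₁ m) _ = m
        drop (inj₂ e) ne = ⊥-elim (ne e)
      ... | no x≢b = GW-fixed Gu Gv (retract toGW (λ (Sz , _) (St , _) → toGW-adj Sz St) (λ {z} (_ , ne) → toGW-in {z} , avoid ne)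
                       (TwoConnectedOn.robust tc (GW-S Gx) (GW-S Gu) (GW-S Gv) u≢x v≢x))
        where
        avoid : ∀ {z} → z ≢ x → toGW z ≢ x
        avoid {z} ne with toGW-cases z
        ... | inj₁ (_ , e) = λ e′ → x≢b (trans (sym e′) e)
        ... | inj₂ (_ , e) = λ e′ → ne (trans (sym e) e′)

    Rest? : ∀ z → Dec (S z ≡ true × (¬ M z ⊎ z ≡ y))
    Rest? z = (S z Bool.≟ true) ×-dec (¬? (M? z) ⊎-dec (z ≟ y))

    Rest : V → Bool
    Rest = subset Rest?

    Rest⁺ : ∀ {z} → S z ≡ true → ¬ M z ⊎ z ≡ y → Rest z ≡ true
    Rest⁺ s m = subset⁺ Rest? (s , m)

    Rest⁻ : ∀ {z} → Rest z ≡ true → S z ≡ true × (¬ M z ⊎ z ≡ y)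
    Rest⁻ = subset⁻ Rest?

    Rest-S : ∀ {z} → Rest z ≡ true → S z ≡ true
    Rest-S = proj₁ ∘ Rest⁻

    -- contracting the component and its attachments onto y, or onto b
    toward : V → V → V
    toward = collapse M?

    toward-M : ∀ {c z} → M z → toward c z ≡ c
    toward-M {c} {z} m with collapse-cases M? c z
    ... | inj₁ (_ , e) = e
    ... | inj₂ (¬m , _) = ⊥-elim (¬m m)

    toward-out : ∀ {c z} → ¬ M z → toward c z ≡ z
    toward-out {c} {z} ¬m with collapse-cases M? c z
    ... | inj₁ (m , _) = ⊥-elim (¬m m)
    ... | inj₂ (_ , e) = e

    toward-adj : ∀ {c} → (∀ {z t} → Att z → z ~ t → t ≃ b → t ≃ c) → ∀ {z t} → S z ≡ true → S t ≡ true → z ~ t → toward c z ≃ toward c t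
    toward-adj {c} h {z} {t} Sz St e = along (collapse-cases M? c z) (collapse-cases M? c t)
      where
      along : ∀ {z′ t′} → (M z × z′ ≡ c) ⊎ (¬ M z × z′ ≡ z) → (M t × t′ ≡ c) ⊎ (¬ M t × t′ ≡ t) → z′ ≃ t′
      along (inj₁ (_ , refl)) (inj₁ (_ , refl)) = ≃-refl
      along (inj₂ (_ , refl)) (inj₂ (_ , refl)) = inj₂ e
      along (inj₁ (m , refl)) (inj₂ (¬m , refl)) = let (at , tb) = leave m ¬m St e in ≃-sym (h at e tb)
      along (inj₂ (¬m , refl)) (inj₁ (m , refl)) = let (at , zb) = leave m ¬m Sz (~-sym e) in h at (~-sym e) zb

    -- The target of the collapse must survive: it is `y`, except that `b` is used when `y` is the
    -- deleted vertex.
    Rest-connected : TwoConnectedOn Rest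
    Rest-connected = record { connected = conn ; robust = rob }
      where
      fixed : ∀ {z} → Rest z ≡ true → toward y z ≡ z
      fixed {z} t with proj₂ (Rest⁻ t)
      ... | inj₁ ¬m = toward-out ¬m
      ... | inj₂ refl = toward-M (att⇒M att-y)
      adj-y : ∀ {z t} → S z ≡ true → S t ≡ true → z ~ t → toward y z ≃ toward y t
      adj-y = toward-adj (λ at e tb → near-y at (inj₂ e) tb)
      into-y : ∀ {z} → S z ≡ true → Rest (toward y z) ≡ true
      into-y {z} Sz with collapse-cases M? y z
      ... | inj₁ (_ , e) = subst (λ s → Rest s ≡ true) (sym e) (Rest⁺ Sy (inj₂ refl))
      ... | inj₂ (¬m , e) = subst (λ s → Rest s ≡ true) (sym e) (Rest⁺ Sz (inj₁ ¬m))
      conn : ∀ {u v} → Rest u ≡ true → Rest v ≡ true → Walk (λ z → Rest z ≡ true) u v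
      conn {u} {v} Ru Rv = subst (λ s → Walk _ s v) (fixed Ru) (subst (Walk _ _) (fixed Rv)
        (retract (toward y) adj-y into-y (TwoConnectedOn.connected tc (Rest-S Ru) (Rest-S Rv))))
      outside : ∀ {z} → Rest z ≡ true → z ≢ y → ¬ M z
      outside t ne with proj₂ (Rest⁻ t)
      ... | inj₁ ¬m = ¬m
      ... | inj₂ eq = ⊥-elim (ne eq)
      rob : ∀ {x u v} → Rest x ≡ true → Rest u ≡ true → Rest v ≡ true → u ≢ x → v ≢ x → Walk (λ z → Rest z ≡ true × z ≢ x) u v
      rob {x} {u} {v} Rx Ru Rv u≢x v≢x with x ≟ y
      ... | no x≢y = subst (λ s → Walk _ s v) (fixed Ru) (subst (Walk _ _) (fixed Rv)
          (retract (toward y) (λ (Sz , _) (St , _) → adj-y Sz St) (λ {z} (Sz , ne) → into-y Sz , avoid ne)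
            (TwoConnectedOn.robust tc (Rest-S Rx) (Rest-S Ru) (Rest-S Rv) u≢x v≢x)))
        where
        avoid : ∀ {z} → z ≢ x → toward y z ≢ x
        avoid {z} ne with collapse-cases M? y z
        ... | inj₁ (_ , e) = λ e′ → x≢y (trans (sym e′) e)
        ... | inj₂ (_ , e) = λ e′ → ne (trans (sym e) e′)
      ... | yes refl = subst (λ s → Walk _ s v) (toward-out (outside Ru u≢x)) (subst (Walk _ _) (toward-out (outside Rv v≢x))
          (retract (toward b) (λ (Sz , _) (St , _) → toward-adj (λ _ _ tb → tb) Sz St) into-b
            (TwoConnectedOn.robust tc (Rest-S Rx) (Rest-S Ru) (Rest-S Rv) u≢x v≢x)))
        where
        into-b : ∀ {z} → S z ≡ true × z ≢ y → Rest (toward b z) ≡ true × toward b z ≢ y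
        into-b {z} (Sz , ne) with collapse-cases M? b z
        ... | inj₁ (_ , e) = subst (λ s → Rest s ≡ true × s ≢ y) (sym e) (Rest⁺ (Sb) (inj₁ (¬Mb)) , y≢b ∘ sym)
        ... | inj₂ (¬m , e) = subst (λ s → Rest s ≡ true × s ≢ y) (sym e) (Rest⁺ Sz (inj₁ ¬m) , ne)

    GW-smaller : count GW < count S
    GW-smaller = count-< (λ _ → GW-S) b′ (Sb′) λ t → case GW⁻ t of λ where
      (inj₁ m) → ¬Mb′ m
      (inj₂ e) → ~⇒≢ bb′ (sym e)

    Rest-smaller : count Rest < count S
    Rest-smaller = count-< (λ _ → Rest-S) w (M-S Mw) λ t → case proj₂ (Rest⁻ t) of λ where
      (inj₁ ¬m) → ¬m Mw
      (inj₂ e) → w≢y e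

    -- The part `M` keeps a copy of `b`, the rest a copy of `y`. The neighbours of `b` on the first
    -- cycle and those of `y` on the second all lie in the clique of the edge `by`, so once these
    -- two copies are removed the remaining paths can be joined at their ends.
    glue : HamOn GW → HamOn Rest → HamOn S
    glue (_ , _ , l , P , cl , un , inl , alll) (_ , _ , l′ , P′ , cl′ , un′ , inl′ , alll′)
      with cycle-open G P cl (alll (GW⁺ (inj₂ refl))) | cycle-open G P′ cl′ (alll′ (Rest⁺ Sy (inj₂ refl)))
    ... | s , t , m , Q , bs , bt , π | s′ , t′ , m′ , Q′ , ys′ , yt′ , π′ =
      s , t′ , m ++ m′ , path-++ Q (link t∈ bt s′∈ ys′) Q′ , ~-sym (link s∈ bs t′∈ yt′) ,
      Unique.++⁺ um um′ (λ (i , j) → proj₂ (outm′ j) (inm i)) , ins , alls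
      where
      ubm : Unique (b ∷ m)
      ubm = unique-↭ (↭-sym π) un
      uym : Unique (y ∷ m′)
      uym = unique-↭ (↭-sym π′) un′
      um : Unique m
      um with _ ∷ u ← ubm = u
      um′ : Unique m′
      um′ with _ ∷ u ← uym = u
      inm : ∀ {z} → z ∈ m → M z
      inm i with GW⁻ (inl (∈-resp-↭ π (there i))) | ubm
      ... | inj₁ k | _ = k
      ... | inj₂ refl | b∉ ∷ _ = ⊥-elim (All.lookup b∉ i refl)
      outm′ : ∀ {z} → z ∈ m′ → S z ≡ true × ¬ M z
      outm′ i with Rest⁻ (inl′ (∈-resp-↭ π′ (there i))) | uym
      ... | Sz , inj₁ ¬k | _ = Sz , ¬k
      ... | Sz , inj₂ refl | y∉ ∷ _ = ⊥-elim (All.lookup y∉ i refl)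
      s∈ = inm (path-first Q)
      t∈ = inm (path-last Q)
      s′∈ = outm′ (path-first Q′)
      t′∈ = outm′ (path-last Q′)
      link : ∀ {c d} → M c → b ~ c → S d ≡ true × ¬ M d → y ~ d → c ~ d
      link {c} {d} Mc bc (Sd , ¬Md) yd = ≃⇒~ (λ { refl → ¬Md Mc })
        (df (~-sym (att~b att-y)) (inj₂ (~-sym bc)) (att-att (b-att Mc bc) att-y) (proj₂ (leave (att⇒M att-y) ¬Md Sd yd)) (inj₂ (~-sym yd)))
      ins : ∀ {z} → z ∈ m ++ m′ → S z ≡ true
      ins i with ∈-++⁻ m i
      ... | inj₁ j = M-S (inm j)
      ... | inj₂ j = proj₁ (outm′ j)
      alls : ∀ {z} → S z ≡ true → z ∈ m ++ m′
      alls {z} Sz with M? z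
      ... | yes k with ∈-resp-↭ (↭-sym π) (alll (GW⁺ (inj₁ k)))
      ...   | here refl = ⊥-elim (¬Mb k)
      ...   | there j = ∈-++⁺ˡ j
      alls {z} Sz | no ¬k with ∈-resp-↭ (↭-sym π′) (alll′ (Rest⁺ Sz (inj₁ ¬k)))
      ...   | here refl = ⊥-elim (¬k (att⇒M att-y))
      ...   | there j = ∈-++⁺ʳ m j

    glued-cycle : Theta G G ⊎ HamOn S
    glued-cycle = outer (IH GW GW-smaller GW-connected (y , b , GW⁺ (inj₁ (att⇒M att-y)) , GW⁺ (inj₂ refl) , y≢b))
      where
      inner : HamOn GW → Theta G G ⊎ HamOn Rest → Theta G G ⊎ HamOn S
      inner h (inj₁ θ) = inj₁ θ
      inner h (inj₂ h′) = inj₂ (glue h h′)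
      outer : Theta G G ⊎ HamOn GW → Theta G G ⊎ HamOn S
      outer (inj₁ θ) = inj₁ θ
      outer (inj₂ h) = inner h (IH Rest Rest-smaller Rest-connected
        (b , b′ , Rest⁺ Sb (inj₁ ¬Mb) , Rest⁺ Sb′ (inj₁ ¬Mb′) , ~⇒≢ bb′))

  module Step (S : V → Bool) (tc : TwoConnectedOn S)
    (IH : ∀ S′ → count S′ < count S → TwoConnectedOn S′ → TwoPoints S′ → Theta G G ⊎ HamOn S′) where

    module Attached {a b p a′ b′ q} (R : Ring a b p a′ b′ q) (inS : ∀ {z} → z ∈ p ++ q → S z ≡ true)
      {w y} (Sw : S w ≡ true) (¬Dw : ¬ Dom (p ++ q) w) (Sy : S y ≡ true) (wy : w ~ y) (yb : y ≃ b) (yb′ : y ≃ b′)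
      (In : V → Bool) (start : In w ≡ true) (outer : ∀ {z} → In z ≡ true → S z ≡ true × ¬ Dom (p ++ q) z)
      (closed : ∀ {r z} → In r ≡ true → S z ≡ true → ¬ Dom (p ++ q) z → r ~ z → In z ≡ true)
      (walk : ∀ {z} → In z ≡ true → Walk (λ v → In v ≡ true) w z)
      where

      O : List V
      O = p ++ q

      a∈ : a ∈ O
      a∈ = ∈-++⁺ˡ (ipath-first (Ring.left R))
      a′∈ : a′ ∈ O
      a′∈ = ∈-++⁺ʳ p (ipath-first (Ring.right R))
      b∈ : b ∈ O
      b∈ = ∈-++⁺ˡ (ipath-last (Ring.left R))
      b′∈ : b′ ∈ O
      b′∈ = ∈-++⁺ʳ p (ipath-last (Ring.right R))

      bb′ : b ~ b′
      bb′ = Ring.bb R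

      far-outer : ∀ {o r} → o ∈ O → In r ≡ true → Far o r
      far-outer i t c = proj₂ (outer t) (_ , i , c)

      Att : V → Set
      Att z = S z ≡ true × Dom O z × ∃ λ r → In r ≡ true × r ~ z

      att? : ∀ z → Dec (Att z)
      att? z = (S z Bool.≟ true) ×-dec (dom? O z ×-dec any? (λ r → (In r Bool.≟ true) ×-dec (r ~? z)))

      att-y : Att y
      att-y = Sy , (b , b∈ , ≃-sym yb) , w , start , wy

      att-off : ∀ {z} → Att z → ∀ {o} → o ∈ O → z ≢ o
      att-off (_ , _ , r , Ir , rz) i refl = far-outer i Ir (inj₂ (~-sym rz))

      -- The third leaf at `z` is its neighbour in the component, which is far from the whole cycle.
      att-pair : ∀ {z} → Att z → ∀ {o o′} → o ∈ O → o′ ∈ O → o ≃ z → o′ ≃ z → o ≃ o′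
      att-pair (_ , _ , r , Ir , rz) i j oz o′z =
        claw₃ (inj₂ (~-sym rz)) (≃-sym oz) (≃-sym o′z) (far-sym (far-outer i Ir)) (far-sym (far-outer j Ir))

      Improved : Set
      Improved = Σ (RingIn S) λ R′ → (∀ {z} → S z ≡ true → Dom O z → Dom (RingIn.verts R′) z) × Dom (RingIn.verts R′) w

      -- The ear is a third leg: with either leg of the cycle it forms a ring. Since it ends at `y`,
      -- the three legs together dominate `w`, so a ring that dominates as much as they do is a
      -- strict gain.
      ear-along : ∀ {t e} → Att t → t ≃ a → t ≃ a′ → ¬ (t ≃ b × t ≃ b′) → IPath t y e →
        (∀ {z} → z ∈ e → z ≡ t ⊎ z ≡ y ⊎ In z ≡ true) → Theta G G ⊎ Improved
      ear-along {t} {e} at ta ta′ nb ip el = conclude (theta-or-better S R R₁ R₂ (λ i → inS (∈-++⁺ˡ i)) (λ i → inS (∈-++⁺ʳ p i)) inE)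
        where
        t≢y : t ≢ y
        t≢y refl = nb (yb , yb′)
        elems : ∀ {m} → m ⊆ₗ O → ∀ {z} → z ∈ e → z ≡ t ⊎ z ≡ y ⊎ (∀ {o} → o ∈ m → Far o z)
        elems s i with el i
        ... | inj₁ eq = inj₁ eq
        ... | inj₂ (inj₁ eq) = inj₂ (inj₁ eq)
        ... | inj₂ (inj₂ m) = inj₂ (inj₂ (λ j → far-outer (s j) m))
        Rs = ring-swap R
        swapped : ∀ {z} → z ∈ q ++ p → z ∈ O
        swapped = ++-swap-⊆ q
        bottom-only : ∀ {a b p a′ b′ q} → Ring a b p a′ b′ q → (p ++ q) ⊆ₗ O → y ≃ b → y ≃ b′ → ∀ {o} → o ∈ p → o ≃ y → o ≡ b
        bottom-only {p = p₀} {q = q₀} R₀ s yb yb′ i c with Ring.cross R₀ i (ipath-last (Ring.right R₀))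
                     (att-pair att-y (s (∈-++⁺ˡ i)) (s (∈-++⁺ʳ p₀ (ipath-last (Ring.right R₀)))) c (≃-sym yb′))
        ... | inj₂ (eq , _) = eq
        ... | inj₁ (refl , eq) = ⊥-elim (Ring.fat′ R₀ (sym eq)
                (att-pair att-y (s (∈-++⁺ˡ i)) (s (∈-++⁺ˡ (ipath-last (Ring.left R₀)))) c (≃-sym yb)))
        onlyyp : ∀ {o} → o ∈ p → o ≃ y → o ≡ b
        onlyyp = bottom-only R id yb yb′
        onlyyq : ∀ {o} → o ∈ q → o ≃ y → o ≡ b′
        onlyyq = bottom-only Rs swapped yb′ yb
        R₁ : Ring a b p t y e
        R₁ = ear-ring R ip t≢y ta ta′ yb (att-off at a∈ ∘ sym) (att-off att-y b∈ ∘ sym)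
          (top-only R (λ i j → att-pair at i j) ta ta′) onlyyp onlyyq (elems ∈-++⁺ˡ)
        R₂ : Ring a′ b′ q t y e
        R₂ = ear-ring Rs ip t≢y ta′ ta yb′ (att-off at a′∈ ∘ sym) (att-off att-y b′∈ ∘ sym)
          (top-only Rs (λ i j → att-pair at (swapped i) (swapped j)) ta′ ta) onlyyq onlyyp (elems (∈-++⁺ʳ p))
        inE : ∀ {z} → z ∈ e → S z ≡ true
        inE i with el i
        ... | inj₁ refl = proj₁ at
        ... | inj₂ (inj₁ refl) = Sy
        ... | inj₂ (inj₂ m) = proj₁ (outer m)
        conclude : Theta G G ⊎ (Σ (RingIn S) λ R′ → ∀ {z} → S z ≡ true → Dom (p ++ q ++ e) z → Dom (RingIn.verts R′) z) → Theta G G ⊎ Improved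
        conclude (inj₁ θ) = inj₁ θ
        conclude (inj₂ (R′ , dom)) = inj₂ (R′ ,
          (λ Sz d → dom Sz (dom-⊆ (λ i → subst (_ ∈_) (List.++-assoc p q e) (∈-++⁺ˡ i)) d)) ,
          dom Sw (y , ∈-++⁺ʳ p (∈-++⁺ʳ q (ipath-last ip)) , inj₂ (~-sym wy)))

      ear : ∀ {t} → Att t → t ≃ a → t ≃ a′ → ¬ (t ≃ b × t ≃ b′) → Theta G G ⊎ Improved
      ear {t} at@(St , _ , r , Ir , rt) ta ta′ nb with walk⇒ipath ear-walk
        where
        ear-walk : Walk (λ z → z ≡ t ⊎ z ≡ y ⊎ In z ≡ true) t y
        ear-walk = go (inj₁ refl) (~-sym rt)
          (walk-snoc (walk-map (λ m → inj₂ (inj₂ m)) (walk-sym (walk Ir))) wy (inj₂ (inj₁ refl)))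
      ... | e , ip , el , _ = ear-along at ta ta′ nb ip el
      module Cut (all : ∀ {z} → Att z → z ≃ b × z ≃ b′) where

        M : V → Set
        M z = In z ≡ true ⊎ Att z

        M? : ∀ z → Dec (M z)
        M? z = (In z Bool.≟ true) ⊎-dec att? z

        M-S : ∀ {z} → M z → S z ≡ true
        M-S (inj₁ t) = proj₁ (outer t)
        M-S (inj₂ (Sz , _)) = Sz

        M-off : ∀ {o} → o ∈ O → ¬ M o
        M-off i (inj₁ t) = far-outer i t ≃-refl
        M-off i (inj₂ at) = att-off at i refl

        in-closed : ∀ {z t} → In z ≡ true → S t ≡ true → z ~ t → M t
        in-closed {z} {t} Iz St e with dom? O t
        ... | yes d = inj₂ (St , d , z , Iz , e)
        ... | no ¬d = inj₁ (closed Iz St ¬d e)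

        att-nbr : ∀ {z t} → Att z → S t ≡ true → z ~ t → t ≃ b ⊎ M t
        att-nbr at@(_ , _ , r , Ir , rz) St e with claw₂ (proj₁ (all at)) (inj₂ (~-sym rz)) (inj₂ e) (far-outer b∈ Ir)
        ... | inj₁ c = inj₁ (≃-sym c)
        ... | inj₂ (inj₁ refl) = inj₂ (inj₁ Ir)
        ... | inj₂ (inj₂ e′) = inj₂ (in-closed Ir St e′)

        att-att : ∀ {z t} → Att z → Att t → z ≃ t
        att-att at at′ = clique-≃ bb′ (all at) (all at′)

        leave : ∀ {z t} → M z → ¬ M t → S t ≡ true → z ~ t → Att z × t ≃ b
        leave (inj₁ Iz) ¬Mt St e = ⊥-elim (¬Mt (in-closed Iz St e))
        leave (inj₂ at) ¬Mt St e with att-nbr at St e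
        ... | inj₁ c = at , c
        ... | inj₂ m = ⊥-elim (¬Mt m)

        att~b : ∀ {z} → Att z → z ~ b
        att~b at = ≃⇒~ (att-off at b∈) (proj₁ (all at))

        to : ∀ {u} → M u → Walk M u w
        to (inj₁ t) = walk-map inj₁ (walk-sym (walk t))
        to m@(inj₂ (_ , _ , r , Ir , ru)) = go m (~-sym ru) (walk-map inj₁ (walk-sym (walk Ir)))

        b-att : ∀ {c} → M c → b ~ c → Att c
        b-att (inj₁ Ic) bc = ⊥-elim (far-outer b∈ Ic (inj₂ bc))
        b-att (inj₂ at) bc = at

        cut-cycle : Theta G G ⊎ HamOn S
        cut-cycle = Gluing.glued-cycle S tc IH bb′ (inS b∈) (inS b′∈) M Att M? inj₂ M-S (M-off b∈) (M-off b′∈)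
          leave att~b att-att att-y (inj₁ start) (~⇒≢ wy) b-att to

    Gain : List V → Set
    Gain O = Σ (RingIn S) λ R′ → (∀ {z} → S z ≡ true → Dom O z → Dom (RingIn.verts R′) z) ×
      ∃ λ w → S w ≡ true × ¬ Dom O w × Dom (RingIn.verts R′) w

    -- If some attachment of the component misses the bottom clique, the cycle is turned until the
    -- edge at this attachment is on top, and an ear runs from there through the component to `y`.
    -- If there is none, the component hangs at one clique and the graph is cut there.
    resolve : ∀ {a b p a′ b′ q} → Ring a b p a′ b′ q → (∀ {z} → z ∈ p ++ q → S z ≡ true) →
      ∀ {w y} → S w ≡ true → ¬ Dom (p ++ q) w → S y ≡ true → w ~ y → y ≃ b → y ≃ b′ →
      (In : V → Bool) → In w ≡ true → (∀ {z} → In z ≡ true → S z ≡ true × ¬ Dom (p ++ q) z) →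
      (∀ {r z} → In r ≡ true → S z ≡ true → ¬ Dom (p ++ q) z → r ~ z → In z ≡ true) →
      (∀ {z} → In z ≡ true → Walk (λ v → In v ≡ true) w z) →
      Theta G G ⊎ HamOn S ⊎ Gain (p ++ q)
    resolve {a} {b} {p} {a′} {b′} {q} R inS {w} {y} Sw ¬Dw Sy wy yb yb′ In start outer closed walk
      with any? (λ t → A.att? t ×-dec ¬? ((t ≃? b) ×-dec (t ≃? b′)))
      where module A = Attached R inS Sw ¬Dw Sy wy yb yb′ In start outer closed walk
    ... | no none = case A.Cut.cut-cycle all of λ where
        (inj₁ θ) → inj₁ θ
        (inj₂ h) → inj₂ (inj₁ h)
      where
      module A = Attached R inS Sw ¬Dw Sy wy yb yb′ In start outer closed walk
      all : ∀ {z} → A.Att z → z ≃ b × z ≃ b′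
      all {z} at = decidable-stable ((z ≃? b) ×-dec (z ≃? b′)) (λ ne → none (z , at , ne))
    ... | yes (t , (St , (o , o∈ , ot) , r , Ir , rt) , nb) = split (∈-++⁻ p o∈)
      where
      rotated : ∀ {c c′ p₁ q₁} → Ring c b p₁ c′ b′ q₁ → t ≃ c → t ≃ c′ → (p ++ q) ⊆ₗ (p₁ ++ q₁) → (p₁ ++ q₁) ⊆ₗ (p ++ q) →
        Theta G G ⊎ HamOn S ⊎ Gain (p ++ q)
      rotated R₁ tc₁ tc₁′ s s′ = conclude (B.ear (St , (o , s o∈ , ot) , r , Ir , rt) tc₁ tc₁′ nb)
        where
        module B = Attached R₁ (λ i → inS (s′ i)) Sw (λ d → ¬Dw (dom-⊆ s′ d)) Sy wy yb yb′ In start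
          (λ Iz → proj₁ (outer Iz) , λ d → proj₂ (outer Iz) (dom-⊆ s′ d)) (λ Ir Sz ¬d → closed Ir Sz (λ d → ¬d (dom-⊆ s d))) walk
        conclude : Theta G G ⊎ B.Improved → Theta G G ⊎ HamOn S ⊎ Gain (p ++ q)
        conclude (inj₁ θ) = inj₁ θ
        conclude (inj₂ (R′ , dom , dw)) = inj₂ (inj₂ (R′ , (λ Sz d → dom Sz (dom-⊆ s d)) , w , Sw , ¬Dw , dw))
      split : o ∈ p ⊎ o ∈ q → Theta G G ⊎ HamOn S ⊎ Gain (p ++ q)
      split (inj₁ i) with scan R i ot
      ... | inj₁ (c , c′ , p₁ , q₁ , R₁ , tc , tc′ , s , s′) = rotated R₁ tc tc′ s s′
      ... | inj₂ hit = ⊥-elim (nb hit)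
      split (inj₂ i) with scan (ring-swap R) i ot
      ... | inj₁ (c , c′ , p₁ , q₁ , R₁ , tc , tc′ , s , s′) =
        rotated (ring-swap R₁) tc′ tc (λ k → ++-swap-⊆ p₁ (s (++-swap-⊆ p k))) (λ k → ++-swap-⊆ q (s′ (++-swap-⊆ q₁ k)))
      ... | inj₂ (h , h′) = ⊥-elim (nb (h′ , h))

    BottomRing : V → List V → Set
    BottomRing y O = ∃ λ c → ∃ λ d → ∃ λ p → ∃ λ c′ → ∃ λ d′ → ∃ λ q →
      Ring c d p c′ d′ q × y ≃ d × y ≃ d′ × O ⊆ₗ (p ++ q) × (p ++ q) ⊆ₗ O

    to-bottom : ∀ {y a b p a′ b′ q o} → Ring a b p a′ b′ q → o ∈ p → o ≃ y → BottomRing y (p ++ q)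
    to-bottom R i oy with scan R i oy
    ... | inj₂ (h , h′) = _ , _ , _ , _ , _ , _ , R , h , h′ , id , id
    ... | inj₁ (c , c′ , p₁ , q₁ , R₁ , yc , yc′ , s , s′) with ring-flip R₁
    ...   | p₂ , q₂ , R₂ , u , u′ = _ , _ , p₂ , _ , _ , q₂ , R₂ , yc , yc′ , (λ k → u (s k)) , λ k → s′ (u′ k)

    advance : (R : RingIn S) → ∀ {w} → S w ≡ true → ¬ Dom (RingIn.verts R) w → Theta G G ⊎ HamOn S ⊎ Gain (RingIn.verts R)
    advance (ringIn {a} {p = p} {q = q} R inS) {w₀} Sw₀ ¬Dw₀
      with first-entry (dom? (p ++ q)) (TwoConnectedOn.connected tc Sw₀ (inS (∈-++⁺ˡ (ipath-first (Ring.left R))))) ¬Dw₀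
             (a , ∈-++⁺ˡ (ipath-first (Ring.left R)) , ≃-refl)
    ... | w , y , Sw , Sy , ¬Dw , (o , o∈ , oy) , wy = from (bottom (∈-++⁻ p o∈))
      where
      bottom : o ∈ p ⊎ o ∈ q → BottomRing y (p ++ q)
      bottom (inj₁ i) = to-bottom R i oy
      bottom (inj₂ i) with to-bottom (ring-swap R) i oy
      ... | c , d , p₁ , c′ , d′ , q₁ , R₁ , h , h′ , s , s′ =
        c , d , p₁ , c′ , d′ , q₁ , R₁ , h , h′ , (λ k → s (++-swap-⊆ p k)) , λ k → ++-swap-⊆ q (s′ k)
      from : BottomRing y (p ++ q) → Theta G G ⊎ HamOn S ⊎ Gain (p ++ q)
      from (c , d , p₁ , c′ , d′ , q₁ , R₁ , yd , yd′ , s , s′) =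
        transport (resolve R₁ (λ i → inS (s′ i)) Sw ¬Dw₁ Sy wy yd yd′ mem start (λ t → subset⁻ Outer? (sound t))
          (λ Ir Sz ¬d e → closed Ir (subset⁺ Outer? (Sz , ¬d)) e) walk)
        where
        ¬Dw₁ : ¬ Dom (p₁ ++ q₁) w
        ¬Dw₁ d = ¬Dw (dom-⊆ s′ d)
        Outer? : ∀ z → Dec (S z ≡ true × ¬ Dom (p₁ ++ q₁) z)
        Outer? z = (S z Bool.≟ true) ×-dec ¬? (dom? (p₁ ++ q₁) z)
        open Component (component (subset Outer?) w (subset⁺ Outer? (Sw , ¬Dw₁)))
        transport : Theta G G ⊎ HamOn S ⊎ Gain (p₁ ++ q₁) → Theta G G ⊎ HamOn S ⊎ Gain (p ++ q)
        transport (inj₁ θ) = inj₁ θ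
        transport (inj₂ (inj₁ h)) = inj₂ (inj₁ h)
        transport (inj₂ (inj₂ (R′ , dom , v , Sv , ¬d , d))) =
          inj₂ (inj₂ (R′ , (λ Sz e → dom Sz (dom-⊆ s e)) , v , Sv , (λ e → ¬d (dom-⊆ s e)) , d))

    undominated : List V → V → Bool
    undominated O = subset (λ z → (S z Bool.≟ true) ×-dec ¬? (dom? O z))

    gain-smaller : ∀ {O} → ((R′ , _) : Gain O) → count (undominated (RingIn.verts R′)) < count (undominated O)
    gain-smaller {O} (R′ , dom , v , Sv , ¬d , d) = count-< sub v (subset⁺ (U? O) (Sv , ¬d)) (λ t → proj₂ (subset⁻ (U? O′) t) d)
      where
      O′ = RingIn.verts R′
      U? : ∀ O z → Dec (S z ≡ true × ¬ Dom O z)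
      U? O z = (S z Bool.≟ true) ×-dec ¬? (dom? O z)
      sub : ∀ z → undominated O′ z ≡ true → undominated O z ≡ true
      sub z t = let (Sz , nd) = subset⁻ (U? O′) t in subset⁺ (U? O) (Sz , λ e → nd (dom Sz e))

    improve : ∀ k (R : RingIn S) → count (undominated (RingIn.verts R)) < k → Theta G G ⊎ HamOn S
    improve (suc k) R (s≤s le) = decide (any? (λ z → (S z Bool.≟ true) ×-dec ¬? (dom? (RingIn.verts R) z)))
      where
      continue : Theta G G ⊎ HamOn S ⊎ Gain (RingIn.verts R) → Theta G G ⊎ HamOn S
      continue (inj₁ θ) = inj₁ θ
      continue (inj₂ (inj₁ h)) = inj₂ h
      continue (inj₂ (inj₂ g@(R′ , _))) = improve k R′ (ℕ.<-≤-trans (gain-smaller g) le)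
      decide : Dec (∃ λ z → S z ≡ true × ¬ Dom (RingIn.verts R) z) → Theta G G ⊎ HamOn S
      decide (yes (w , Sw , ¬Dw)) = continue (advance R Sw ¬Dw)
      decide (no none) = inj₂ (ring-cycle S (RingIn.theRing R) (RingIn.inside R)
        (λ {z} Sz → decidable-stable (dom? (RingIn.verts R) z) (λ nd → none (z , Sz , nd))))

  -- The induction over subsets `S` serves the cuts, which fall back on two smaller parts. Improving
  -- the cycle is a separate descent, on the number of undominated vertices of a fixed `S`.
  theta-or-cycle : ∀ k S → count S < k → TwoConnectedOn S → TwoPoints S → Theta G G ⊎ HamOn S
  theta-or-cycle (suc k) S (s≤s le) tc (u , v , Su , Sv , u≢v)
    with any? (λ a → any? (λ b → (S a Bool.≟ true) ×-dec ((S b Bool.≟ true) ×-dec ¬? (a ≃? b))))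
  ... | yes (a , b , Sa , Sb , far) = Step.improve S tc (λ S′ lt → theta-or-cycle k S′ (ℕ.<-≤-trans lt le)) _ (initial-ring tc Sa Sb far) ℕ.≤-refl
  ... | no clique = inj₂ (spliced-cycle S one one uv uv ((u≢v ∷ []) ∷ [] ∷ []) ins (λ Sz → inj₂ (inj₂ (inj₁ (close Sz Su , close Sz Sv)))))
    where
    close : ∀ {a b} → S a ≡ true → S b ≡ true → a ≃ b
    close {a} {b} Sa Sb = decidable-stable (a ≃? b) (λ f → clique (a , b , Sa , Sb , f))
    uv : u ~ v
    uv = ≃⇒~ u≢v (close Su Sv)
    ins : ∀ {z} → z ∈ u ∷ v ∷ [] → S z ≡ true
    ins (here refl) = Su
    ins (there (here refl)) = Sv

-- Large vertices

module Large {n : ℕ} (G₀ G : Graph n) (cf : ClawFree G) (df : DiamondFree G) (sub : G₀ ⊑ G) where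
  private module Z = Adjacency G₀
  open Adjacency G
  open Claw cf
  open Cliques G df

  Big : V → Set
  Big v = n + 3 ≤ 3 * deg G₀ v

  shared : V → V → ℕ
  shared e f = count (λ v → adj G₀ e v ∧ adj G₀ f v)

  private
    table : ∀ a b c → (a ≡ true → b ≡ true → c ≡ true → ⊥) →
      bit a + (bit b + (bit c + 0)) ≤ 1 + (bit (a ∧ b) + (bit (a ∧ c) + bit (b ∧ c)))
    table true true true h = ⊥-elim (h refl refl refl)
    table true true false _ = ℕ.≤-refl
    table true false true _ = ℕ.≤-refl
    table true false false _ = ℕ.≤-refl
    table false true true _ = ℕ.≤-refl
    table false true false _ = ℕ.≤-refl
    table false false true _ = ℕ.≤-refl
    table false false false _ = z≤n

    is : V → V → ℕ
    is e v = bit ⌊ v ≟ e ⌋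

    is-self : ∀ e → is e e ≡ 1
    is-self e = cong bit (⌊⌋⁺ (e ≟ e) refl)

    is-other : ∀ {e v} → v ≢ e → is e v ≡ 0
    is-other {e} {v} ne with v ≟ e
    ... | yes eq = ⊥-elim (ne eq)
    ... | no _ = refl

    one-self : ∀ e → 1 ≤ total (is e) (allFin n)
    one-self e = ℕ.≤-<-trans z≤n (total-strict {f = λ _ → 0} (λ _ → z≤n) (∈-allFin e) (subst (0 <_) (sym (is-self e)) (s≤s z≤n)))

  module _ {e f g : V} (e≢f : e ≢ f) (e≢g : e ≢ g) (f≢g : f ≢ g)
    (¬ef : ¬ e Z.~ f) (¬eg : ¬ e Z.~ g) (¬fg : ¬ f Z.~ g)
    (none : ∀ {v} → e Z.~ v → f Z.~ v → g Z.~ v → ⊥) where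

    private
      E F H : V → ℕ
      E v = bit (adj G₀ e v)
      F v = bit (adj G₀ f v)
      H v = bit (adj G₀ g v)
      -- The indicators of `e`, `f`, `g` let these three vertices, which lie in none of the three
      -- neighbourhoods, contribute one each to the left side.
      lhs rhs : V → ℕ
      lhs v = E v + (F v + (H v + (is e v + (is f v + is g v))))
      rhs v = 1 + (bit (adj G₀ e v ∧ adj G₀ f v) + (bit (adj G₀ e v ∧ adj G₀ g v) + bit (adj G₀ f v ∧ adj G₀ g v)))

      zero-bit : ∀ {u v} → ¬ u Z.~ v → bit (adj G₀ u v) ≡ 0
      zero-bit ne = cong bit (Bool.¬-not ne)

      at : ∀ {v} → ¬ e Z.~ v → ¬ f Z.~ v → ¬ g Z.~ v → is e v + (is f v + is g v) ≤ 1 → lhs v ≤ 1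
      at a b c le rewrite zero-bit a | zero-bit b | zero-bit c = le

      point : ∀ v → lhs v ≤ rhs v
      point v = cases (v ≟ e) (v ≟ f) (v ≟ g)
        where
        cases : Dec (v ≡ e) → Dec (v ≡ f) → Dec (v ≡ g) → lhs v ≤ rhs v
        cases (yes refl) _ _ = ℕ.≤-trans (at Z.~-irrefl (¬ef ∘ Z.~-sym) (¬eg ∘ Z.~-sym) le) (s≤s z≤n)
          where
          le : is v v + (is f v + is g v) ≤ 1
          le rewrite is-self v | is-other e≢f | is-other e≢g = ℕ.≤-refl
        cases (no v≢e) (yes refl) _ = ℕ.≤-trans (at ¬ef Z.~-irrefl (¬fg ∘ Z.~-sym) le) (s≤s z≤n)
          where
          le : is e v + (is v v + is g v) ≤ 1
          le rewrite is-self v | is-other v≢e | is-other f≢g = ℕ.≤-refl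
        cases (no v≢e) (no v≢f) (yes refl) = ℕ.≤-trans (at ¬eg ¬fg Z.~-irrefl le) (s≤s z≤n)
          where
          le : is e v + (is f v + is v v) ≤ 1
          le rewrite is-self v | is-other v≢e | is-other v≢f = ℕ.≤-refl
        cases (no v≢e) (no v≢f) (no v≢g) = subst (_≤ rhs v) eq (table (adj G₀ e v) (adj G₀ f v) (adj G₀ g v) none)
          where
          eq : E v + (F v + (H v + 0)) ≡ lhs v
          eq = sym (cong (λ k → E v + (F v + (H v + k))) (cong₂ _+_ (is-other v≢e) (cong₂ _+_ (is-other v≢f) (is-other v≢g))))

      L = allFin n

      sum-lhs : total lhs L ≡ deg G₀ e + (deg G₀ f + (deg G₀ g + (total (is e) L + (total (is f) L + total (is g) L))))
      sum-lhs =
        trans (total-+ E _ L) (cong (deg G₀ e +_)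
        (trans (total-+ F _ L) (cong (deg G₀ f +_)
        (trans (total-+ H _ L) (cong (deg G₀ g +_)
        (trans (total-+ (is e) _ L) (cong (total (is e) L +_) (total-+ (is f) (is g) L))))))))

      ones : total (λ _ → 1) L ≡ n
      ones = trans (total-1 L) (List.length-tabulate {n = n} id)

      EF EG FG : V → ℕ
      EF v = bit (adj G₀ e v ∧ adj G₀ f v)
      EG v = bit (adj G₀ e v ∧ adj G₀ g v)
      FG v = bit (adj G₀ f v ∧ adj G₀ g v)

      sum-rhs : total rhs L ≡ n + (shared e f + (shared e g + shared f g))
      sum-rhs = trans (total-+ (λ _ → 1) _ L)
        (cong₂ _+_ ones
        (trans (total-+ EF _ L) (cong (shared e f +_) (total-+ EG FG L))))

      degrees : Big e → Big f → Big g → n + 3 ≤ deg G₀ e + (deg G₀ f + deg G₀ g)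
      degrees be bf bg = ℕ.*-cancelˡ-≤ 3 (subst₂ _≤_ (three (n + 3)) (spread (deg G₀ e) (deg G₀ f) (deg G₀ g))
          (ℕ.+-mono-≤ be (ℕ.+-mono-≤ bf bg)))
        where
        open import Data.Nat.Solver using (module +-*-Solver)
        open +-*-Solver
        three : ∀ m → m + (m + m) ≡ 3 * m
        three = solve 1 (λ m → m :+ (m :+ m) := con 3 :* m) refl
        spread : ∀ a b c → 3 * a + (3 * b + 3 * c) ≡ 3 * (a + (b + c))
        spread = solve 3 (λ a b c → con 3 :* a :+ (con 3 :* b :+ con 3 :* c) := con 3 :* (a :+ (b :+ c))) refl

      lower : Big e → Big f → Big g → n + 6 ≤ total lhs L
      lower be bf bg = subst (n + 6 ≤_) (sym sum-lhs)
        (subst₂ _≤_ (add n) (assoc (deg G₀ e) (deg G₀ f) (deg G₀ g) (total (is e) L + (total (is f) L + total (is g) L)))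
          (ℕ.+-mono-≤ (degrees be bf bg) (ℕ.+-mono-≤ (one-self e) (ℕ.+-mono-≤ (one-self f) (one-self g)))))
        where
        open import Data.Nat.Solver using (module +-*-Solver)
        open +-*-Solver
        add : ∀ m → (m + 3) + 3 ≡ m + 6
        add = solve 1 (λ m → (m :+ con 3) :+ con 3 := m :+ con 6) refl
        assoc : ∀ a b c d → (a + (b + c)) + d ≡ a + (b + (c + d))
        assoc = solve 4 (λ a b c d → (a :+ (b :+ c)) :+ d := a :+ (b :+ (c :+ d))) refl

    -- Summed over all vertices, the left side of `point` is at least (n + 3) + 3 and the right side
    -- is n plus the overlaps. Six is also the most that three pairs can reach when each shares at
    -- most two vertices.
    overlaps : Big e → Big f → Big g → 6 ≤ shared e f + (shared e g + shared f g)
    overlaps be bf bg = ℕ.+-cancelˡ-≤ n _ _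
      (ℕ.≤-trans (lower be bf bg) (ℕ.≤-trans (total-mono point L) (ℕ.≤-reflexive sum-rhs)))

    overlaps-strict : Big e → Big f → Big g → ∀ {v} → v ≢ e → v ≢ f → v ≢ g → ¬ e Z.~ v → ¬ f Z.~ v → ¬ g Z.~ v →
      6 < shared e f + (shared e g + shared f g)
    overlaps-strict be bf bg {v} v≢e v≢f v≢g ev fv gv = ℕ.+-cancelˡ-< n _ _
      (ℕ.≤-<-trans (lower be bf bg) (ℕ.<-≤-trans (total-strict point (∈-allFin v) lt) (ℕ.≤-reflexive sum-rhs)))
      where
      lt : lhs v < rhs v
      lt rewrite zero-bit ev | zero-bit fv | zero-bit gv | is-other v≢e | is-other v≢f | is-other v≢g = s≤s z≤n

  common-far : ∀ {e f} → Far e f → ∀ {p q} → p ≢ q → e ~ p → f ~ p → e ~ q → f ~ q → Far p q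
  common-far ef p≢q ep fp eq fq (inj₁ r) = p≢q r
  common-far ef p≢q ep fp eq fq (inj₂ pq) = ef (df pq (inj₂ ep) (inj₂ eq) (inj₂ fp) (inj₂ fq))

  -- Common neighbours of far vertices are pairwise far, or there would be a diamond. Three of them
  -- would be the leaves of a claw at `e`.
  shared-≤2 : ∀ {e f} → Far e f → shared e f ≤ 2
  shared-≤2 {e} {f} ef = tally-≤2 (λ v → adj G₀ e v ∧ adj G₀ f v) (Unique.allFin⁺ n) three
    where
    three : ∀ {x y z} → x ≢ y → x ≢ z → y ≢ z → adj G₀ e x ∧ adj G₀ f x ≡ true → adj G₀ e y ∧ adj G₀ f y ≡ true →
      adj G₀ e z ∧ adj G₀ f z ≡ true → ⊥
    three xy xz yz cx cy cz with ∧-true cx | ∧-true cy | ∧-true cz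
    ... | ex , fx | ey , fy | ez , fz with claw (inj₂ (sub ex)) (inj₂ (sub ey)) (inj₂ (sub ez))
    ...   | inj₁ r = common-far ef xy (sub ex) (sub fx) (sub ey) (sub fy) r
    ...   | inj₂ (inj₁ r) = common-far ef xz (sub ex) (sub fx) (sub ez) (sub fz) r
    ...   | inj₂ (inj₂ r) = common-far ef yz (sub ey) (sub fy) (sub ez) (sub fz) r

  no-triple : ∀ {e f g} → Far e f → Far e g → Far f g → ∀ {v} → e ~ v → f ~ v → g ~ v → ⊥
  no-triple ef eg fg ev fv gv with claw (inj₂ (~-sym ev)) (inj₂ (~-sym fv)) (inj₂ (~-sym gv))
  ... | inj₁ r = ef r
  ... | inj₂ (inj₁ r) = eg r
  ... | inj₂ (inj₂ r) = fg r

  -- Meant for `e` and `f` in the same clique of `G`, where being non-adjacent in `G₀` does not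
  -- bound the overlap. Sharing nothing, they leave a total overlap of at most four.
  clique-kill : ∀ {e f g} → Big e → Big f → Big g → e ≢ f → ¬ e Z.~ f → (∀ {v} → e Z.~ v → f Z.~ v → ⊥) →
    Far e g → Far f g → ⊥
  clique-kill {e} {f} {g} be bf bg e≢f ¬ef none eg fg = six≰four (ℕ.≤-trans
      (overlaps e≢f (far⇒≢ eg) (far⇒≢ fg) ¬ef (eg ∘ inj₂ ∘ sub) (fg ∘ inj₂ ∘ sub) (λ ev fv _ → none ev fv) be bf bg)
      (ℕ.+-mono-≤ (ℕ.≤-reflexive (tally-none (λ v → adj G₀ e v ∧ adj G₀ f v) (allFin n) (λ _ c → let (p , q) = ∧-true c in none p q)))
        (ℕ.+-mono-≤ (shared-≤2 eg) (shared-≤2 fg))))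
    where
    six≰four : ¬ (6 ≤ 4)
    six≰four (s≤s (s≤s (s≤s (s≤s ()))))

  Common : V → V → V → Set
  Common e f v = e Z.~ v × f Z.~ v

  two-common : ∀ {e f} → 2 ≤ shared e f → ∃ λ p → ∃ λ q → p ≢ q × Common e f p × Common e f q
  two-common {e} {f} le with any? (λ p → any? (λ q → ¬? (p ≟ q) ×-dec (((e Z.~? p) ×-dec (f Z.~? p)) ×-dec ((e Z.~? q) ×-dec (f Z.~? q)))))
  ... | yes r = r
  ... | no none with ℕ.≤-trans le (tally-≤1 (λ v → adj G₀ e v ∧ adj G₀ f v) (Unique.allFin⁺ n) (λ ne cx cy → none (_ , _ , ne , ∧-true cx , ∧-true cy)))
  ...   | s≤s ()

  -- at e, two pairs of far neighbours match up along the two cliques of e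
  align : ∀ {e v₁ v₂ w₁ w₂} → e ~ v₁ → e ~ v₂ → e ~ w₁ → e ~ w₂ → Far v₁ v₂ → Far w₁ w₂ →
    (v₁ ≃ w₁ × v₂ ≃ w₂) ⊎ (v₂ ≃ w₁ × v₁ ≃ w₂)
  align {e} {v₁} {v₂} {w₁} {w₂} ev₁ ev₂ ew₁ ew₂ fv fw
    with claw₂ (inj₂ ev₁) (inj₂ ev₂) (inj₂ ew₁) fv | claw₂ (inj₂ ev₁) (inj₂ ev₂) (inj₂ ew₂) fv
  ... | inj₁ r | inj₂ s = inj₁ (r , s)
  ... | inj₂ r | inj₁ s = inj₂ (r , s)
  ... | inj₁ r | inj₁ s = ⊥-elim (fw (df ev₁ (inj₂ (~-sym ew₁)) (≃-sym r) (inj₂ (~-sym ew₂)) (≃-sym s)))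
  ... | inj₂ r | inj₂ s = ⊥-elim (fw (df ev₂ (inj₂ (~-sym ew₁)) (≃-sym r) (inj₂ (~-sym ew₂)) (≃-sym s)))

  -- in the extremal case the six cliques of e, f, g form a dominating hexagon
  module Hexagon {e f g : V} (ef : Far e f) (eg : Far e g) (fg : Far f g)
    (dom : ∀ v → v ≃ e ⊎ v ≃ f ⊎ v ≃ g) where

    everywhere : HamiltonianCycleOn G (λ _ → true ≡ true) → HamiltonianCycle G
    everywhere (u , v , l , p , c , un , _ , all) = u , v , l , p , c , un , (λ _ → tt) , (λ _ → all refl)

    hexagon : ∀ {v₁ v₂ w₁ w₂ z₁ z₂} → e ~ v₁ × g ~ v₁ → e ~ v₂ × g ~ v₂ → e ~ w₁ × f ~ w₁ → e ~ w₂ × f ~ w₂ →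
      f ~ z₁ × g ~ z₁ → f ~ z₂ × g ~ z₂ → Far v₁ v₂ → Far w₁ w₂ → Far z₁ z₂ →
      v₁ ≃ w₁ → v₂ ≃ w₂ → w₁ ≃ z₁ → w₂ ≃ z₂ → z₁ ≃ v₂ → z₂ ≃ v₁ → HamiltonianCycle G
    hexagon {v₁} {v₂} {w₁} {w₂} {z₁} {z₂} (ev₁ , gv₁) (ev₂ , gv₂) (ew₁ , fw₁) (ew₂ , fw₂) (fz₁ , gz₁) (fz₂ , gz₂)
      fv fw fz v₁w₁ v₂w₂ w₁z₁ w₂z₂ z₁v₂ z₂v₁ = everywhere
      (spliced-cycle (λ _ → true) {a = v₁} {z₁} {z₂} {v₂} {v₁ ∷ w₁ ∷ z₁ ∷ []} {z₂ ∷ w₂ ∷ v₂ ∷ []}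
        (cons (≃⇒~ (vw ev₁ gv₁ fw₁) v₁w₁) (cons (≃⇒~ (wz ew₁ fz₁ gz₁) w₁z₁) one))
        (cons (~-sym (≃⇒~ (wz ew₂ fz₂ gz₂) w₂z₂)) (cons (~-sym (≃⇒~ (vw ev₂ gv₂ fw₂) v₂w₂)) one))
        (~-sym (≃⇒~ (vz ev₁ fz₂ gz₂ ∘ sym) z₂v₁)) (≃⇒~ (vz ev₂ fz₁ gz₁ ∘ sym) z₁v₂)
        ((vw ev₁ gv₁ fw₁ ∷ vz ev₁ fz₁ gz₁ ∷ vz ev₁ fz₂ gz₂ ∷ vw ev₁ gv₁ fw₂ ∷ far⇒≢ fv ∷ []) ∷
         (wz ew₁ fz₁ gz₁ ∷ wz ew₁ fz₂ gz₂ ∷ far⇒≢ fw ∷ (vw ev₂ gv₂ fw₁ ∘ sym) ∷ []) ∷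
         (far⇒≢ fz ∷ (wz ew₂ fz₁ gz₁ ∘ sym) ∷ (vz ev₂ fz₁ gz₁ ∘ sym) ∷ []) ∷
         ((wz ew₂ fz₂ gz₂ ∘ sym) ∷ (vz ev₂ fz₂ gz₂ ∘ sym) ∷ []) ∷ ((vw ev₂ gv₂ fw₂ ∘ sym) ∷ []) ∷ [] ∷ [])
        (λ _ → refl) (λ {z} _ → cover z))
      where
      triple : ∀ {v} → e ~ v → f ~ v → g ~ v → ⊥
      triple = no-triple ef eg fg
      vw : ∀ {v w} → e ~ v → g ~ v → f ~ w → v ≢ w
      vw ev gv fw refl = triple ev fw gv
      wz : ∀ {w z} → e ~ w → f ~ z → g ~ z → w ≢ z
      wz ew fz gz refl = triple ew fz gz
      vz : ∀ {v z} → e ~ v → f ~ z → g ~ z → v ≢ z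
      vz ev fz gz refl = triple ev fz gz
      carry : ∀ {c p q z} → c ~ p → c ~ q → p ≃ q → z ≃ c → p ≃ z → z ≃ p × z ≃ q
      carry cp cq pq zc pz = ≃-sym pz , df cp zc (≃-sym pz) (inj₂ (~-sym cq)) (≃-sym pq)
      cover : ∀ z → Covered v₁ z₁ z₂ v₂ (v₁ ∷ w₁ ∷ z₁ ∷ []) (z₂ ∷ w₂ ∷ v₂ ∷ []) z
      cover z with dom z
      cover z | inj₁ ze with claw₂ (inj₂ ev₁) (inj₂ ev₂) (≃-sym ze) fv
      ... | inj₁ r = inj₁ (_ , _ , here , carry ev₁ ew₁ v₁w₁ ze r)
      ... | inj₂ r = inj₂ (inj₁ (_ , _ , there here , let (p , q) = carry ev₂ ew₂ v₂w₂ ze r in q , p))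
      cover z | inj₂ (inj₁ zf) with claw₂ (inj₂ fw₁) (inj₂ fw₂) (≃-sym zf) fw
      ... | inj₁ r = inj₁ (_ , _ , there here , carry fw₁ fz₁ w₁z₁ zf r)
      ... | inj₂ r = inj₂ (inj₁ (_ , _ , here , let (p , q) = carry fw₂ fz₂ w₂z₂ zf r in q , p))
      cover z | inj₂ (inj₂ zg) with claw₂ (inj₂ gz₁) (inj₂ gz₂) (≃-sym zg) fz
      ... | inj₁ r = inj₂ (inj₂ (inj₂ (carry gz₁ gv₂ z₁v₂ zg r)))
      ... | inj₂ r = inj₂ (inj₂ (inj₁ (let (p , q) = carry gz₂ gv₁ z₂v₁ zg r in q , p)))

    -- Only the crossed matching at `g` occurs. The straight one makes `z₁` close to both `v₁` and
    -- `w₁`, hence to `e` by diamond-freeness, and `z₁` would then be a common neighbour of `e`, `f`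
    -- and `g`.
    from-common : ∀ {v₁ v₂ w₁ w₂ z₁ z₂} → e ~ v₁ × g ~ v₁ → e ~ v₂ × g ~ v₂ → e ~ w₁ × f ~ w₁ → e ~ w₂ × f ~ w₂ →
      f ~ z₁ × g ~ z₁ → f ~ z₂ × g ~ z₂ → Far v₁ v₂ → Far w₁ w₂ → Far z₁ z₂ →
      v₁ ≃ w₁ → v₂ ≃ w₂ → w₁ ≃ z₁ → w₂ ≃ z₂ → HamiltonianCycle G
    from-common {v₁} {v₂} {w₁} {w₂} {z₁} {z₂} v₁′@(ev₁ , gv₁) v₂′@(ev₂ , gv₂) w₁′@(ew₁ , fw₁) w₂′ z₁′@(fz₁ , gz₁) z₂′@(_ , gz₂) fv fw fz a b c d
      with align gz₁ gz₂ gv₁ gv₂ fz fv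
    ... | inj₂ (r , s) = hexagon v₁′ v₂′ w₁′ w₂′ z₁′ z₂′ fv fw fz a b c d s r
    ... | inj₁ (r , _) = ⊥-elim (bad (df (≃⇒~ v₁≢w₁ a) (inj₂ ev₁) (inj₂ ew₁) r (≃-sym c)))
      where
      v₁≢w₁ : v₁ ≢ w₁
      v₁≢w₁ refl = no-triple ef eg fg ev₁ fw₁ gv₁
      bad : e ≃ z₁ → ⊥
      bad (inj₁ refl) = ef (inj₂ (~-sym fz₁))
      bad (inj₂ ez) = no-triple ef eg fg ez fz₁ gz₁

  -- Equality in the count forces two common neighbours for every pair. It also forces domination,
  -- since a vertex close to none of the three would raise the required overlap to seven.
  far-kill : ∀ {e f g} → Big e → Big f → Big g → Far e f → Far e g → Far f g → HamiltonianCycle G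
  far-kill {e} {f} {g} be bf bg ef eg fg = found (two-common {e} {f} (tight (shared-≤2 eg) (shared-≤2 fg) need))
          (two-common {e} {g} (tight (shared-≤2 ef) (shared-≤2 fg) (subst (6 ≤_) (swap₁ (shared e f) (shared e g) (shared f g)) need)))
          (two-common {f} {g} (tight (shared-≤2 ef) (shared-≤2 eg) (subst (6 ≤_) (swap₂ (shared e f) (shared e g) (shared f g)) need)))
    where
    open import Data.Nat.Solver using (module +-*-Solver)
    open +-*-Solver
    triple : ∀ {v} → e Z.~ v → f Z.~ v → g Z.~ v → ⊥
    triple a b c = no-triple ef eg fg (sub a) (sub b) (sub c)
    need : 6 ≤ shared e f + (shared e g + shared f g)
    need = overlaps (far⇒≢ ef) (far⇒≢ eg) (far⇒≢ fg) (ef ∘ inj₂ ∘ sub) (eg ∘ inj₂ ∘ sub) (fg ∘ inj₂ ∘ sub) triple be bf bg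
    swap₁ : ∀ a b c → a + (b + c) ≡ b + (a + c)
    swap₁ = solve 3 (λ a b c → a :+ (b :+ c) := b :+ (a :+ c)) refl
    swap₂ : ∀ a b c → a + (b + c) ≡ c + (a + b)
    swap₂ = solve 3 (λ a b c → a :+ (b :+ c) := c :+ (a :+ b)) refl
    tight : ∀ {a b c} → b ≤ 2 → c ≤ 2 → 6 ≤ a + (b + c) → 2 ≤ a
    tight {a} b≤ c≤ le = ℕ.+-cancelʳ-≤ 4 2 a (ℕ.≤-trans le (ℕ.+-monoʳ-≤ a (ℕ.+-mono-≤ b≤ c≤)))
    dom : ∀ v → v ≃ e ⊎ v ≃ f ⊎ v ≃ g
    dom v with v ≃? e | v ≃? f | v ≃? g
    ... | yes r | _ | _ = inj₁ r
    ... | no _ | yes r | _ = inj₂ (inj₁ r)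
    ... | no _ | no _ | yes r = inj₂ (inj₂ r)
    ... | no a | no b | no c = ⊥-elim (ℕ.<-irrefl refl (ℕ.<-≤-trans
      (overlaps-strict (far⇒≢ ef) (far⇒≢ eg) (far⇒≢ fg) (ef ∘ inj₂ ∘ sub) (eg ∘ inj₂ ∘ sub) (fg ∘ inj₂ ∘ sub) triple be bf bg
        (far⇒≢ a) (far⇒≢ b) (far⇒≢ c) (λ t → a (inj₂ (~-sym (sub t)))) (λ t → b (inj₂ (~-sym (sub t)))) (λ t → c (inj₂ (~-sym (sub t)))))
      (ℕ.+-mono-≤ (shared-≤2 ef) (ℕ.+-mono-≤ (shared-≤2 eg) (shared-≤2 fg)))))
    Two : V → V → Set
    Two e f = ∃ λ p → ∃ λ q → p ≢ q × Common e f p × Common e f q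
    found : Two e f → Two e g → Two f g → HamiltonianCycle G
    found (w₁ , w₂ , w≢ , (ew₁ , fw₁) , (ew₂ , fw₂)) (v₁ , v₂ , v≢ , (ev₁ , gv₁) , (ev₂ , gv₂)) (z₁ , z₂ , z≢ , (fz₁ , gz₁) , (fz₂ , gz₂)) =
      orient (align (sub ev₁) (sub ev₂) (sub ew₁) (sub ew₂) fv fw) (align (sub fw₁) (sub fw₂) (sub fz₁) (sub fz₂) fw fz)
      where
      fw : Far w₁ w₂
      fw = common-far ef w≢ (sub ew₁) (sub fw₁) (sub ew₂) (sub fw₂)
      fv : Far v₁ v₂
      fv = common-far eg v≢ (sub ev₁) (sub gv₁) (sub ev₂) (sub gv₂)
      fz : Far z₁ z₂
      fz = common-far fg z≢ (sub fz₁) (sub gz₁) (sub fz₂) (sub gz₂)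
      open Hexagon ef eg fg dom
      V₁ = sub ev₁ , sub gv₁
      V₂ = sub ev₂ , sub gv₂
      W₁ = sub ew₁ , sub fw₁
      W₂ = sub ew₂ , sub fw₂
      Z₁ = sub fz₁ , sub gz₁
      Z₂ = sub fz₂ , sub gz₂
      orient : (v₁ ≃ w₁ × v₂ ≃ w₂) ⊎ (v₂ ≃ w₁ × v₁ ≃ w₂) → (w₁ ≃ z₁ × w₂ ≃ z₂) ⊎ (w₂ ≃ z₁ × w₁ ≃ z₂) → HamiltonianCycle G
      orient (inj₁ (a , b)) (inj₁ (c , d)) = from-common V₁ V₂ W₁ W₂ Z₁ Z₂ fv fw fz a b c d
      orient (inj₁ (a , b)) (inj₂ (c , d)) = from-common V₁ V₂ W₁ W₂ Z₂ Z₁ fv fw (far-sym fz) a b d c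
      orient (inj₂ (a , b)) (inj₁ (c , d)) = from-common V₂ V₁ W₁ W₂ Z₁ Z₂ (far-sym fv) fw fz a b c d
      orient (inj₂ (a , b)) (inj₂ (c , d)) = from-common V₂ V₁ W₁ W₂ Z₂ Z₁ (far-sym fv) fw (far-sym fz) a b d c

-- Cliques of the closure seen from the original graph

module Regions {n : ℕ} (G₀ G : Graph n) (cf₀ : ClawFree G₀) (df : DiamondFree G)
  (sub : G₀ ⊑ G) (sp : Spanned G₀ G) where
  private module Z = Adjacency G₀
  open Adjacency G
  open Z using () renaming (_~_ to _~₀_; _≃_ to _≃₀_; Far to Far₀; Walk to Walk₀; IPath to IPath₀; stop to stop₀; go to go₀; one to one₀; cons to cons₀)
  open Z.Claw cf₀ renaming (claw₂ to claw₀₂; claw₃ to claw₀₃)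
  open Cliques G df

  ≃₀⇒≃ : ∀ {u v} → u ≃₀ v → u ≃ v
  ≃₀⇒≃ (inj₁ eq) = inj₁ eq
  ≃₀⇒≃ (inj₂ e) = inj₂ (sub e)

  far⇒far₀ : ∀ {u v} → Far u v → Far₀ u v
  far⇒far₀ f = f ∘ ≃₀⇒≃

  -- Such a vertex has no neighbour outside the clique, so it can be added to a leg without coming
  -- close to anything that avoids the clique.
  Interior : V → V → V → Set
  Interior x x′ z = ∀ {t} → t ≃ z → Clique x x′ t

  module _ {x x′ : V} (xx′ : x ~ x′) where

    absorb₀ : ∀ {s t y} → Clique x x′ s → Clique x x′ t → s ≢ t → y ≃₀ s → y ≃₀ t → Clique x x′ y
    absorb₀ cs ct ne ys yt = clique-absorb xx′ cs ct ne (≃₀⇒≃ ys) (≃₀⇒≃ yt)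

    -- The walk of `G₀` that spans `zt` already leaves the clique at its first step: its vertices
    -- are close to `t`, and a second clique vertex close to `t` would draw `t` into the clique.
    leaving : ∀ {z t} → Clique x x′ z → z ~ t → ¬ Clique x x′ t → ∃ λ s → z ~₀ s × ¬ Clique x x′ s
    leaving {z} {t} cz zt ¬ct with sp zt
    ... | stop₀ _ = ⊥-elim (~-irrefl zt)
    ... | go₀ {v = s} _ zs w = s , zs , λ cs → ¬ct (clique-absorb xx′ cs cz (Z.~⇒≢ zs ∘ sym) (≃-sym (proj₂ (Z.walk-start w))) (inj₂ (~-sym zt)))

    -- a vertex with a neighbour outside the clique has only adjacent original neighbours inside
    inner : ∀ {u z v} → Clique x x′ u → Clique x x′ z → Clique x x′ v → u ~₀ z → z ~₀ v → Far₀ u v → Interior x x′ z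
    inner cu cz cv uz zv far (inj₁ refl) = cz
    inner {u} {z} {v} cu cz cv uz zv far {t} (inj₂ tz) with clique? x x′ t
    ... | yes c = c
    ... | no ¬ct with leaving cz (~-sym tz) ¬ct
    ...   | s , zs , ¬cs with claw₀₂ (inj₂ (Z.~-sym uz)) (inj₂ zv) (inj₂ zs) far
    ...     | inj₁ r = ⊥-elim (¬cs (absorb₀ cu cz (Z.~⇒≢ uz) (Z.≃-sym r) (inj₂ (Z.~-sym zs))))
    ...     | inj₂ r = ⊥-elim (¬cs (absorb₀ cv cz (Z.~⇒≢ zv ∘ sym) (Z.≃-sym r) (inj₂ (Z.~-sym zs))))

    region-walk : ∀ {y y′} → Clique x x′ y → Clique x x′ y′ → Walk₀ (Clique x x′) y y′
    region-walk {y} {y′} cy cy′ with y ≟ y′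
    ... | yes refl = stop₀ cy
    ... | no ne = Z.walk-map (λ (r , s) → clique-absorb xx′ cy cy′ ne r s) (sp (≃⇒~ ne (clique-≃ xx′ cy cy′)))

    region-path : ∀ {y y′} → Clique x x′ y → Clique x x′ y′ →
      ∃ λ l → IPath₀ y y′ l × (∀ {z} → z ∈ l → z ≡ y ⊎ z ≡ y′ ⊎ Interior x x′ z)
    region-path cy cy′ with Z.walk⇒ipath (region-walk cy cy′)
    ... | l , p , inl , _ = l , p , place
      where
      place : ∀ {z} → z ∈ l → z ≡ _ ⊎ z ≡ _ ⊎ Interior x x′ z
      place i with Z.ipath-position p i
      ... | inj₁ eq = inj₁ eq
      ... | inj₂ (inj₁ eq) = inj₂ (inj₁ eq)
      ... | inj₂ (inj₂ (s , t , s∈ , t∈ , _ , _ , sz , zt , far)) = inj₂ (inj₂ (inner (inl s∈) (inl i) (inl t∈) sz zt far))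

  OnLeg : List V → V → Set
  OnLeg vs z = z ∈ vs ⊎ ∃ λ x → ∃ λ x′ → x ∈ vs × x′ ∈ vs × x ~ x′ × Interior x x′ z

  edge-walk : ∀ {vs x x′} → x ∈ vs → x′ ∈ vs → x ~ x′ → Walk₀ (OnLeg vs) x x′
  edge-walk {vs} {x} {x′} i i′ e with region-path e (inj₁ refl , inj₂ e) (inj₂ (~-sym e) , inj₁ refl)
  ... | l , p , place = proj₁ (Z.ipath⇒walk p onLeg)
    where
    onLeg : ∀ {z} → z ∈ l → OnLeg vs z
    onLeg j with place j
    ... | inj₁ refl = inj₁ i
    ... | inj₂ (inj₁ refl) = inj₁ i′
    ... | inj₂ (inj₂ int) = inj₂ (_ , _ , i , i′ , e , int)

  leg-walk : ∀ {vs a b l} → IPath a b l → (∀ {z} → z ∈ l → z ∈ vs) → Walk₀ (OnLeg vs) a b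
  leg-walk one inl = stop₀ (inj₁ (inl (here refl)))
  leg-walk (cons e f p) inl = Z.walk-trans (edge-walk (inl (here refl)) (inl (there (here refl))) e) (leg-walk p (inl ∘ there))

  module _ {vs : List V} {a b : V} where

    -- An edge of `G` may be missing in `G₀`. If `ab` is, the triangle becomes a long leg through
    -- its clique. Otherwise the second vertex `d` of a path of `G₀` from `a` to `c` inside the
    -- clique becomes the tip; it is `c` or interior, so it stays away from the other legs.
    realise-shape : Shape G a b vs → (∃ λ s → a ~ s × ¬ Clique a b s) → (∃ λ s → b ~ s × ¬ Clique a b s) →
      ∃ λ vs′ → Shape G₀ a b vs′ × (∀ {z} → z ∈ vs′ → OnLeg vs z)
    realise-shape (long p far inl) _ _ with Z.walk⇒ipath (leg-walk p inl)
    ... | l , q , onl , _ = l , long q (far⇒far₀ far) id , onl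
    realise-shape (tee {c} ab ca cb a∈ b∈ c∈) (s , as , ¬cs) (s′ , bs′ , ¬cs′) with a Z.~? b
    ... | no ¬ab with region-path ab (inj₁ refl , inj₂ ab) (inj₂ (~-sym ab) , inj₁ refl)
    ...   | l , q , place = l , long q far id , onl
      where
      far : Far₀ a b
      far (inj₁ eq) = ~⇒≢ ab eq
      far (inj₂ e) = ¬ab e
      onl : ∀ {z} → z ∈ l → OnLeg vs z
      onl j with place j
      ... | inj₁ refl = inj₁ a∈
      ... | inj₂ (inj₁ refl) = inj₁ b∈
      ... | inj₂ (inj₂ int) = inj₂ (a , b , a∈ , b∈ , ab , int)
    realise-shape (tee {c} ab ca cb a∈ b∈ c∈) (s , as , ¬cs) (s′ , bs′ , ¬cs′) | yes ab₀
      with region-path ab (inj₁ refl , inj₂ ab) (inj₂ ca , inj₂ cb)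
    ...   | _ , one₀ , _ = ⊥-elim (~-irrefl ca)
    ...   | _ , cons₀ {c = d} {l = l} ad _ q , place =
      a ∷ b ∷ d ∷ [] , tee ab₀ (Z.~-sym ad) db (here refl) (there (here refl)) (there (there (here refl))) , onl
      where
      ca′ : Clique a b a
      ca′ = inj₁ refl , inj₂ ab
      cb′ : Clique a b b
      cb′ = inj₂ (~-sym ab) , inj₁ refl
      d-place : d ≡ a ⊎ d ≡ c ⊎ Interior a b d
      d-place = place (there (here refl))
      cd : Clique a b d
      cd with d-place
      ... | inj₁ refl = ca′
      ... | inj₂ (inj₁ refl) = inj₂ ca , inj₂ cb
      ... | inj₂ (inj₂ int) = int ≃-refl
      d≢b : d ≢ b
      d≢b refl with d-place
      ... | inj₁ refl = ~-irrefl ab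
      ... | inj₂ (inj₁ refl) = ~-irrefl cb
      ... | inj₂ (inj₂ int) = ¬cs′ (int (inj₂ (~-sym bs′)))
      -- In the claw at `a` the third leaf is an original neighbour outside the clique, which is far
      -- from `d` and from `b`.
      db : d ~₀ b
      db with leaving ab ca′ as ¬cs
      ... | t , at , ¬ct = Z.≃⇒~ d≢b (claw₀₃ (inj₂ at) (inj₂ ad) (inj₂ ab₀)
          (λ r → ¬ct (absorb₀ ab cd ca′ (Z.~⇒≢ ad ∘ sym) r (inj₂ (Z.~-sym at))))
          (λ r → ¬ct (absorb₀ ab cb′ ca′ (Z.~⇒≢ ab₀ ∘ sym) r (inj₂ (Z.~-sym at)))))
      onl : ∀ {z} → z ∈ a ∷ b ∷ d ∷ [] → OnLeg vs z
      onl (here refl) = inj₁ a∈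
      onl (there (here refl)) = inj₁ b∈
      onl (there (there (here refl))) with d-place
      ... | inj₁ refl = inj₁ a∈
      ... | inj₂ (inj₁ refl) = inj₁ c∈
      ... | inj₂ (inj₂ int) = inj₂ (a , b , a∈ , b∈ , ab , int)

  module ThetaFacts {G₁ : Graph n} (T : Theta G₁ G) (lift : ∀ {u v} → Adj G₁ u v → u ~ v) where
    open Theta T

    shape-ends : ∀ {a b vs} → Shape G₁ a b vs → a ∈ vs × b ∈ vs × a ≢ b
    shape-ends (long p far inl) = inl (Adjacency.ipath-first G₁ p) , inl (Adjacency.ipath-last G₁ p) , Adjacency.far⇒≢ G₁ far
    shape-ends (tee ab _ _ a∈ b∈ _) = a∈ , b∈ , ~⇒≢ (lift ab)

    a∈ : ∀ i → a i ∈ vs i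
    a∈ i = proj₁ (shape-ends (shape i))

    b∈ : ∀ i → b i ∈ vs i
    b∈ i = proj₁ (proj₂ (shape-ends (shape i)))

    a≢b : ∀ i → a i ≢ b i
    a≢b i = proj₂ (proj₂ (shape-ends (shape i)))

    off-a : ∀ {i j} → i ≢ j → ∀ {y} → y ∈ vs i → y ≢ a i → Far y (a j)
    off-a {i} {j} ne y∈ y≢a c with cross ne y∈ (a∈ j) c
    ... | inj₁ (eq , _) = y≢a eq
    ... | inj₂ (_ , eq) = a≢b j eq

    off-b : ∀ {i j} → i ≢ j → ∀ {y} → y ∈ vs i → y ≢ b i → Far y (b j)
    off-b {i} {j} ne y∈ y≢b c with cross ne y∈ (b∈ j) c
    ... | inj₁ (_ , eq) = a≢b j (sym eq)
    ... | inj₂ (eq , _) = y≢b eq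

    not-both : ∀ {i j} → i ≢ j → ∀ {x x′ y} → x ∈ vs i → x′ ∈ vs i → x ~ x′ → y ∈ vs j → y ≃ x → y ≃ x′ → ⊥
    not-both {i} {j} ne x∈ x′∈ e y∈ yx yx′ with cross ne x∈ y∈ (≃-sym yx) | cross ne x′∈ y∈ (≃-sym yx′)
    ... | inj₁ (refl , _) | inj₁ (refl , _) = ~-irrefl e
    ... | inj₂ (refl , _) | inj₂ (refl , _) = ~-irrefl e
    ... | inj₁ (_ , e₁) | inj₂ (_ , e₂) = a≢b j (trans (sym e₁) e₂)
    ... | inj₂ (_ , e₁) | inj₁ (_ , e₂) = a≢b j (trans (sym e₂) e₁)

  other : (i : Fin 3) → ∃ λ j → i ≢ j
  other zero = suc zero , λ ()
  other (suc zero) = zero , λ ()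
  other (suc (suc zero)) = zero , λ ()

  -- The vertices new on the legs are interior to a clique spanned by two vertices of the same leg.
  -- If one of them were close to another leg, a vertex of one leg would lie in a clique spanned by
  -- an edge of another, which `not-both` excludes.
  realise : Theta G G → Theta G₀ G
  realise T = record
    { a = a ; b = b ; vs = λ i → proj₁ (real i) ; shape = λ i → proj₁ (proj₂ (real i)) ; aa = aa ; bb = bb
    ; cross = λ {i} {j} ne x∈ y∈ → cross′ ne (proj₂ (proj₂ (real i)) x∈) (proj₂ (proj₂ (real j)) y∈) }
    where
    open Theta T
    open ThetaFacts T id
    real : ∀ i → ∃ λ vs′ → Shape G₀ (a i) (b i) vs′ × (∀ {z} → z ∈ vs′ → OnLeg (vs i) z)
    real i = let (j , ne) = other i in realise-shape (shape i)
      (a j , aa ne , λ (_ , c) → off-a ne (b∈ i) (a≢b i ∘ sym) (≃-sym c))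
      (b j , bb ne , λ (c , _) → off-b ne (a∈ i) (a≢b i) (≃-sym c))
    cross′ : ∀ {i j} → i ≢ j → ∀ {x y} → OnLeg (vs i) x → OnLeg (vs j) y → x ≃ y → (x ≡ a i × y ≡ a j) ⊎ (x ≡ b i × y ≡ b j)
    cross′ ne (inj₁ x∈) (inj₁ y∈) c = cross ne x∈ y∈ c
    cross′ ne (inj₂ (s , s′ , s∈ , s′∈ , e , int)) (inj₁ y∈) c =
      let (ys , ys′) = int (≃-sym c) in ⊥-elim (not-both ne s∈ s′∈ e y∈ ys ys′)
    cross′ ne (inj₁ x∈) (inj₂ (s , s′ , s∈ , s′∈ , e , int)) c =
      let (xs , xs′) = int c in ⊥-elim (not-both (ne ∘ sym) s∈ s′∈ e x∈ xs xs′)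
    cross′ ne (inj₂ (s , s′ , s∈ , s′∈ , e , int)) (inj₂ (r , r′ , r∈ , r′∈ , e′ , int′)) c =
      let (ys , _) = int (≃-sym c)
          (sr , sr′) = int′ (≃-sym ys)
      in ⊥-elim (not-both (ne ∘ sym) r∈ r′∈ e′ s∈ sr sr′)

  theta-flip : Theta G₀ G → Theta G₀ G
  theta-flip T = record { a = b ; b = a ; vs = vs ; shape = λ i → flip (shape i) ; aa = bb ; bb = aa ; cross = λ ne x∈ y∈ c → turn (cross ne x∈ y∈ c) }
    where
    open Theta T
    turn : ∀ {A B : Set} → A ⊎ B → B ⊎ A
    turn (inj₁ x) = inj₂ x
    turn (inj₂ x) = inj₁ x
    flip : ∀ {a b vs} → Shape G₀ a b vs → Shape G₀ b a vs
    flip (long p far inl) with Z.ipath-reverse p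
    ... | m , q , s , _ = long q (Z.far-sym far) (inl ∘ s)
    flip (tee ab ca cb a∈ b∈ c∈) = tee (Z.~-sym ab) cb ca b∈ a∈ c∈

  -- An induced path `l` seen from a vertex `t` whose only neighbours on it are the consecutive `x`
  -- and `x′`, from which the arms run to the ends. `spell` recovers the path, so that facts about
  -- its consecutive vertices can be read off the arms.
  record Touch (t u v : V) (l : List V) : Set where
    field
      {x x′}   : V
      {D₁ D₂}  : List V
      arm₁     : IPath₀ x u D₁
      arm₂     : IPath₀ x′ v D₂
      tx       : t ~₀ x
      tx′      : t ~₀ x′
      xx′      : x ~₀ x′
      apart    : ∀ {z z′} → z ∈ D₁ → z′ ∈ D₂ → z ≃₀ z′ → z ≡ x × z′ ≡ x′
      only₁    : ∀ {z} → z ∈ D₁ → z ≃₀ t → z ≡ x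
      only₂    : ∀ {z} → z ∈ D₂ → z ≃₀ t → z ≡ x′
      sub₁     : ∀ {z} → z ∈ D₁ → z ∈ l
      sub₂     : ∀ {z} → z ∈ D₂ → z ∈ l
      spell    : l ≡ D₁ ʳ++ D₂

  touch-cons : ∀ {t u c v l} → u ~₀ c → (∀ {x} → x ∈ l → Far₀ u x) → Far₀ u t → Touch t c v (c ∷ l) → Touch t u v (u ∷ c ∷ l)
  touch-cons {t} {u} {c} {v} {l} e f fu τ = record
      { arm₁ = Z.ipath-snoc arm₁ (Z.~-sym e) last ; arm₂ = arm₂ ; tx = tx ; tx′ = tx′ ; xx′ = xx′
      ; apart = apart′ ; only₁ = only₁′ ; only₂ = only₂ ; sub₁ = sub₁′ ; sub₂ = there ∘ sub₂
      ; spell = trans (cong (u ∷_) spell) (sym (List.++-ʳ++ D₁)) }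
    where
    open Touch τ
    last : ∀ {z} → z ∈ D₁ → z ≃₀ u → z ≡ c
    last j r with sub₁ j
    ... | here eq = eq
    ... | there k = ⊥-elim (f k (Z.≃-sym r))
    apart′ : ∀ {z z′} → z ∈ D₁ ++ [ u ] → z′ ∈ D₂ → z ≃₀ z′ → z ≡ x × z′ ≡ x′
    apart′ j k r with ∈-++⁻ D₁ j
    ... | inj₁ j′ = apart j′ k r
    ... | inj₂ (here refl) with sub₂ k
    ...   | there k′ = ⊥-elim (f k′ r)
    ...   | here refl with apart (Z.ipath-last arm₁) k (inj₁ refl)
    ...     | e₁ , e₂ = ⊥-elim (Z.~-irrefl (subst₂ _~₀_ (sym e₁) (sym e₂) xx′))
    only₁′ : ∀ {z} → z ∈ D₁ ++ [ u ] → z ≃₀ t → z ≡ x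
    only₁′ j r with ∈-++⁻ D₁ j
    ... | inj₁ j′ = only₁ j′ r
    ... | inj₂ (here refl) = ⊥-elim (fu r)
    sub₁′ : ∀ {z} → z ∈ D₁ ++ [ u ] → z ∈ u ∷ c ∷ l
    sub₁′ j with ∈-++⁻ D₁ j
    ... | inj₁ j′ = there (sub₁ j′)
    ... | inj₂ (here eq) = here eq

  -- At the first vertex close to `t`, the claw makes its successor close to `t` too, because its
  -- predecessor is not. A further neighbour of `t` beyond these two would form a claw at `t` with
  -- the first one and `s`.
  touch : ∀ {t s u v l} → IPath₀ u v l → t ~₀ s → (∀ {p} → p ∈ l → Far₀ p s) → Far₀ u t → Far₀ v t →
    (∃ λ p → p ∈ l × p ≃₀ t) → Touch t u v l
  touch one₀ ts fs fu fv (p , here refl , c) = ⊥-elim (fu c)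
  touch {t} {s} {u} {v} (cons₀ {c = c} {l = l} e f p) ts fs fu fv ex with c Z.≃? t
  touch {t} {s} {u} {v} (cons₀ {c = c} {l = l} e f p) ts fs fu fv (q , here refl , cl) | no _ = ⊥-elim (fu cl)
  touch {t} {s} {u} {v} (cons₀ {c = c} {l = l} e f p) ts fs fu fv (q , there i , cl) | no fc =
    touch-cons e f fu (touch p ts (fs ∘ there) fc fv (q , i , cl))
  touch {t} {s} {u} {v} (cons₀ e f one₀) ts fs fu fv ex | yes cl = ⊥-elim (fv cl)
  touch {t} {s} {u} {v} (cons₀ {c = c} e f (cons₀ {c = d} {l = l} e′ f′ p)) ts fs fu fv ex | yes cl =
    record
      { arm₁ = cons₀ (Z.~-sym e) (λ ()) one₀ ; arm₂ = p ; tx = Z.~-sym ct ; tx′ = Z.~-sym dt ; xx′ = e′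
      ; apart = apart′ ; only₁ = only₁′ ; only₂ = only₂′
      ; sub₁ = λ { (here eq) → there (here eq) ; (there (here eq)) → here eq } ; sub₂ = (λ i → there (there i)) ; spell = refl }
    where
    strict : ∀ {z} → z ∈ u ∷ c ∷ d ∷ l → z ≃₀ t → z ~₀ t
    strict i (inj₁ refl) = ⊥-elim (fs i (inj₂ ts))
    strict i (inj₂ e) = e
    ct : c ~₀ t
    ct = strict (there (here refl)) cl
    dt : d ~₀ t
    dt = strict (there (there (here refl))) (claw₀₃ (inj₂ (Z.~-sym e)) (inj₂ e′) (inj₂ ct) (f (here refl)) fu)
    apart′ : ∀ {z z′} → z ∈ c ∷ u ∷ [] → z′ ∈ d ∷ l → z ≃₀ z′ → z ≡ c × z′ ≡ d
    apart′ (here refl) (here refl) r = refl , refl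
    apart′ (here refl) (there k) r = ⊥-elim (f′ k r)
    apart′ (there (here refl)) k r = ⊥-elim (f k r)
    only₁′ : ∀ {z} → z ∈ c ∷ u ∷ [] → z ≃₀ t → z ≡ c
    only₁′ (here refl) r = refl
    only₁′ (there (here refl)) r = ⊥-elim (fu r)
    only₂′ : ∀ {z} → z ∈ d ∷ l → z ≃₀ t → z ≡ d
    only₂′ (here refl) r = refl
    only₂′ (there k) r = ⊥-elim (fs (there (there (there k)))
      (claw₀₃ (inj₂ (Z.~-sym ct)) (Z.≃-sym r) (inj₂ ts) (f′ k) (fs (there (here refl)))))

  next : ∀ {u v l} → IPath₀ u v l → u ≡ v ⊎ ∃ λ c → c ∈ l × u ~₀ c
  next one₀ = inj₁ refl
  next (cons₀ e _ _) = inj₂ (_ , there (here refl) , e)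

  -- A corner of a theta: a clique with three exits
  module Corner {a₁ a₂ a₃ o₁ o₂ o₃ : V}
    (a₁₂ : a₁ ~ a₂) (a₁₃ : a₁ ~ a₃) (a₂₃ : a₂ ~ a₃) (ao₁ : a₁ ~₀ o₁) (ao₂ : a₂ ~₀ o₂) (ao₃ : a₃ ~₀ o₃)
    (out₁ : Far o₁ a₂) (out₂ : Far o₂ a₁) (out₃ : Far o₃ a₁)
    (far₁₂ : Far o₁ o₂) (far₁₃ : Far o₁ o₃) (far₂₃ : Far o₂ o₃) where

    A : V → Set
    A = Clique a₁ a₂

    Int : V → Set
    Int = Interior a₁ a₂

    A₁ : A a₁
    A₁ = inj₁ refl , inj₂ a₁₂
    A₂ : A a₂
    A₂ = inj₂ (~-sym a₁₂) , inj₁ refl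
    A₃ : A a₃
    A₃ = inj₂ (~-sym a₁₃) , inj₂ (~-sym a₂₃)

    door : ∀ {a o} → A a → a ~₀ o → ¬ A o → ∀ {z} → A z → o ≃ z → z ≡ a
    door {a} {o} ca ao ¬co {z} cz oz with z ≟ a
    ... | yes eq = eq
    ... | no ne = ⊥-elim (¬co (clique-absorb a₁₂ cz ca ne oz (inj₂ (~-sym (sub ao)))))

    ¬A₁ : ¬ A o₁
    ¬A₁ (_ , c) = out₁ c
    ¬A₂ : ¬ A o₂
    ¬A₂ (c , _) = out₂ c
    ¬A₃ : ¬ A o₃
    ¬A₃ (c , _) = out₃ c

    door₁ : ∀ {z} → A z → o₁ ≃ z → z ≡ a₁
    door₁ = door A₁ ao₁ ¬A₁
    door₂ : ∀ {z} → A z → o₂ ≃ z → z ≡ a₂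
    door₂ = door A₂ ao₂ ¬A₂
    door₃ : ∀ {z} → A z → o₃ ≃ z → z ≡ a₃
    door₃ = door A₃ ao₃ ¬A₃

    -- A vertex `y` as excluded here could replace the two middle ones of four consecutive vertices.
    -- When a third arm hangs at these middle vertices, `e` and `f` are the next vertices on the two
    -- base arms, and the exclusion leaves them without a common neighbour in the clique.
    NoShort : List V → Set
    NoShort (e ∷ x ∷ x′ ∷ f ∷ l) = (∀ {y} → A y → e ~₀ y → f ~₀ y → ⊥) × NoShort (x ∷ x′ ∷ f ∷ l)
    NoShort _ = ⊤

    noShort-ʳ++ : ∀ d {l} → NoShort (d ʳ++ l) → NoShort l
    noShort-ʳ++ [] h = h
    noShort-ʳ++ (x ∷ d) {l} h = tail l (noShort-ʳ++ d h)
      where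
      tail : ∀ l → NoShort (x ∷ l) → NoShort l
      tail [] _ = tt
      tail (_ ∷ []) _ = tt
      tail (_ ∷ _ ∷ []) _ = tt
      tail (_ ∷ _ ∷ _ ∷ _) (_ , h) = h

    AO : V → Set
    AO z = z ≡ o₁ ⊎ z ≡ o₂ ⊎ A z

    shorten : ∀ {u v l} → IPath₀ u v l → (∀ {z} → z ∈ l → AO z) →
      NoShort l ⊎ Σ (Walk₀ AO u v) λ w → Z.steps w < length l
    shorten one₀ inl = inj₁ tt
    shorten (cons₀ _ _ one₀) inl = inj₁ tt
    shorten (cons₀ _ _ (cons₀ _ _ one₀)) inl = inj₁ tt
    shorten {u} (cons₀ e₁ f₁ p@(cons₀ e₂ f₂ (cons₀ {c = f} e₃ f₃ q))) inl
      with shorten p (inl ∘ there) | any? (λ y → clique? a₁ a₂ y ×-dec ((u Z.~? y) ×-dec (f Z.~? y)))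
    ... | inj₂ (w , lt) | _ = inj₂ (go₀ (inl (here refl)) e₁ w , s≤s lt)
    ... | inj₁ h | no none = inj₁ ((λ cy uy fy → none (_ , cy , uy , fy)) , h)
    ... | inj₁ _ | yes (y , cy , uy , fy) with Z.ipath⇒walk q (λ i → inl (there (there (there i))))
    ...   | w , eq = inj₂ (go₀ (inl (here refl)) uy (go₀ (inj₂ (inj₂ cy)) (Z.~-sym fy) w) , s≤s (s≤s (s≤s (ℕ.≤-reflexive eq))))

    Base : Set
    Base = ∃ λ l → IPath₀ o₁ o₂ l × (∀ {z} → z ∈ l → AO z) × NoShort l

    shortest : ∀ k {l} → length l < k → IPath₀ o₁ o₂ l → (∀ {z} → z ∈ l → AO z) → Base
    shortest (suc k) {l} (s≤s le) p inl with shorten p inl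
    ... | inj₁ h = l , p , inl , h
    ... | inj₂ (w , lt) with Z.walk⇒ipath w
    ...   | l′ , p′ , inl′ , le′ = shortest k (ℕ.≤-<-trans le′ (ℕ.<-≤-trans lt le)) p′ inl′

    base : Base
    base with Z.walk⇒ipath walk
      where
      walk : Walk₀ AO o₁ o₂
      walk = go₀ (inj₁ refl) (Z.~-sym ao₁) (Z.walk-snoc (Z.walk-map (λ c → inj₂ (inj₂ c)) (region-walk a₁₂ A₁ A₂)) ao₂ (inj₂ (inj₁ refl)))
    ... | l , p , inl , _ = shortest (suc (length l)) ℕ.≤-refl p inl

    record Arm (a o t : V) (D : List V) : Set where
      field
        path  : IPath₀ t o D
        start : A t
        elems : ∀ {z} → z ∈ D → z ≡ o ⊎ z ≡ a ⊎ Int z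

    record Apart (t : V) (D : List V) (t′ : V) (D′ : List V) : Set where
      constructor separated
      field
        edge  : t ~₀ t′
        cross : ∀ {z z′} → z ∈ D → z′ ∈ D′ → z ≃₀ z′ → z ≡ t × z′ ≡ t′

    -- A generalised net in `G₀`: a triangle with one arm to each exit. Two arms are cut from the
    -- base path, the third leads from the last contact with the base to `o₃`.
    record Spider : Set where
      field
        {t₁ t₂ t₃} : V
        {D₁ D₂ D₃} : List V
        arm₁ : Arm a₁ o₁ t₁ D₁
        arm₂ : Arm a₂ o₂ t₂ D₂
        arm₃ : Arm a₃ o₃ t₃ D₃
        ap₁₂ : Apart t₁ D₁ t₂ D₂
        ap₁₃ : Apart t₁ D₁ t₃ D₃
        ap₂₃ : Apart t₂ D₂ t₃ D₃
        base-short : ∀ {e f r s} → D₁ ≡ t₁ ∷ e ∷ r → D₂ ≡ t₂ ∷ f ∷ s → ∀ {y} → A y → e ~₀ y → f ~₀ y → ⊥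

    module Build {l} (p : IPath₀ o₁ o₂ l) (inl : ∀ {z} → z ∈ l → AO z) (short : NoShort l) where

      -- Next to an exit, a clique vertex can only be the door of that exit. Between two far clique
      -- vertices it is interior by `inner`.
      settle : ∀ {x z y} → A x ⊎ x ≡ o₁ ⊎ x ≡ o₂ ⊎ x ≡ o₃ → A z → A y ⊎ y ≡ o₁ ⊎ y ≡ o₂ ⊎ y ≡ o₃ → x ~₀ z → z ~₀ y → Far₀ x y →
        z ≡ a₁ ⊎ z ≡ a₂ ⊎ z ≡ a₃ ⊎ Int z
      settle (inj₂ (inj₁ refl)) cz _ xz _ _ = inj₁ (door₁ cz (inj₂ (sub xz)))
      settle (inj₂ (inj₂ (inj₁ refl))) cz _ xz _ _ = inj₂ (inj₁ (door₂ cz (inj₂ (sub xz))))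
      settle (inj₂ (inj₂ (inj₂ refl))) cz _ xz _ _ = inj₂ (inj₂ (inj₁ (door₃ cz (inj₂ (sub xz)))))
      settle (inj₁ _) cz (inj₂ (inj₁ refl)) _ zy _ = inj₁ (door₁ cz (inj₂ (~-sym (sub zy))))
      settle (inj₁ _) cz (inj₂ (inj₂ (inj₁ refl))) _ zy _ = inj₂ (inj₁ (door₂ cz (inj₂ (~-sym (sub zy)))))
      settle (inj₁ _) cz (inj₂ (inj₂ (inj₂ refl))) _ zy _ = inj₂ (inj₂ (inj₁ (door₃ cz (inj₂ (~-sym (sub zy))))))
      settle (inj₁ cx) cz (inj₁ cy) xz zy far = inj₂ (inj₂ (inj₂ (inner a₁₂ cx cz cy xz zy far)))

      a₃-open : ¬ Int a₃
      a₃-open int = ¬A₃ (int (inj₂ (~-sym (sub ao₃))))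

      base-place : ∀ {z} → z ∈ l → A z → z ≡ a₁ ⊎ z ≡ a₂ ⊎ z ≡ a₃ ⊎ Int z
      base-place i cz with Z.ipath-position p i
      ... | inj₁ refl = ⊥-elim (¬A₁ cz)
      ... | inj₂ (inj₁ refl) = ⊥-elim (¬A₂ cz)
      ... | inj₂ (inj₂ (x , y , x∈ , y∈ , _ , _ , xz , zy , far)) = settle (ao x∈) cz (ao y∈) xz zy far
        where
        ao : ∀ {x} → x ∈ l → A x ⊎ x ≡ o₁ ⊎ x ≡ o₂ ⊎ x ≡ o₃
        ao i with inl i
        ... | inj₁ e = inj₂ (inj₁ e)
        ... | inj₂ (inj₁ e) = inj₂ (inj₂ (inj₁ e))
        ... | inj₂ (inj₂ c) = inj₁ c

      a₃∉ : a₃ ∉ l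
      a₃∉ i with Z.ipath-position p i
      ... | inj₁ refl = ¬A₁ A₃
      ... | inj₂ (inj₁ refl) = ¬A₂ A₃
      ... | inj₂ (inj₂ (x , y , x∈ , y∈ , _ , _ , xz , zy , far)) with inl x∈ | inl y∈
      ...   | inj₁ refl | _ = ~⇒≢ a₁₃ (sym (door₁ A₃ (inj₂ (sub xz))))
      ...   | inj₂ (inj₁ refl) | _ = ~⇒≢ a₂₃ (sym (door₂ A₃ (inj₂ (sub xz))))
      ...   | inj₂ (inj₂ _) | inj₁ refl = ~⇒≢ a₁₃ (sym (door₁ A₃ (inj₂ (~-sym (sub zy)))))
      ...   | inj₂ (inj₂ _) | inj₂ (inj₁ refl) = ~⇒≢ a₂₃ (sym (door₂ A₃ (inj₂ (~-sym (sub zy)))))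
      ...   | inj₂ (inj₂ cx) | inj₂ (inj₂ cy) = a₃-open (inner a₁₂ cx A₃ cy xz zy far)

      o₃-far : ∀ {q} → q ∈ l → Far₀ q o₃
      o₃-far i c with inl i
      ... | inj₁ refl = far₁₃ (≃₀⇒≃ c)
      ... | inj₂ (inj₁ refl) = far₂₃ (≃₀⇒≃ c)
      ... | inj₂ (inj₂ cq) = a₃∉ (subst (_∈ l) (door₃ cq (≃-sym (≃₀⇒≃ c))) i)

      Clear : V → Set
      Clear z = A z × (∀ {q} → q ∈ l → Far₀ q z)

      touches? : ∀ z → Dec (∃ λ q → q ∈ l × q ≃₀ z)
      touches? z with Any.any? (Z._≃? z) l
      ... | yes i = yes (find i)
      ... | no ¬i = no λ (q , i , c) → ¬i (lose i c)

      Last : V → Set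
      Last v = ∃ λ t → A t × (∃ λ q → q ∈ l × q ≃₀ t) × (t ≡ v ⊎ ∃ λ s → t ~₀ s × Walk₀ Clear s v)

      -- Past the last vertex `t` that touches the base the walk keeps clear of it. The successor of
      -- `t`, or the exit `o₃` if `t` is `a₃`, is then the neighbour far from the base that `touch`
      -- requires.
      last-touch : ∀ {u v} → Walk₀ A u v → Walk₀ Clear u v ⊎ Last v
      last-touch {u} (stop₀ c) with touches? u
      ... | yes h = inj₂ (_ , c , h , inj₁ refl)
      ... | no h = inj₁ (stop₀ (c , λ i r → h (_ , i , r)))
      last-touch {u} (go₀ c e w) with last-touch w
      ... | inj₂ r = inj₂ r
      ... | inj₁ w′ with touches? u
      ...   | yes h = inj₂ (_ , c , h , inj₂ (_ , e , w′))
      ...   | no h = inj₁ (go₀ (c , λ i r → h (_ , i , r)) e w′)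

      module Third {t} (ct : A t) (q∈ : ∃ λ q → q ∈ l × q ≃₀ t) {s} (ts : t ~₀ s) (fs : ∀ {q} → q ∈ l → Far₀ q s)
        (w : Walk₀ (λ z → z ≡ o₃ ⊎ Clear z) s o₃) (only-a₃ : s ≡ o₃ → t ≡ a₃) where

        t∉ : t ∉ l
        t∉ i = fs i (inj₂ ts)

        o₁t : Far₀ o₁ t
        o₁t c = t∉ (subst (_∈ l) (sym (door₁ ct (≃₀⇒≃ c))) a₁∈)
          where
          a₁∈ : a₁ ∈ l
          a₁∈ with next p
          ... | inj₁ refl = ⊥-elim (far₁₂ ≃-refl)
          ... | inj₂ (c , c∈ , e) with inl c∈
          ...   | inj₁ refl = ⊥-elim (Z.~-irrefl e)
          ...   | inj₂ (inj₁ refl) = ⊥-elim (far₁₂ (inj₂ (sub e)))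
          ...   | inj₂ (inj₂ cc) = subst (_∈ l) (door₁ cc (inj₂ (sub e))) c∈

        o₂t : Far₀ o₂ t
        o₂t c = t∉ (subst (_∈ l) (sym (door₂ ct (≃₀⇒≃ c))) a₂∈)
          where
          a₂∈ : a₂ ∈ l
          a₂∈ with Z.ipath-reverse p
          ... | _ , p′ , i , _ with next p′
          ...   | inj₁ refl = ⊥-elim (far₁₂ ≃-refl)
          ...   | inj₂ (c , c∈ , e) with inl (i c∈)
          ...     | inj₂ (inj₁ refl) = ⊥-elim (Z.~-irrefl e)
          ...     | inj₁ refl = ⊥-elim (far₁₂ (inj₂ (~-sym (sub e))))
          ...     | inj₂ (inj₂ cc) = subst (_∈ l) (door₂ cc (inj₂ (sub e))) (i c∈)

        open Touch (touch p ts fs o₁t o₂t q∈)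

        arm-walk : Walk₀ (λ z → z ≡ t ⊎ z ≡ o₃ ⊎ Clear z) t o₃
        arm-walk = go₀ (inj₁ refl) ts (Z.walk-map inj₂ w)

        in-A : ∀ {z} → z ∈ l → z ≃₀ t → A z
        in-A i c with inl i
        ... | inj₁ refl = ⊥-elim (o₁t c)
        ... | inj₂ (inj₁ refl) = ⊥-elim (o₂t c)
        ... | inj₂ (inj₂ cz) = cz

        x∈ : x ∈ l
        x∈ = sub₁ (Z.ipath-first arm₁)
        x′∈ : x′ ∈ l
        x′∈ = sub₂ (Z.ipath-first arm₂)

        Ax : A x
        Ax = in-A x∈ (inj₂ (Z.~-sym tx))
        Ax′ : A x′
        Ax′ = in-A x′∈ (inj₂ (Z.~-sym tx′))

        t-place : t ≡ a₃ ⊎ Int t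
        t-place with Z.walk-start w
        ... | inj₁ eq = inj₁ (only-a₃ eq)
        ... | inj₂ (cs , _) = inj₂ (inner a₁₂ Ax ct cs (Z.~-sym tx) ts (fs x∈))

        spider : Spider
        spider with Z.walk⇒ipath arm-walk
        ... | D , q , inD , _ = record
          { arm₁ = record { path = arm₁ ; start = Ax ; elems = elems₁ }
          ; arm₂ = record { path = arm₂ ; start = Ax′ ; elems = elems₂ }
          ; arm₃ = record { path = q ; start = ct ; elems = elems₃ }
          ; ap₁₂ = separated xx′ (Touch.apart T)
          ; ap₁₃ = separated (Z.~-sym tx) (cross₃ sub₁ only₁)
          ; ap₂₃ = separated (Z.~-sym tx′) (cross₃ sub₂ only₂)
          ; base-short = λ {e} {f} {r} {s} eq eq′ → no-short eq eq′ }
          where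
          T = touch p ts fs o₁t o₂t q∈
          no-a₃ : ∀ {z} → z ∈ l → z ≢ a₃
          no-a₃ i refl = a₃∉ i
          a₂∉₁ : a₂ ∉ D₁
          a₂∉₁ i with Touch.apart T i (Z.ipath-last arm₂) (inj₂ ao₂)
          ... | _ , eq = ¬A₂ (subst A (sym eq) Ax′)
          a₁∉₂ : a₁ ∉ D₂
          a₁∉₂ i with Touch.apart T (Z.ipath-last arm₁) i (inj₂ (Z.~-sym ao₁))
          ... | eq , _ = ¬A₁ (subst A (sym eq) Ax)
          elems₁ : ∀ {z} → z ∈ D₁ → z ≡ o₁ ⊎ z ≡ a₁ ⊎ Int z
          elems₁ i with inl (sub₁ i)
          ... | inj₁ eq = inj₁ eq
          ... | inj₂ (inj₁ refl) with Touch.apart T i (Z.ipath-last arm₂) (inj₁ refl)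
          ...   | eq , _ = ⊥-elim (¬A₂ (subst A (sym eq) Ax))
          elems₁ i | inj₂ (inj₂ cz) with base-place (sub₁ i) cz
          ... | inj₁ eq = inj₂ (inj₁ eq)
          ... | inj₂ (inj₁ refl) = ⊥-elim (a₂∉₁ i)
          ... | inj₂ (inj₂ (inj₁ eq)) = ⊥-elim (no-a₃ (sub₁ i) eq)
          ... | inj₂ (inj₂ (inj₂ int)) = inj₂ (inj₂ int)
          elems₂ : ∀ {z} → z ∈ D₂ → z ≡ o₂ ⊎ z ≡ a₂ ⊎ Int z
          elems₂ i with inl (sub₂ i)
          ... | inj₂ (inj₁ eq) = inj₁ eq
          ... | inj₁ refl with Touch.apart T (Z.ipath-last arm₁) i (inj₁ refl)
          ...   | eq , _ = ⊥-elim (¬A₁ (subst A (sym eq) Ax))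
          elems₂ i | inj₂ (inj₂ cz) with base-place (sub₂ i) cz
          ... | inj₂ (inj₁ eq) = inj₂ (inj₁ eq)
          ... | inj₁ refl = ⊥-elim (a₁∉₂ i)
          ... | inj₂ (inj₂ (inj₁ eq)) = ⊥-elim (no-a₃ (sub₂ i) eq)
          ... | inj₂ (inj₂ (inj₂ int)) = inj₂ (inj₂ int)
          site : ∀ {z} → z ∈ D → A z ⊎ z ≡ o₁ ⊎ z ≡ o₂ ⊎ z ≡ o₃
          site i with inD i
          ... | inj₁ refl = inj₁ ct
          ... | inj₂ (inj₁ eq) = inj₂ (inj₂ (inj₂ eq))
          ... | inj₂ (inj₂ (cz , _)) = inj₁ cz
          elems₃ : ∀ {z} → z ∈ D → z ≡ o₃ ⊎ z ≡ a₃ ⊎ Int z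
          elems₃ i with inD i
          ... | inj₁ refl = inj₂ t-place
          ... | inj₂ (inj₁ eq) = inj₁ eq
          ... | inj₂ (inj₂ (cz , clear)) with Z.ipath-position q i
          ...   | inj₁ refl = inj₂ t-place
          ...   | inj₂ (inj₁ eq) = inj₁ eq
          ...   | inj₂ (inj₂ (x , y , x∈ , y∈ , _ , _ , xz , zy , far)) with settle (site x∈) cz (site y∈) xz zy far
          ...     | inj₁ refl = ⊥-elim (clear (Z.ipath-first p) (inj₂ (Z.~-sym ao₁)))
          ...     | inj₂ (inj₁ refl) = ⊥-elim (clear (Z.ipath-last p) (inj₂ (Z.~-sym ao₂)))
          ...     | inj₂ (inj₂ r) = inj₂ r
          cross₃ : ∀ {E x} → (∀ {z} → z ∈ E → z ∈ l) → (∀ {z} → z ∈ E → z ≃₀ t → z ≡ x) →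
            ∀ {z z′} → z ∈ E → z′ ∈ D → z ≃₀ z′ → z ≡ x × z′ ≡ t
          cross₃ s o i j c with inD j
          ... | inj₁ refl = o i c , refl
          ... | inj₂ (inj₁ refl) = ⊥-elim (o₃-far (s i) c)
          ... | inj₂ (inj₂ (_ , clear)) = ⊥-elim (clear (s i) c)
          no-short : ∀ {e f r s} → D₁ ≡ x ∷ e ∷ r → D₂ ≡ x′ ∷ f ∷ s → ∀ {y} → A y → e ~₀ y → f ~₀ y → ⊥
          no-short {e} {f} {r} {s} eq eq′ = proj₁ (noShort-ʳ++ r (subst NoShort (trans spell (cong₂ _ʳ++_ eq eq′)) short))

      spider-from : Last a₃ → Spider
      spider-from (t , ct , q , inj₁ refl) = Third.spider ct q ao₃ o₃-far (stop₀ (inj₁ refl)) (λ _ → refl)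
      spider-from (t , ct , q , inj₂ (s , ts , w)) =
        Third.spider ct q ts (proj₂ (Z.walk-start w)) (Z.walk-snoc (Z.walk-map inj₂ w) ao₃ (inj₁ refl))
          (λ { refl → ⊥-elim (¬A₃ (proj₁ (Z.walk-start w))) })

      build : Spider
      build with last-touch (region-walk a₁₂ A₁ A₃)
      ... | inj₂ r = spider-from r
      ... | inj₁ w = ⊥-elim (proj₂ (Z.walk-start w) (Z.ipath-first p) (inj₂ (Z.~-sym ao₁)))

    spider : Spider
    spider = let (l , p , inl , short) = base in Build.build p inl short

-- Induced copies of the three graphs

symmetric-pattern : ∀ H i j → adjOf H i j ≡ adjOf H j i
symmetric-pattern H = toWitness (check H)
  where
  symmetric? : ∀ H → Dec (∀ i j → adjOf H i j ≡ adjOf H j i)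
  symmetric? H = all? λ i → all? λ j → adjOf H i j Bool.≟ adjOf H j i
  check : ∀ H → True (symmetric? H)
  check P6 = tt
  check N = tt
  check W = tt

loopless-pattern : ∀ H i → adjOf H i i ≡ false
loopless-pattern H = toWitness (check H)
  where
  loopless? : ∀ H → Dec (∀ i → adjOf H i i ≡ false)
  loopless? H = all? λ i → adjOf H i i Bool.≟ false
  check : ∀ H → True (loopless? H)
  check P6 = tt
  check N = tt
  check W = tt

increasing-pairs : ∀ {Q : Fin 6 → Fin 6 → Set} → Q #0 #1 → Q #0 #2 → Q #0 #3 → Q #0 #4 → Q #0 #5 → Q #1 #2 → Q #1 #3 → Q #1 #4 → Q #1 #5 →
  Q #2 #3 → Q #2 #4 → Q #2 #5 → Q #3 #4 → Q #3 #5 → Q #4 #5 → ∀ i j → toℕ i < toℕ j → Q i j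
increasing-pairs {Q} q01 q02 q03 q04 q05 q12 q13 q14 q15 q23 q24 q25 q34 q35 q45 = each₆ row₀ row₁ row₂ row₃ row₄ row₅
  where
  each₆ : ∀ {R : Fin 6 → Set} → R #0 → R #1 → R #2 → R #3 → R #4 → R #5 → ∀ i → R i
  each₆ a b c d e f zero = a
  each₆ a b c d e f (suc zero) = b
  each₆ a b c d e f (suc (suc zero)) = c
  each₆ a b c d e f (suc (suc (suc zero))) = d
  each₆ a b c d e f (suc (suc (suc (suc zero)))) = e
  each₆ a b c d e f (suc (suc (suc (suc (suc zero))))) = f
  Row : Fin 6 → Set
  Row i = ∀ j → toℕ i < toℕ j → Q i j
  not< : ∀ {k l} {A : Set} → k ≤ l → l < k → A
  not< le lt = ⊥-elim (ℕ.<⇒≱ lt le)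
  k≤k : ∀ {k} → k ≤ k
  k≤k = ℕ.≤-refl
  ↓ : ∀ {k l} → suc k ≤ l → k ≤ l
  ↓ = ℕ.<⇒≤
  row₀ : Row #0
  row₀ = each₆ (not< k≤k) (λ _ → q01) (λ _ → q02) (λ _ → q03) (λ _ → q04) (λ _ → q05)
  row₁ : Row #1
  row₁ = each₆ (not< z≤n) (not< k≤k) (λ _ → q12) (λ _ → q13) (λ _ → q14) (λ _ → q15)
  row₂ : Row #2
  row₂ = each₆ (not< z≤n) (not< (↓ k≤k)) (not< k≤k) (λ _ → q23) (λ _ → q24) (λ _ → q25)
  row₃ : Row #3
  row₃ = each₆ (not< z≤n) (not< (↓ (↓ k≤k))) (not< (↓ k≤k)) (not< k≤k) (λ _ → q34) (λ _ → q35)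
  row₄ : Row #4
  row₄ = each₆ (not< z≤n) (not< (↓ (↓ (↓ k≤k)))) (not< (↓ (↓ k≤k))) (not< (↓ k≤k)) (not< k≤k) (λ _ → q45)
  row₅ : Row #5
  row₅ = each₆ (not< z≤n) (not< (↓ (↓ (↓ (↓ k≤k))))) (not< (↓ (↓ (↓ k≤k)))) (not< (↓ (↓ k≤k))) (not< (↓ k≤k)) (not< k≤k)

module Copies {n : ℕ} (G : Graph n) where
  open Adjacency G

  Fits : Bool → V → V → Set
  Fits true = _~_
  Fits false = Far

  fits-≡ : ∀ b {u v} → Fits b u v → adj G u v ≡ b
  fits-≡ true e = e
  fits-≡ false f = Bool.¬-not (f ∘ inj₂)

  fits-≢ : ∀ b {u v} → Fits b u v → u ≢ v
  fits-≢ true e = ~⇒≢ e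
  fits-≢ false f = far⇒≢ f

  six : V → V → V → V → V → V → Fin 6 → V
  six a b c d e f zero = a
  six a b c d e f (suc zero) = b
  six a b c d e f (suc (suc zero)) = c
  six a b c d e f (suc (suc (suc zero))) = d
  six a b c d e f (suc (suc (suc (suc zero)))) = e
  six a b c d e f (suc (suc (suc (suc (suc zero))))) = f

  copy : ∀ H (f : Fin 6 → V) → (∀ i j → toℕ i < toℕ j → Fits (adjOf H i j) (f i) (f j)) →
    ∀ i → degreeOf (adjOf H) i ≡ 1 → EndVertexOfInduced G H (f i)
  copy H f up i d = f , inj , match , i , d , refl
    where
    match : ∀ i j → adj G (f i) (f j) ≡ adjOf H i j
    match i j with ℕ.<-cmp (toℕ i) (toℕ j)
    ... | tri< lt _ _ = fits-≡ (adjOf H i j) (up i j lt)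
    ... | tri≈ _ eq _ with refl ← toℕ-injective eq = trans (irrefl G (f i)) (sym (loopless-pattern H i))
    ... | tri> _ _ gt = trans (Graph.sym G (f i) (f j)) (trans (fits-≡ (adjOf H j i) (up j i gt)) (symmetric-pattern H j i))
    inj : ∀ {i j} → f i ≡ f j → i ≡ j
    inj {i} {j} eq with ℕ.<-cmp (toℕ i) (toℕ j)
    ... | tri< lt _ _ = ⊥-elim (fits-≢ (adjOf H i j) (up i j lt) eq)
    ... | tri≈ _ e _ = toℕ-injective e
    ... | tri> _ _ gt = ⊥-elim (fits-≢ (adjOf H j i) (up j i gt) (sym eq))

  path-copy : ∀ {u v l} → IPath u v l → 6 ≤ length l → EndVertexOfInduced G P6 u
  path-copy one (s≤s ())
  path-copy (cons _ _ one) (s≤s (s≤s ()))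
  path-copy (cons _ _ (cons _ _ one)) (s≤s (s≤s (s≤s ())))
  path-copy (cons _ _ (cons _ _ (cons _ _ one))) (s≤s (s≤s (s≤s (s≤s ()))))
  path-copy (cons _ _ (cons _ _ (cons _ _ (cons _ _ one)))) (s≤s (s≤s (s≤s (s≤s (s≤s ())))))
  path-copy (cons {u} {a} e₁ f₁ (cons {c = b} e₂ f₂ (cons {c = c} e₃ f₃ (cons {c = d} e₄ f₄ (cons {c = e} e₅ f₅ _))))) _ =
    copy P6 (six u a b c d e)
      (increasing-pairs e₁ (f₁ (here refl)) (f₁ (there (here refl))) (f₁ (there (there (here refl)))) (f₁ (there (there (there (here refl)))))
        e₂ (f₂ (here refl)) (f₂ (there (here refl))) (f₂ (there (there (here refl))))
        e₃ (f₃ (here refl)) (f₃ (there (here refl))) e₄ (f₄ (here refl)) e₅)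
      #0 refl

  -- A net with its vertices indexed by arm, so that the three arms can be treated uniformly.
  record Fan : Set where
    field
      t e     : Fin 3 → V
      tri     : ∀ {i j} → i ≢ j → t i ~ t j
      pend    : ∀ i → t i ~ e i
      te-far  : ∀ {i j} → i ≢ j → Far (t i) (e j)
      ee-far  : ∀ {i j} → i ≢ j → Far (e i) (e j)

  module _ (F : Fan) where
    open Fan F

    private
      0≢1 : _≢_ {A = Fin 3} zero (suc zero)
      0≢1 ()
      0≢2 : _≢_ {A = Fin 3} zero (suc (suc zero))
      0≢2 ()
      1≢2 : _≢_ {A = Fin 3} (suc zero) (suc (suc zero))
      1≢2 ()

    net-copy : ∀ i → EndVertexOfInduced G N (e i)
    net-copy i = at i
      where
      t₀ = t zero
      t₁ = t (suc zero)
      t₂ = t (suc (suc zero))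
      e₀ = e zero
      e₁ = e (suc zero)
      e₂ = e (suc (suc zero))
      up : ∀ i j → toℕ i < toℕ j → Fits (adjOf N i j) (six t₀ t₁ t₂ e₀ e₁ e₂ i) (six t₀ t₁ t₂ e₀ e₁ e₂ j)
      up = increasing-pairs (tri 0≢1) (tri 0≢2) (pend zero) (te-far 0≢1) (te-far 0≢2)
        (tri 1≢2) (te-far (0≢1 ∘ sym)) (pend _) (te-far 1≢2)
        (te-far (0≢2 ∘ sym)) (te-far (1≢2 ∘ sym)) (pend _)
        (ee-far 0≢1) (ee-far 0≢2) (ee-far 1≢2)
      at : ∀ i → EndVertexOfInduced G N (e i)
      at zero = copy N _ up #3 refl
      at (suc zero) = copy N _ up #4 refl
      at (suc (suc zero)) = copy N _ up #5 refl

    wounded-copy : ∀ {p q r} → p ≢ q → p ≢ r → q ≢ r → ∀ {x} → e q ~ x → Far (t q) x → Far (t p) x → Far (e p) x → Far (t r) x →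
      EndVertexOfInduced G W (e p)
    wounded-copy {p} {q} {r} pq pr qr {x} ex tqx tpx epx trx = copy W (six (t r) (t p) (t q) (e p) (e q) x)
      (increasing-pairs (tri (pr ∘ sym)) (tri (qr ∘ sym)) (te-far (pr ∘ sym)) (te-far (qr ∘ sym)) trx
        (tri pq) (pend p) (te-far pq) tpx (te-far (pq ∘ sym)) (pend q) tqx (ee-far pq) epx ex) #3 refl

  -- the wounded with triangle x y z, pendant edge y c and pendant path z u w
  wounded : ∀ {x y z c u w} → x ~ y → y ~ z → x ~ z → y ~ c → z ~ u → u ~ w →
    Far x c → Far x u → Far x w → Far y u → Far y w → Far z c → Far z w → Far c u → Far c w → EndVertexOfInduced G W w
  wounded {x} {y} {z} {c} {u} {w} xy yz xz yc zu uw xc xu xw yu yw zc zw cu cw =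
    copy W (six x y z c u w) (increasing-pairs xy xz xc xu xw yz yc yu yw zc zu zw cu cw uw) #5 refl

-- Large ends

module Ends {n : ℕ} (G₀ G : Graph n) (cf₀ : ClawFree G₀) (cf : ClawFree G) (df : DiamondFree G)
  (sub : G₀ ⊑ G) (sp : Spanned G₀ G) where
  private module Z = Adjacency G₀
  open Adjacency G
  open Z using () renaming (_~_ to _~₀_; _≃_ to _≃₀_; Far to Far₀; IPath to IPath₀; one to one₀; cons to cons₀)
  open Cliques G df
  open Regions G₀ G cf₀ df sub sp
  open Large G₀ G cf df sub
  open Copies G₀

  ipath₀-join : ∀ {u v w l m} → IPath₀ u v l → IPath₀ v w m → (∀ {x y} → x ∈ l → y ∈ m → x ≃₀ y → x ≡ v ⊎ y ≡ v) →
    ∃ λ r → IPath₀ u w r × (∀ {z} → z ∈ r → z ∈ l ⊎ z ∈ m) × suc (length r) ≡ length l + length m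
  ipath₀-join {l = l} p one₀ h = l , p , inj₁ , sym (trans (ℕ.+-suc (length l) 0) (cong suc (ℕ.+-identityʳ (length l))))
  ipath₀-join {v = v} {l = l} {m = _ ∷ c ∷ m} p q@(cons₀ _ _ _) h =
    l ++ c ∷ m , Z.ipath-join p q only , mem , trans (cong suc (List.length-++ l)) (sym (ℕ.+-suc (length l) (suc (length m))))
    where
    only : ∀ {x y} → x ∈ l → y ∈ c ∷ m → x ≃₀ y → x ≡ v
    only i j c with h i (there j) c
    ... | inj₁ eq = eq
    ... | inj₂ refl = ⊥-elim (Z.ipath-head∉ q j refl)
    mem : ∀ {z} → z ∈ l ++ c ∷ m → z ∈ l ⊎ z ∈ v ∷ c ∷ m
    mem i with ∈-++⁻ l i
    ... | inj₁ j = inj₁ j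
    ... | inj₂ j = inj₂ (there j)

  far-length : ∀ {u v l} → IPath₀ u v l → Far₀ u v → 3 ≤ length l
  far-length one₀ f = ⊥-elim (f Z.≃-refl)
  far-length (cons₀ e _ one₀) f = ⊥-elim (f (inj₂ e))
  far-length (cons₀ _ _ (cons₀ _ _ _)) f = s≤s (s≤s (s≤s z≤n))

  ≢-length : ∀ {u v l} → IPath₀ u v l → u ≢ v → 2 ≤ length l
  ≢-length one₀ f = ⊥-elim (f refl)
  ≢-length (cons₀ _ _ _) f = s≤s (s≤s z≤n)

  record Exit (a b : V) (vs : List V) : Set where
    field
      o    : V
      ao   : a ~₀ o
      o∈   : o ∈ vs
      o≢a  : o ≢ a
      o≢b  : o ≢ b
      kind : (a ~₀ b × o ~₀ b) ⊎ (∃ λ x → o ~₀ x × Far₀ a x × x ∈ vs)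

  exit-of : ∀ {a b vs} → Shape G₀ a b vs → Exit a b vs
  exit-of (tee ab ca cb a∈ b∈ c∈) = record
    { ao = Z.~-sym ca ; o∈ = c∈ ; o≢a = Z.~⇒≢ ca ; o≢b = Z.~⇒≢ cb ; kind = inj₁ (ab , cb) }
  exit-of (long one₀ far inl) = ⊥-elim (far Z.≃-refl)
  exit-of (long (cons₀ e f one₀) far inl) = ⊥-elim (far (inj₂ e))
  exit-of (long (cons₀ e f q@(cons₀ e′ f′ p)) far inl) = record
    { ao = e ; o∈ = inl (there (here refl)) ; o≢a = Z.~⇒≢ e ∘ sym ; o≢b = Z.ipath-head∉ q (Z.ipath-last p)
    ; kind = inj₂ (_ , e′ , f (here refl) , inl (there (there (here refl)))) }

  module Side (T : Theta G₀ G) where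
    open Theta T
    open ThetaFacts T sub

    exit : ∀ i → Exit (a i) (b i) (vs i)
    exit i = exit-of (shape i)

    o : Fin 3 → V
    o i = Exit.o (exit i)

    a-close : ∀ i j → a i ≃ a j
    a-close i j with i ≟ j
    ... | yes refl = ≃-refl
    ... | no ne = inj₂ (aa ne)

    InA : V → Set
    InA z = ∀ m → z ≃ a m

    IntA : V → Set
    IntA z = ∀ {t} → t ≃ z → InA t

    everywhere : ∀ {i j} → i ≢ j → ∀ {z} → Clique (a i) (a j) z → InA z
    everywhere {i} {j} ne (zi , zj) m = df (aa ne) zi zj (a-close m i) (a-close m j)

    interior : ∀ {i j} → i ≢ j → ∀ {z} → Interior (a i) (a j) z → IntA z
    interior ne int c = everywhere ne (int c)

    o-far : ∀ {i j} → i ≢ j → Far (o i) (o j)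
    o-far {i} {j} ne c with cross ne (Exit.o∈ (exit i)) (Exit.o∈ (exit j)) c
    ... | inj₁ (eq , _) = Exit.o≢a (exit i) eq
    ... | inj₂ (eq , _) = Exit.o≢b (exit i) eq

    o-off : ∀ {i j} → i ≢ j → Far (o i) (a j)
    o-off {i} ne = off-a ne (Exit.o∈ (exit i)) (Exit.o≢a (exit i))

    Loc : Fin 3 → V → Set
    Loc i e = e ≡ o i ⊎ e ≡ a i ⊎ IntA e

    beyond : ∀ {i j} → i ≢ j → ∀ {e x} → Loc i e → x ∈ vs j → x ≢ a j → Far e x
    beyond {i} {j} ne (inj₁ refl) x∈ x≢a c with cross ne (Exit.o∈ (exit i)) x∈ c
    ... | inj₁ (eq , _) = Exit.o≢a (exit i) eq
    ... | inj₂ (eq , _) = Exit.o≢b (exit i) eq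
    beyond ne (inj₂ (inj₁ refl)) x∈ x≢a c = off-a (ne ∘ sym) x∈ x≢a (≃-sym c)
    beyond {i} ne (inj₂ (inj₂ int)) x∈ x≢a c = off-a (ne ∘ sym) x∈ x≢a (int (≃-sym c) i)

    -- Position `m` of the net belongs to leg `ι m`. An end is either the exit, with its foot at the
    -- corner vertex, or still in the clique, and then the arm continues to some `x`, which the
    -- wounded needs. Only positions 0 and 1 satisfy `sep`: their arms come from the shortened base
    -- path.
    record EndsAt (ι : Fin 3 → Fin 3) : Set where
      field
        fan : Fan
      open Fan fan public
      field
        t-loc : ∀ m → t m ≡ a (ι m) ⊎ IntA (t m)
        e-loc : ∀ m → (e m ≡ o (ι m) × t m ≡ a (ι m)) ⊎
          ((e m ≡ a (ι m) ⊎ IntA (e m)) × ∃ λ x → e m ~₀ x × Far₀ (t m) x × (∀ m′ → m′ ≢ m → Far₀ (t m′) x × Far₀ (e m′) x))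
        sep : (e zero ≡ a (ι zero) ⊎ IntA (e zero)) → (e (suc zero) ≡ a (ι (suc zero)) ⊎ IntA (e (suc zero))) →
          ∀ {v} → e zero ~₀ v → e (suc zero) ~₀ v → ⊥

      loc : ∀ m → Loc (ι m) (e m)
      loc m with e-loc m
      ... | inj₁ (eq , _) = inj₁ eq
      ... | inj₂ (l , _) = inj₂ l

    module _ {i j k : Fin 3} (ij : i ≢ j) (ik : i ≢ k) (jk : j ≢ k) where
      open Corner (aa ij) (aa ik) (aa jk) (Exit.ao (exit i)) (Exit.ao (exit j)) (Exit.ao (exit k))
        (o-off ij) (o-off (ij ∘ sym)) (o-off (ik ∘ sym)) (o-far ij) (o-far ik) (o-far jk)

      record ArmEnd (a o t : V) (D : List V) : Set where
        field
          e   : V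
          r   : List V
          eqD : D ≡ t ∷ e ∷ r
          te  : t ~₀ e
          tl  : t ≡ a ⊎ Int t
          el  : (e ≡ o × t ≡ a) ⊎ ((e ≡ a ⊎ Int e) × ∃ λ x → x ∈ D × e ~₀ x × Far₀ t x)
        e∈ : e ∈ D
        e∈ = subst (e ∈_) (sym eqD) (there (here refl))
        t∈ : t ∈ D
        t∈ = subst (t ∈_) (sym eqD) (here refl)

      arm-end : ∀ {a o t D} → Arm a o t D → ¬ A o → ArmEnd a o t D
      arm-end {a} {o} {t} {D} arm ¬Ao = from (Arm.path arm) (Arm.elems arm)
        where
        t-place : ∀ {D} → (∀ {z} → z ∈ D → z ≡ o ⊎ z ≡ a ⊎ Int z) → t ∈ D → t ≡ a ⊎ Int t
        t-place el i with el i
        ... | inj₁ refl = ⊥-elim (¬Ao (Arm.start arm))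
        ... | inj₂ l = l
        from : ∀ {D} → IPath₀ t o D → (∀ {z} → z ∈ D → z ≡ o ⊎ z ≡ a ⊎ Int z) → ArmEnd a o t D
        from one₀ el = ⊥-elim (¬Ao (Arm.start arm))
        from (cons₀ te f one₀) el = record { eqD = refl ; te = te ; tl = t-place el (here refl) ; el = inj₁ (refl , door-side (t-place el (here refl))) }
          where
          door-side : t ≡ a ⊎ Int t → t ≡ a
          door-side (inj₁ eq) = eq
          door-side (inj₂ int) = ⊥-elim (¬Ao (int (inj₂ (~-sym (sub te)))))
        from (cons₀ te f q@(cons₀ {c = x} ex f′ p)) el = record
          { eqD = refl ; te = te ; tl = t-place el (here refl) ; el = inj₂ (inside (el (there (here refl))) , x , there (there (here refl)) , ex , f (here refl)) }
          where
          inside : ∀ {e} → _ ≡ o ⊎ e → e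
          inside (inj₁ eq) = ⊥-elim (Z.ipath-head∉ q (Z.ipath-last p) eq)
          inside (inj₂ l) = l

      module FromArms (spider : Spider)
        (end₁ : ArmEnd (a i) (o i) (Spider.t₁ spider) (Spider.D₁ spider))
        (end₂ : ArmEnd (a j) (o j) (Spider.t₂ spider) (Spider.D₂ spider))
        (end₃ : ArmEnd (a k) (o k) (Spider.t₃ spider) (Spider.D₃ spider)) where
        private
          module S = Spider spider
          module E₁ = ArmEnd end₁
          module E₂ = ArmEnd end₂
          module E₃ = ArmEnd end₃
        tt-edge : ∀ {t D t′ D′} → Apart t D t′ D′ → t ~₀ t′ × t′ ~₀ t
        tt-edge ap = Apart.edge ap , Z.~-sym (Apart.edge ap)
        tri : ∀ m m′ → m ≢ m′ → pick₃ S.t₁ S.t₂ S.t₃ m ~₀ pick₃ S.t₁ S.t₂ S.t₃ m′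
        tri = off-diagonal₃ {λ m m′ → pick₃ S.t₁ S.t₂ S.t₃ m ~₀ pick₃ S.t₁ S.t₂ S.t₃ m′}
          (proj₁ (tt-edge S.ap₁₂)) (proj₁ (tt-edge S.ap₁₃)) (proj₂ (tt-edge S.ap₁₂)) (proj₁ (tt-edge S.ap₂₃))
          (proj₂ (tt-edge S.ap₁₃)) (proj₂ (tt-edge S.ap₂₃))
        pend : ∀ m → pick₃ S.t₁ S.t₂ S.t₃ m ~₀ pick₃ E₁.e E₂.e E₃.e m
        pend = each₃ E₁.te E₂.te E₃.te
        left-far : ∀ {t D t′ D′} → Apart t D t′ D′ → ∀ {z z′} → z ∈ D → z ≢ t → z′ ∈ D′ → Far₀ z z′
        left-far ap i ne j c = ne (proj₁ (Apart.cross ap i j c))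
        right-far : ∀ {t D t′ D′} → Apart t D t′ D′ → ∀ {z z′} → z ∈ D → z′ ∈ D′ → z′ ≢ t′ → Far₀ z z′
        right-far ap i j ne c = ne (proj₂ (Apart.cross ap i j c))
        e₁≢ = Z.~⇒≢ E₁.te ∘ sym
        e₂≢ = Z.~⇒≢ E₂.te ∘ sym
        e₃≢ = Z.~⇒≢ E₃.te ∘ sym
        te-far : ∀ m m′ → m ≢ m′ → Far₀ (pick₃ S.t₁ S.t₂ S.t₃ m) (pick₃ E₁.e E₂.e E₃.e m′)
        te-far = off-diagonal₃ {λ m m′ → Far₀ (pick₃ S.t₁ S.t₂ S.t₃ m) (pick₃ E₁.e E₂.e E₃.e m′)}
          (right-far S.ap₁₂ E₁.t∈ E₂.e∈ e₂≢) (right-far S.ap₁₃ E₁.t∈ E₃.e∈ e₃≢)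
          (Z.far-sym (left-far S.ap₁₂ E₁.e∈ e₁≢ E₂.t∈)) (right-far S.ap₂₃ E₂.t∈ E₃.e∈ e₃≢)
          (Z.far-sym (left-far S.ap₁₃ E₁.e∈ e₁≢ E₃.t∈)) (Z.far-sym (left-far S.ap₂₃ E₂.e∈ e₂≢ E₃.t∈))
        e₁₂ = left-far S.ap₁₂ E₁.e∈ e₁≢ E₂.e∈
        e₁₃ = left-far S.ap₁₃ E₁.e∈ e₁≢ E₃.e∈
        e₂₃ = left-far S.ap₂₃ E₂.e∈ e₂≢ E₃.e∈
        ee-far : ∀ m m′ → m ≢ m′ → Far₀ (pick₃ E₁.e E₂.e E₃.e m) (pick₃ E₁.e E₂.e E₃.e m′)
        ee-far = off-diagonal₃ {λ m m′ → Far₀ (pick₃ E₁.e E₂.e E₃.e m) (pick₃ E₁.e E₂.e E₃.e m′)}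
          e₁₂ e₁₃ (Z.far-sym e₁₂) e₂₃ (Z.far-sym e₁₃) (Z.far-sym e₂₃)
        global : ∀ {z c} → z ≡ c ⊎ Int z → z ≡ c ⊎ IntA z
        global (inj₁ eq) = inj₁ eq
        global (inj₂ int) = inj₂ (interior ij int)
        t-loc : ∀ m → pick₃ S.t₁ S.t₂ S.t₃ m ≡ a (pick₃ i j k m) ⊎ IntA (pick₃ S.t₁ S.t₂ S.t₃ m)
        t-loc = each₃ (global E₁.tl) (global E₂.tl) (global E₃.tl)
        Away : V → V → V → Set
        Away x t e = Far₀ t x × Far₀ e x
        place : ∀ {c d e t t′ e′ t″ e″ D} → (∀ {x} → x ∈ D → x ≢ t → Away x t′ e′ × Away x t″ e″) →
          (e ≡ d × t ≡ c) ⊎ ((e ≡ c ⊎ Int e) × ∃ λ x → x ∈ D × e ~₀ x × Far₀ t x) →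
          (e ≡ d × t ≡ c) ⊎ ((e ≡ c ⊎ IntA e) × ∃ λ x → e ~₀ x × Far₀ t x × Away x t′ e′ × Away x t″ e″)
        place h (inj₁ r) = inj₁ r
        place h (inj₂ (l , x , x∈ , ex , tx)) = inj₂ (global l , x , ex , tx , h x∈ (Z.far⇒≢ tx ∘ sym))
        before : ∀ {t D t′ D′} → Apart t D t′ D′ → ∀ {x s e} → x ∈ D → x ≢ t → s ∈ D′ → e ∈ D′ → Away x s e
        before ap i ne s∈ e∈ = Z.far-sym (left-far ap i ne s∈) , Z.far-sym (left-far ap i ne e∈)
        after : ∀ {t D t′ D′} → Apart t D t′ D′ → ∀ {x s e} → x ∈ D′ → x ≢ t′ → s ∈ D → e ∈ D → Away x s e
        after ap i ne s∈ e∈ = right-far ap s∈ i ne , right-far ap e∈ i ne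
        loc₁ = place (λ i ne → before S.ap₁₂ i ne E₂.t∈ E₂.e∈ , before S.ap₁₃ i ne E₃.t∈ E₃.e∈) E₁.el
        loc₂ = place (λ i ne → after S.ap₁₂ i ne E₁.t∈ E₁.e∈ , before S.ap₂₃ i ne E₃.t∈ E₃.e∈) E₂.el
        loc₃ = place (λ i ne → after S.ap₁₃ i ne E₁.t∈ E₁.e∈ , after S.ap₂₃ i ne E₂.t∈ E₂.e∈) E₃.el
        E : Fin 3 → V
        E = pick₃ E₁.e E₂.e E₃.e
        T₃ : Fin 3 → V
        T₃ = pick₃ S.t₁ S.t₂ S.t₃
        spread : ∀ {c d} m {t e t′ e′} →
          (∀ {x} → Away x t e × Away x t′ e′ → ∀ m′ → m′ ≢ m → Away x (T₃ m′) (E m′)) →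
          (E m ≡ d × T₃ m ≡ c) ⊎ ((E m ≡ c ⊎ IntA (E m)) × ∃ λ x → E m ~₀ x × Far₀ (T₃ m) x × Away x t e × Away x t′ e′) →
          (E m ≡ d × T₃ m ≡ c) ⊎ ((E m ≡ c ⊎ IntA (E m)) × ∃ λ x → E m ~₀ x × Far₀ (T₃ m) x × (∀ m′ → m′ ≢ m → Away x (T₃ m′) (E m′)))
        spread m h (inj₁ r) = inj₁ r
        spread m h (inj₂ (l , x , ex , tx , aw)) = inj₂ (l , x , ex , tx , h aw)
        e-loc : ∀ m → (E m ≡ o (pick₃ i j k m) × T₃ m ≡ a (pick₃ i j k m)) ⊎
          ((E m ≡ a (pick₃ i j k m) ⊎ IntA (E m)) × ∃ λ x → E m ~₀ x × Far₀ (T₃ m) x × (∀ m′ → m′ ≢ m → Away x (T₃ m′) (E m′)))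
        e-loc zero = spread zero (λ {x} (p , q) → each₃ {λ m′ → m′ ≢ zero → Away x (T₃ m′) (E m′)} (λ ne → ⊥-elim (ne refl)) (λ _ → p) (λ _ → q)) loc₁
        e-loc (suc zero) = spread (suc zero) (λ {x} (p , q) → each₃ {λ m′ → m′ ≢ suc zero → Away x (T₃ m′) (E m′)} (λ _ → p) (λ ne → ⊥-elim (ne refl)) (λ _ → q)) loc₂
        e-loc (suc (suc zero)) = spread (suc (suc zero)) (λ {x} (p , q) → each₃ {λ m′ → m′ ≢ suc (suc zero) → Away x (T₃ m′) (E m′)} (λ _ → p) (λ _ → q) (λ ne → ⊥-elim (ne refl))) loc₃
        separate : (E₁.e ≡ a i ⊎ IntA E₁.e) → (E₂.e ≡ a j ⊎ IntA E₂.e) → ∀ {v} → E₁.e ~₀ v → E₂.e ~₀ v → ⊥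
        separate l₁ l₂ {v} ev fv with clique? (a i) (a j) v
        ... | yes c = S.base-short E₁.eqD E₂.eqD c ev fv
        ... | no ¬c = ¬c (clique-absorb (aa ij) (in-clique l₁) (in-clique l₂) (Z.far⇒≢ (ee-far zero (suc zero) λ ()))
                        (inj₂ (~-sym (sub ev))) (inj₂ (~-sym (sub fv))))
          where
          in-clique : ∀ {z m} → z ≡ a m ⊎ IntA z → Clique (a i) (a j) z
          in-clique {m = m} (inj₁ refl) = a-close m i , a-close m j
          in-clique (inj₂ int) = int ≃-refl i , int ≃-refl j

        -- position 0, 1, 2 of the fan belongs to leg i, j, k
        ends : EndsAt (pick₃ i j k)
        ends = record
          { fan = record
            { t = pick₃ S.t₁ S.t₂ S.t₃ ; e = pick₃ E₁.e E₂.e E₃.e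
            ; tri = λ {m} {m′} → tri m m′ ; pend = pend ; te-far = λ {m} {m′} → te-far m m′ ; ee-far = λ {m} {m′} → ee-far m m′ }
          ; t-loc = t-loc ; e-loc = e-loc ; sep = separate }

      abstract
        ends-at : EndsAt (pick₃ i j k)
        ends-at = from spider
          where
          ¬A : ∀ {m m′} → m ≢ m′ → (∀ {z} → A z → z ≃ a m′) → ¬ A (o m)
          ¬A ne h c = o-off ne (h c)
          from : Spider → EndsAt (pick₃ i j k)
          from s = FromArms.ends s (arm-end (Spider.arm₁ s) (¬A ij proj₂)) (arm-end (Spider.arm₂ s) (¬A (ij ∘ sym) proj₁))
            (arm-end (Spider.arm₃ s) (¬A (ik ∘ sym) proj₁))

-- The cases P₆, N and W

module Conclusion {n : ℕ} (G₀ G : Graph n) (cf₀ : ClawFree G₀) (cf : ClawFree G) (df : DiamondFree G)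
  (sub : G₀ ⊑ G) (sp : Spanned G₀ G) where
  private module Z = Adjacency G₀
  open Adjacency G
  open Z using () renaming (_~_ to _~₀_; _≃_ to _≃₀_; Far to Far₀; IPath to IPath₀; one to one₀; cons to cons₀)
  open Cliques G df
  open Regions G₀ G cf₀ df sub sp
  open Large G₀ G cf df sub
  open Copies G₀
  open Ends G₀ G cf₀ cf df sub sp

  pick₃-injective : ∀ {i j k : Fin 3} → i ≢ j → i ≢ k → j ≢ k → ∀ m m′ → m ≢ m′ → pick₃ i j k m ≢ pick₃ i j k m′
  pick₃-injective {i} {j} {k} ij ik jk = off-diagonal₃ {λ m m′ → pick₃ i j k m ≢ pick₃ i j k m′} ij ik (ij ∘ sym) jk (ik ∘ sym) (jk ∘ sym)

  module Approach (T : Theta G₀ G) where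
    open Theta T
    module A = Side T

    to-exit : ∀ {i k} → i ≢ k → ∃ λ l → IPath₀ (a i) (A.o k) l × (∀ {z} → z ∈ l → z ≡ a i ⊎ A.Loc k z)
    to-exit {i} {k} ne with region-path (aa ne) (inj₁ refl , inj₂ (aa ne)) (inj₂ (~-sym (aa ne)) , inj₁ refl)
    ... | l , p , place with ipath₀-join p (cons₀ (Exit.ao (A.exit k)) (λ ()) one₀) only
      where
      only : ∀ {x y} → x ∈ l → y ∈ a k ∷ A.o k ∷ [] → x ≃₀ y → x ≡ a k ⊎ y ≡ a k
      only i (here eq) c = inj₂ eq
      only i (there (here refl)) c with place i
      ... | inj₁ refl = ⊥-elim (A.o-off (ne ∘ sym) (≃-sym (≃₀⇒≃ c)))
      ... | inj₂ (inj₁ eq) = inj₁ eq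
      ... | inj₂ (inj₂ int) = ⊥-elim (A.o-off (ne ∘ sym) (A.interior ne int (≃-sym (≃₀⇒≃ c)) _))
    ... | r , q , mem , _ = r , q , at
      where
      at : ∀ {z} → z ∈ r → z ≡ a i ⊎ A.Loc k z
      at j with mem j
      ... | inj₂ (here refl) = inj₂ (inj₂ (inj₁ refl))
      ... | inj₂ (there (here refl)) = inj₂ (inj₁ refl)
      ... | inj₁ j′ with place j′
      ...   | inj₁ eq = inj₁ eq
      ...   | inj₂ (inj₁ eq) = inj₂ (inj₂ (inj₁ eq))
      ...   | inj₂ (inj₂ int) = inj₂ (inj₂ (inj₂ (A.interior ne int)))

  module TwoSides (T : Theta G₀ G) where
    open Theta T
    open ThetaFacts T sub
    module A = Side T
    module B = Side (theta-flip T)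
    open Approach (theta-flip T) public using (to-exit)

    across : ∀ {i k} → i ≢ k → ∀ {e f} → A.Loc i e → B.Loc k f → Far e f
    across {k = k} ne l (inj₁ refl) = A.beyond ne l (Exit.o∈ (B.exit k)) (Exit.o≢b (B.exit k))
    across {k = k} ne l (inj₂ (inj₁ refl)) = A.beyond ne l (b∈ k) (a≢b k ∘ sym)
    across {k = k} ne l (inj₂ (inj₂ int)) c = A.beyond ne l (b∈ k) (a≢b k ∘ sym) (int c k)

  -- The Hamilton cycle as an alternative is there for W: when two legs are triangles, the net at a
  -- corner may have no extension to a wounded with the wanted end.
  BigEnds : Theta G₀ G → Set
  BigEnds T = ∀ {i j k} (ij : i ≢ j) (ik : i ≢ k) (jk : j ≢ k) →
    (∀ m → Big (Side.EndsAt.e (Side.ends-at T ij ik jk) m)) ⊎ HamiltonianCycle G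

  -- An end inside the clique of the b i, on leg k, is far from the ends of the other two legs at the clique of the a i.
  big-ends-kill : ∀ T → BigEnds T → BigEnds (theta-flip T) → HamiltonianCycle G
  big-ends-kill T bigA bigB = bottom (bigB {zero} {suc zero} {suc (suc zero)} (λ ()) (λ ()) (λ ()))
    where
    open Theta T
    open TwoSides T
    module E = B.EndsAt (B.ends-at {zero} {suc zero} {suc (suc zero)} (λ ()) (λ ()) (λ ()))
    Inside : Fin 3 → V → Set
    Inside k f = f ≡ b k ⊎ B.IntA f
    outer : ∀ {i j} → i ≢ j → ∀ {e} → e ≡ a j ⊎ A.IntA e → Far (A.o i) e
    outer ij (inj₁ refl) = A.o-off ij
    outer {j = j} ij (inj₂ int) c = A.o-off ij (int c j)
    pair : ∀ {i j} → i ≢ j → ∀ {e e′} → A.Loc i e → A.Loc j e′ →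
      Far e e′ ⊎ ((e ≡ a i ⊎ A.IntA e) × (e′ ≡ a j ⊎ A.IntA e′))
    pair ij (inj₂ l) (inj₂ l′) = inj₂ (l , l′)
    pair ij (inj₁ refl) (inj₁ refl) = inj₁ (A.o-far ij)
    pair {i} {j} ij (inj₁ refl) (inj₂ l) = inj₁ (outer ij l)
    pair {i} {j} ij (inj₂ l) (inj₁ refl) = inj₁ (far-sym (outer (ij ∘ sym) l))
    -- The leg of `f` is put last, so that the two ends compared at the other corner are in the
    -- positions for which `sep` holds.
    top : ∀ {i j k} → i ≢ j → i ≢ k → j ≢ k → ∀ {f} → Big f → Inside k f → HamiltonianCycle G
    top {i} {j} {k} ij ik jk {f} bf l with bigA ij ik jk
    ... | inj₂ h = h
    ... | inj₁ big = strike (pair ij (F.loc zero) (F.loc (suc zero)))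
      where
      module F = A.EndsAt (A.ends-at ij ik jk)
      far₀ : Far (F.e zero) f
      far₀ = across ik (F.loc zero) (inj₂ l)
      far₁ : Far (F.e (suc zero)) f
      far₁ = across jk (F.loc (suc zero)) (inj₂ l)
      01-far : Far₀ (F.e zero) (F.e (suc zero))
      01-far = F.ee-far (λ ())
      strike : _ → HamiltonianCycle G
      strike (inj₁ far) = far-kill (big zero) (big (suc zero)) bf far far₀ far₁
      strike (inj₂ (l₀ , l₁)) = ⊥-elim (clique-kill (big zero) (big (suc zero)) bf (Z.far⇒≢ 01-far) (01-far ∘ inj₂) (F.sep l₀ l₁) far₀ far₁)
    bottom : (∀ m → Big (E.e m)) ⊎ HamiltonianCycle G → HamiltonianCycle G
    bottom (inj₂ h) = h
    bottom (inj₁ big) with E.loc zero | E.loc (suc zero) | E.loc (suc (suc zero))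
    ... | inj₂ l | _ | _ = top {suc zero} {suc (suc zero)} {zero} (λ ()) (λ ()) (λ ()) (big zero) l
    ... | inj₁ _ | inj₂ l | _ = top {zero} {suc (suc zero)} {suc zero} (λ ()) (λ ()) (λ ()) (big (suc zero)) l
    ... | inj₁ _ | inj₁ _ | inj₂ l = top {zero} {suc zero} {suc (suc zero)} (λ ()) (λ ()) (λ ()) (big (suc (suc zero))) l
    ... | inj₁ e₀ | inj₁ e₁ | inj₁ e₂ = far-kill (subst Big e₀ (big zero)) (subst Big e₁ (big (suc zero))) (subst Big e₂ (big (suc (suc zero))))
      (B.o-far (λ ())) (B.o-far (λ ())) (B.o-far (λ ()))

  net-case : (∀ v → EndVertexOfInduced G₀ N v → Big v) → Theta G₀ G → HamiltonianCycle G
  net-case phi T = big-ends-kill T (big T) (big (theta-flip T))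
    where
    big : ∀ T → BigEnds T
    big T ij ik jk = inj₁ λ m → phi _ (net-copy (Side.EndsAt.fan (Side.ends-at T ij ik jk)) m)

  path-case : (∀ v → EndVertexOfInduced G₀ P6 v → Big v) → Theta G₀ G → HamiltonianCycle G
  path-case phi T = far-kill (big {suc zero} {suc (suc zero)} {zero} (λ ()) (λ ()) (λ ()))
      (big {zero} {suc (suc zero)} {suc zero} (λ ()) (λ ()) (λ ())) (big {zero} {suc zero} {suc (suc zero)} (λ ()) (λ ()) (λ ()))
      (A.o-far (λ ())) (A.o-far (λ ())) (A.o-far (λ ()))
    where
    open Theta T
    open ThetaFacts T sub
    open TwoSides T
    module R = Approach T
    leg : ∀ {a b vs} → Shape G₀ a b vs → ∃ λ l → IPath₀ a b l × (∀ {z} → z ∈ l → z ∈ vs)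
    leg (long p _ inl) = _ , p , inl
    leg (tee ab _ _ a∈ b∈ _) = _ , cons₀ ab (λ ()) one₀ , λ { (here refl) → a∈ ; (there (here refl)) → b∈ }
    -- o k ⇝ a i, along leg i, then b i ⇝ o′ j
    module Along {i j k : Fin 3} (ij : i ≢ j) (ik : i ≢ k) (jk : j ≢ k)
      {l} (p : IPath₀ (A.o k) (a i) l) (place : ∀ {z} → z ∈ l → z ≡ a i ⊎ A.Loc k z)
      {m} (q : IPath₀ (a i) (b i) m) (inm : ∀ {z} → z ∈ m → z ∈ vs i)
      {s} (r : IPath₀ (b i) (B.o j) s) (place′ : ∀ {z} → z ∈ s → z ≡ b i ⊎ B.Loc j z) where

      first : ∀ {x y} → x ∈ l → y ∈ m → x ≃₀ y → x ≡ a i ⊎ y ≡ a i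
      first {x} {y} x∈ y∈ c = cases (place x∈) (y ≟ a i)
        where
        cases : x ≡ a i ⊎ A.Loc k x → Dec (y ≡ a i) → x ≡ a i ⊎ y ≡ a i
        cases (inj₁ eq) _ = inj₁ eq
        cases (inj₂ _) (yes eq) = inj₂ eq
        cases (inj₂ loc) (no ne) = ⊥-elim (A.beyond (ik ∘ sym) loc (inm y∈) ne (≃₀⇒≃ c))

      second : ∀ {x y} → x ∈ l ⊎ x ∈ m → y ∈ s → x ≃₀ y → x ≡ b i ⊎ y ≡ b i
      second {x} {y} x∈ y∈ c = cases (place′ y∈) x∈ (x ≟ b i)
        where
        before : x ≡ a i ⊎ A.Loc k x → B.Loc j y → ⊥
        before (inj₁ refl) loc′ = across ij (inj₂ (inj₁ refl)) loc′ (≃₀⇒≃ c)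
        before (inj₂ loc) loc′ = across (jk ∘ sym) loc loc′ (≃₀⇒≃ c)
        cases : y ≡ b i ⊎ B.Loc j y → x ∈ l ⊎ x ∈ m → Dec (x ≡ b i) → x ≡ b i ⊎ y ≡ b i
        cases (inj₁ eq) _ _ = inj₂ eq
        cases (inj₂ loc′) (inj₁ x∈) _ = ⊥-elim (before (place x∈) loc′)
        cases (inj₂ _) (inj₂ _) (yes eq) = inj₁ eq
        cases (inj₂ loc′) (inj₂ x∈) (no ne) = ⊥-elim (B.beyond (ij ∘ sym) loc′ (inm x∈) ne (≃-sym (≃₀⇒≃ c)))

      long-path : EndVertexOfInduced G₀ P6 (A.o k)
      long-path = extend₁ (ipath₀-join p q first)
        where
        far-start : Far₀ (A.o k) (a i)
        far-start = far⇒far₀ (A.o-off (ik ∘ sym))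
        far-end : Far₀ (b i) (B.o j)
        far-end = Z.far-sym (far⇒far₀ (B.o-off (ij ∘ sym)))
        -- At least three vertices up to `a i`, two on the leg and three from `b i` on, with `a i`
        -- and `b i` counted twice: six in all.
        extend₂ : ∀ {l₂} → 4 ≤ length l₂ →
          (∃ λ l₃ → IPath₀ (A.o k) (B.o j) l₃ × (∀ {z} → z ∈ l₃ → z ∈ l₂ ⊎ z ∈ s) × suc (length l₃) ≡ length l₂ + length s) → EndVertexOfInduced G₀ P6 (A.o k)
        extend₂ four (_ , p₃ , _ , len) = path-copy p₃ (ℕ.≤-pred (subst (7 ≤_) (sym len) (ℕ.+-mono-≤ four (far-length r far-end))))
        extend₁ : (∃ λ l₂ → IPath₀ (A.o k) (b i) l₂ × (∀ {z} → z ∈ l₂ → z ∈ l ⊎ z ∈ m) × suc (length l₂) ≡ length l + length m) → EndVertexOfInduced G₀ P6 (A.o k)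
        extend₁ (_ , p₂ , mem , len) = extend₂ (ℕ.≤-pred (subst (5 ≤_) (sym len) (ℕ.+-mono-≤ (far-length p far-start) (≢-length q (a≢b i)))))
          (ipath₀-join p₂ r (λ x∈ → second (mem x∈)))

    big : ∀ {i j k} → i ≢ j → i ≢ k → j ≢ k → Big (A.o k)
    big {i} {j} {k} ij ik jk = let
        (l , p , place) = R.to-exit {i} {k} ik
        (m , q , inm) = leg (shape i)
        (s , r , place′) = to-exit {i} {j} ij
        (l′ , p′ , l′⊆ , _) = Z.ipath-reverse p
      in phi _ (Along.long-path ij ik jk p′ (λ i → place (l′⊆ i)) q inm r place′)

  two-steps : ∀ {u v l} → IPath₀ u v l → Far₀ u v → ∃ λ x → ∃ λ y → u ~₀ x × x ~₀ y × Far₀ u y × x ∈ l × y ∈ l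
  two-steps one₀ f = ⊥-elim (f Z.≃-refl)
  two-steps (cons₀ e _ one₀) f = ⊥-elim (f (inj₂ e))
  two-steps (cons₀ e f (cons₀ e′ _ _)) _ = _ , _ , e , e′ , f (here refl) , there (here refl) , there (there (here refl))

  module Wounded (phi : ∀ v → EndVertexOfInduced G₀ W v → Big v) where

    module AdjacentTees (T : Theta G₀ G) where
      open Theta T
      open ThetaFacts T sub
      open TwoSides T

      Tee : Fin 3 → Set
      Tee i = a i ~₀ b i × A.o i ~₀ b i

      module _ {i j k : Fin 3} (ij : i ≢ j) (ik : i ≢ k) (jk : j ≢ k) (tee-i : Tee i) (adj-ij : a i ~₀ a j) where

        private
          ab = proj₁ tee-i
          ob = proj₂ tee-i
          ao : ∀ m → a m ~₀ A.o m
          ao m = Exit.ao (A.exit m)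
          bi-aj : Far (b i) (a j)
          bi-aj = off-a ij (b∈ i) (a≢b i ∘ sym)
          bi-oj : Far (b i) (A.o j)
          bi-oj = far-sym (A.beyond (ij ∘ sym) (inj₁ refl) (b∈ i) (a≢b i ∘ sym))

          far : ∀ {i k} → i ≢ k → ∀ {s t} → A.Loc i s → B.Loc k t → Far₀ s t
          far ne l l′ = far⇒far₀ (across ne l l′)
          loc-o : ∀ m → A.Loc m (A.o m)
          loc-o m = inj₁ refl
          loc-a : ∀ m → A.Loc m (a m)
          loc-a m = inj₂ (inj₁ refl)

        module _ {y₁ y₂} (e : b i ~₀ y₁) (e′ : y₁ ~₀ y₂) (f : Far₀ (b i) y₂) (l₁ : B.Loc k y₁) (l₂ : B.Loc k y₂) where

          tip-copy : EndVertexOfInduced G₀ W (A.o j)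
          tip-copy = wounded ob (Z.~-sym ab) (Z.~-sym (ao i)) e adj-ij (ao j)
            (far ik (loc-o i) l₁) (far⇒far₀ (A.o-off ij)) (far⇒far₀ (A.o-far ij)) (far⇒far₀ bi-aj) (far⇒far₀ bi-oj)
            (far ik (loc-a i) l₁) (Z.far-sym (far⇒far₀ (A.o-off (ij ∘ sym)))) (Z.far-sym (far jk (loc-a j) l₁)) (Z.far-sym (far jk (loc-o j) l₁))

          step-copy : EndVertexOfInduced G₀ W y₂
          step-copy = wounded (Z.~-sym (ao i)) ab ob adj-ij e e′
            (far⇒far₀ (A.o-off ij)) (far ik (loc-o i) l₁) (far ik (loc-o i) l₂) (far ik (loc-a i) l₁) (far ik (loc-a i) l₂)
            (far⇒far₀ bi-aj) f (far jk (loc-a j) l₁) (far jk (loc-a j) l₂)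

        -- Both copies use the triangle `a i`, `b i`, `A.o i`. One takes the path from `a i` over
        -- `a j` to `A.o j` and a pendant edge at `b i`; the other takes two steps from `b i`
        -- towards the exit of leg `k` and the pendant edge from `a i` to `a j`.
        tees : Big (A.o j) × ∃ λ y → Big y × B.Loc k y
        tees = from (to-exit ik)
          where
          beyond-b : ∀ {y} → y ≢ b i → y ≡ b i ⊎ B.Loc k y → B.Loc k y
          beyond-b ne (inj₁ eq) = ⊥-elim (ne eq)
          beyond-b ne (inj₂ l) = l
          from : (∃ λ l → IPath₀ (b i) (B.o k) l × (∀ {z} → z ∈ l → z ≡ b i ⊎ B.Loc k z)) → Big (A.o j) × ∃ λ y → Big y × B.Loc k y
          from (_ , q , place) = let
              (y₁ , y₂ , e , e′ , f , y₁∈ , y₂∈) = two-steps q (Z.far-sym (far⇒far₀ (B.o-off (ik ∘ sym))))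
              l₁ = beyond-b (Z.~⇒≢ e ∘ sym) (place y₁∈)
              l₂ = beyond-b (Z.far⇒≢ f ∘ sym) (place y₂∈)
            in phi _ (tip-copy e e′ f l₁ l₂) , y₂ , phi _ (step-copy e e′ f l₁ l₂) , l₂

      -- Using `tees` from either triangle makes `A.o i` and `A.o j` large, along with a vertex of
      -- leg `k` at the opposite corner. These three are pairwise far.
      tees-kill : ∀ {i j k} → i ≢ j → i ≢ k → j ≢ k → Tee i → Tee j → a i ~₀ a j → HamiltonianCycle G
      tees-kill ij ik jk ti tj e = strike (tees ij ik jk ti e) (tees (ij ∘ sym) jk ik tj (Z.~-sym e))
        where
        strike : _ → _ → HamiltonianCycle G
        strike (bj , y , by , ly) (bi , _) = far-kill bi bj by (A.o-far ij) (across ik (inj₁ refl) ly) (across jk (inj₁ refl) ly)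

    big-ends : ∀ T → BigEnds T
    big-ends T {i} {j} {k} ij ik jk = collect (end zero (suc zero) (suc (suc zero)) (λ ()) (λ ()) (λ ()))
        (end (suc zero) zero (suc (suc zero)) (λ ()) (λ ()) (λ ())) (end (suc (suc zero)) zero (suc zero) (λ ()) (λ ()) (λ ()))
      where
      open Theta T
      module A = Side T
      module F = A.EndsAt (A.ends-at ij ik jk)
      open AdjacentTees T using (Tee; tees-kill)
      ι : Fin 3 → Fin 3
      ι = pick₃ i j k
      ι-inj : ∀ {m m′} → m ≢ m′ → ι m ≢ ι m′
      ι-inj {m} {m′} = pick₃-injective ij ik jk m m′
      -- The net becomes a wounded with end `e p` once the pendant edge of `q` extends by a vertex
      -- `x`: the next one on the arm if `e q` is still in the clique, the next one on the leg if
      -- `e q` is the exit of a long leg. Only a triangle leg prevents this. If both other legs are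
      -- triangles, their feet are adjacent in `G₀` as vertices of the net, as `tees-kill` demands.
      prolong : ∀ p q r → p ≢ q → p ≢ r → q ≢ r → Big (F.e p) ⊎ (F.t q ≡ a (ι q) × Tee (ι q))
      prolong p q r pq pr qr with F.e-loc q
      ... | inj₂ (_ , x , ex , tx , away) =
        inj₁ (phi _ (wounded-copy F.fan pq pr qr ex tx (proj₁ (away p pq)) (proj₂ (away p pq)) (proj₁ (away r (qr ∘ sym)))))
      ... | inj₁ (eo , ta) with Exit.kind (A.exit (ι q))
      ...   | inj₁ t = inj₂ (ta , t)
      ...   | inj₂ (x , ox , ax , x∈) = inj₁ (phi _ (wounded-copy F.fan pq pr qr (subst (_~₀ x) (sym eo) ox) (subst (λ s → Far₀ s x) (sym ta) ax)
                (out (ι-inj pq) (inj₂ (F.t-loc p))) (out (ι-inj pq) (F.loc p)) (out (ι-inj (qr ∘ sym)) (inj₂ (F.t-loc r)))))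
        where
        out : ∀ {m} → m ≢ ι q → ∀ {s} → A.Loc m s → Far₀ s x
        out ne l = far⇒far₀ (A.beyond ne l x∈ (Z.far⇒≢ ax ∘ sym))
      end : ∀ p q r → p ≢ q → p ≢ r → q ≢ r → Big (F.e p) ⊎ HamiltonianCycle G
      end p q r pq pr qr with prolong p q r pq pr qr | prolong p r q pr pq (qr ∘ sym)
      ... | inj₁ big | _ = inj₁ big
      ... | inj₂ _ | inj₁ big = inj₁ big
      ... | inj₂ (tq , Tq) | inj₂ (tr , Tr) =
        inj₂ (tees-kill (ι-inj qr) (ι-inj (pq ∘ sym)) (ι-inj (pr ∘ sym)) Tq Tr (subst₂ _~₀_ tq tr (F.tri qr)))
      collect : Big (F.e zero) ⊎ HamiltonianCycle G → Big (F.e (suc zero)) ⊎ HamiltonianCycle G → Big (F.e (suc (suc zero))) ⊎ HamiltonianCycle G →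
        (∀ m → Big (F.e m)) ⊎ HamiltonianCycle G
      collect (inj₂ h) _ _ = inj₂ h
      collect (inj₁ _) (inj₂ h) _ = inj₂ h
      collect (inj₁ _) (inj₁ _) (inj₂ h) = inj₂ h
      collect (inj₁ x) (inj₁ y) (inj₁ z) = inj₁ (each₃ x y z)

    wounded-case : Theta G₀ G → HamiltonianCycle G
    wounded-case T = big-ends-kill T (big-ends T) (big-ends (theta-flip T))

  theta-case : ∀ H → Phi G₀ H 3 → Theta G G → HamiltonianCycle G
  theta-case P6 phi T = path-case phi (realise T)
  theta-case N phi T = net-case phi (realise T)
  theta-case W phi T = Wounded.wounded-case phi (realise T)

-- From the closure back to the given graph

module _ {n : ℕ} (G₀ G : Graph n) (sub : G₀ ⊑ G) where
  open Adjacency G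
  open Search G

  two-connected-on : TwoConnected G₀ → TwoConnectedOn (λ _ → true)
  two-connected-on (_ , conn , rob) = record { connected = λ _ _ → reach (conn _ _) ; robust = λ _ _ _ u≢x v≢x → avoid u≢x (rob _ _ _ u≢x v≢x) }
    where
    reach : ∀ {u v} → Reach G₀ u v → Walk (λ _ → true ≡ true) u v
    reach here = stop refl
    reach (step e r) = go refl (sub e) (reach r)
    avoid : ∀ {x u v} → u ≢ x → ReachAvoiding G₀ x u v → Walk (λ z → true ≡ true × z ≢ x) u v
    avoid u≢x here = stop (refl , u≢x)
    avoid u≢x (step e v≢x r) = go (refl , u≢x) (sub e) (avoid v≢x r)

module _ {n : ℕ} (G : Graph n) where
  open Adjacency G

  closed-linked : ∀ {u v w l} → Path u v l → v ~ w → Linked _~_ (l ++ [ w ])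
  closed-linked one e = e ∷ [-]
  closed-linked (cons f one) e = f ∷ e ∷ [-]
  closed-linked (cons f p@(cons _ _)) e = f ∷ closed-linked p e

  hamiltonian-cycle : HamiltonianCycle G → Hamiltonian G
  hamiltonian-cycle (_ , _ , _ , p@one , vu , un , _ , all) = _ , _ , un , (λ _ → all tt) , closed-linked p vu
  hamiltonian-cycle (_ , _ , _ , p@(cons _ _) , vu , un , _ , all) = _ , _ , un , (λ _ → all tt) , closed-linked p vu

theorem5 : (H : Forbidden) (n : ℕ) (G : Graph n) →
    ClawFree G → TwoConnected G → Phi G H 3 → Hamiltonian G
theorem5 H (suc (suc (suc n))) G cf tc phi =
  hamiltonian-cycle G (C.hamiltonian (cycle (theta-or-cycle _ (λ _ → true) ℕ.≤-refl (two-connected-on G C.closure C.extends tc)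
    (zero , suc zero , refl , refl , λ ()))))
  where
  module C = Closure (closure-of G cf)
  open Extraction C.closure C.clawFree C.diamondFree
  cycle : Theta C.closure C.closure ⊎ HamiltonianCycleOn C.closure (λ _ → true ≡ true) → HamiltonianCycle C.closure
  cycle (inj₁ θ) = Conclusion.theta-case G C.closure cf C.clawFree C.diamondFree C.extends C.spanned H phi θ
  cycle (inj₂ (u , v , l , p , e , un , _ , all)) = u , v , l , p , e , un , (λ _ → tt) , (λ _ → all refl)
theorem5 H zero G cf (() , _) phi
theorem5 H (suc zero) G cf (s≤s () , _) phi
theorem5 H (suc (suc zero)) G cf (s≤s (s≤s ()) , _) phi
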